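{- Let $m\ge 3$ and $N\ge 0$ be integers, and let $$\Delta_N=\det\bigl(\gamma^{(2m)}_{i+j+3-m}(t)\bigr)_{i,j=0}^{N-1}.$$ Then \begin{itemize} \item if $N=mn$ for an integer $n\ge0$, then $\Delta_N=\xi\, t^{m^2n(n-1)/2}\,[n+1]_{t^m}^2$; \item if $N=mn-1$ for an integer $n\ge1$, then $\Delta_N=(-1)^{m-1}\xi\, t^{m(n-1)(mn-2)/2}\,R(m;t,n-1)$; \item if $N=mn-2$ for an integer $n\ge1$, then $\Delta_N=-\xi\, t^{m(n-1)(mn-4)/2}\,[n]_{t^m}^2$; \item in all other cases $\Delta_N=0$. \end{itemize} Here $\xi=(-1)^{nm(m-1)/2}$, with $n$ the integer from the respective case, and $$R(m;t,n)=m[m]_t\Bigl(\sum_{i=0}^{n}\binom{i+2}{2}t^{mi}+\sum_{i=n+1}^{2n}\binom{2n-i+2}{2}t^{mi}\Bigr).$$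
   Context: Let $t$ be an indeterminate. The Narayana polynomials are $\gamma_0(t)=1$ and, for $n\ge1$, $\gamma_n(t)=\sum_{k=0}^{n-1}\binom{n}{k}\binom{n-1}{k}\frac{1}{k+1}t^k$. Their generating function $\gamma(t,q)=\sum_{n\ge0}\gamma_n(t)q^n$ satisfies $-1+(1-q+tq)\gamma(t,q)-tq\,\gamma(t,q)^2=0$. For an integer $m\ge1$, the polynomials $\gamma^{(2m)}_n(t)$, $n\ge0$, are defined by $\sum_{n\ge0}\gamma^{(2m)}_n(t)q^n=\bigl((\gamma(t,q)-1)/q\bigr)^m$, and one sets $\gamma^{(2m)}_i(t)=0$ for $i<0$. For an integer $n\ge0$ and an indeterminate $x$, $[n]_x=1+x+\cdots+x^{n-1}$. The determinant of a $0\times0$ matrix is $1$. -}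

module Defs where

open import Data.Nat as ℕ using (ℕ; zero; suc)
open import Data.Nat.Combinatorics using (_C_)
open import Data.Integer as ℤ using (ℤ; +_; -[1+_])
open import Data.Fin using (Fin; zero; suc; punchIn)
open import Relation.Nullary using (yes; no)
open import Relation.Binary.PropositionalEquality using (_≡_)

-- Polynomials (more generally formal power series) in t with integer
-- coefficients, represented by their coefficient sequences.
Poly : Set
Poly = ℕ → ℤ

_≈ₚ_ : Poly → Poly → Set
p ≈ₚ q = ∀ k → p k ≡ q k

infix 4 _≈ₚ_

0ₚ : Poly
0ₚ _ = + 0

_+ₚ_ : Poly → Poly → Poly
(p +ₚ q) k = p k ℤ.+ q k

-ₚ_ : Poly → Poly
(-ₚ p) k = ℤ.- p k

_·ₚ_ : ℤ → Poly → Poly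
(c ·ₚ p) k = c ℤ.* p k

sumℤ : ℕ → (ℕ → ℤ) → ℤ
sumℤ zero f = + 0
sumℤ (suc n) f = sumℤ n f ℤ.+ f n

_*ₚ_ : Poly → Poly → Poly
(p *ₚ q) k = sumℤ (suc k) (λ i → p i ℤ.* q (k ℕ.∸ i))

infixl 6 _+ₚ_
infixl 7 _*ₚ_ _·ₚ_

tpow : ℕ → Poly
tpow e k with k ℕ.≟ e
... | yes _ = + 1
... | no _ = + 0

1ₚ : Poly
1ₚ = tpow 0

sumP : ℕ → (ℕ → Poly) → Poly
sumP zero f = 0ₚ
sumP (suc n) f = sumP n f +ₚ f n

-- Narayana polynomials γ_n(t)
-- (the quotient by k+1 is exact, so ℕ-division is the literal formula)
gamma : ℕ → Poly
gamma zero = 1ₚ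
gamma (suc n) =
  sumP (suc n) (λ k → (+ (((suc n C k) ℕ.* (n C k)) ℕ./ suc k)) ·ₚ tpow k)

-- coefficient of q^n in ((γ(t,q) - 1)/q)^m, i.e. the m-fold Cauchy power
-- (in q) of the sequence a_n = γ_{n+1}(t)
gammaPowN : ℕ → ℕ → Poly
gammaPowN zero n with n
... | zero = 1ₚ
... | suc _ = 0ₚ
gammaPowN (suc m) n = sumP (suc n) (λ k → gamma (suc k) *ₚ gammaPowN m (n ℕ.∸ k))

gamma2m : ℕ → ℤ → Poly
gamma2m m (+ n) = gammaPowN m n
gamma2m m -[1+ _ ] = 0ₚ

det : (n : ℕ) → (Fin n → Fin n → Poly) → Poly
det zero M = 1ₚ
det (suc n) M =
  sumFin (λ j → (sgn j ·ₚ M zero j) *ₚ det n (λ i k → M (suc i) (punchIn j k)))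
  where
  sumFin : ∀ {r} → (Fin r → Poly) → Poly
  sumFin {zero} f = 0ₚ
  sumFin {suc r} f = f zero +ₚ sumFin (λ j → f (suc j))
  sgn : ∀ {r} → Fin r → ℤ
  sgn zero = + 1
  sgn (suc j) = ℤ.- sgn j

Delta : ℕ → ℕ → Poly
Delta m N = det N (λ i j →
  gamma2m m (+ (Data.Fin.toℕ i ℕ.+ Data.Fin.toℕ j ℕ.+ 3) ℤ.- + m))
  where import Data.Fin

qint : ℕ → ℕ → Poly
qint m n = sumP n (λ i → tpow (m ℕ.* i))

sgnPow : ℕ → ℤ
sgnPow e = ℤ.-1ℤ ℤ.^ e

R : ℕ → ℕ → Poly
R m n = ((+ m) ·ₚ qint 1 m) *ₚ
  ( sumP (suc n) (λ i → (+ ((i ℕ.+ 2) C 2)) ·ₚ tpow (m ℕ.* i))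
  +ₚ sumP n (λ j → let i = suc n ℕ.+ j in
                    (+ (((2 ℕ.* n ℕ.∸ i) ℕ.+ 2) C 2)) ·ₚ tpow (m ℕ.* i)) )

xi : ℕ → ℕ → ℤ
xi m n = sgnPow ((n ℕ.* m ℕ.* (m ℕ.∸ 1)) ℕ./ 2)

{-# OPTIONS --safe #-}
-- Let u = γ − 1, so that u = q (1 + u) (1 + t u) and the entries of the Hankel
-- matrix are the coefficients of uᵐ at q^(i+j+3).  With x = 1/q and L the
-- linear functional L(xⁿ) = [qⁿ⁺¹] uᵐ, they are the values L(x² x^(i+j)), so
-- Δ_N is up to sign the Gram determinant of L on the polynomials of degree at
-- most N, bordered by the evaluation at 0.
--
-- Put τ = tᵐ.  As V = u⁻ᵐ + τ uᵐ is a monic polynomial of degree m in x, the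
-- continued fraction of uᵐ is periodic, and the polynomials W₀ = 1, W₁ = V,
-- W_(k+1) = V W_k − τ W_(k−1) make the Gram matrix block diagonal: in the bases
-- xʳ W_k (rows) and g_s W_k (columns), r, s < m, where g_s consists of the s + 1
-- leading coefficients of V, block k is antidiagonal with entries τᵏ.  In the
-- row basis only W_k is nonzero at 0, with value ± [k + 1]_τ; the evaluation of
-- the column basis enters through the constant and the linear coefficient of
-- V, the latter being ± m [m]_t.  Splitting off one block at a time computes
-- the bordered determinant; it vanishes unless the last, incomplete block has
-- 0, 1 or m − 1 rows.
module Submission where

open import Algebra using (CommutativeRing)
open import Level using (Level; 0ℓ; _⊔_)
open import Data.Nat as ℕ using (ℕ; zero; suc; _<_; _≤_; z≤n; s≤s; s≤s⁻¹)
import Data.Nat.Properties as ℕ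
import Data.Nat.DivMod as ℕ
open import Data.Nat.Combinatorics using (_C_; nC1≡n; k>n⇒nCk≡0; nCk+nC[k+1]≡[n+1]C[k+1])
open import Data.Nat.Solver using (module +-*-Solver)
open import Data.Integer as ℤ using (ℤ; +_; -[1+_])
import Data.Integer.Properties as ℤ
import Data.Integer.Solver as ℤ-Solver
open import Data.Maybe using (Maybe; just; nothing)
open import Data.Sign as Sign using (Sign)
open import Data.Product using (_×_; _,_; proj₁)
open import Data.Empty using (⊥-elim)
open import Function using (_∘_)
open import Relation.Nullary using (yes; no)
import Relation.Binary.PropositionalEquality as ≡
open ≡ using (_≡_; _≢_)

-- Why the border: the Hankel matrix is the Gram matrix of L without the row and the column of the
-- constant 1. Bordering the full Gram matrix by the functional f ↦ f(0) deletes both up to sign,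
-- and a bordered determinant survives every unitriangular change of either basis. Why these bases:
-- with a = u⁻ᵐ and b = τ uᵐ one has V = a + b and a b = τ, so W_k = aᵏ + aᵏ⁻¹ b + ... + bᵏ is a
-- Chebyshev polynomial of the second kind in V, and W_k uᵐ = W_(k-1) + τᵏ u^((k+1)m). The W_k are
-- thus denominators of convergents. Inside a block, powers of x on both sides would only clear one
-- side of the antidiagonal; the truncations g_s of V clear the other side. Why the values at 0: x =
-- (1 + u)(1 + t u)/u vanishes at u = -1, where a and b are (-1)ᵐ and (-1)ᵐ τ. The obstacle is that
-- τ is not invertible, so no block can be inverted and the elimination has to be free of
-- denominators. When the last block is complete, every block in turn can absorb the border; this
-- produces the sum of the τⁿ⁻ᵏ [k+1]² whose expansion is the bracket in R.

-- A ring solver with integer coefficients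

module IntegerCoefficientSolver {c ℓ : Level} (R : CommutativeRing c ℓ) where
  open CommutativeRing R
  open import Algebra.Properties.Semiring.Mult.TCOptimised semiring renaming (_×_ to _×ₙ_)
  open import Algebra.Properties.Ring ring
  open import Algebra.Properties.AbelianGroup +-abelianGroup using (⁻¹-∙-comm)
  open import Relation.Binary.Reasoning.Setoid setoid
  open import Algebra.Solver.Ring.AlmostCommutativeRing

  -- The solver has to compare coefficients, and equality in `R` need not be decidable. With the
  -- optimised multiples `ofℤ (+ 1)` computes to `1#`, so that `con (+ 1)` matches a literal `1#`.
  ofℤ : ℤ → Carrier
  ofℤ (+ n) = n ×ₙ 1#
  ofℤ -[1+ n ] = - (suc n ×ₙ 1#)

  x-0≈x : ∀ x → x + - 0# ≈ x
  x-0≈x x = trans (+-congˡ -0#≈0#) (+-identityʳ x)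

  cancelˡ : ∀ x y z → x + y + - (x + z) ≈ y + - z
  cancelˡ x y z = begin
    x + y + - (x + z)     ≈⟨ +-cong (+-comm x y) (sym (⁻¹-∙-comm x z)) ⟩
    y + x + (- x + - z)   ≈⟨ sym (+-assoc _ _ _) ⟩
    y + x + - x + - z     ≈⟨ +-congʳ (+-assoc _ _ _) ⟩
    y + (x + - x) + - z   ≈⟨ +-congʳ (+-congˡ (-‿inverseʳ x)) ⟩
    y + 0# + - z          ≈⟨ +-congʳ (+-identityʳ y) ⟩
    y + - z               ∎

  ofℤ-⊖ : ∀ m n → ofℤ (m ℤ.⊖ n) ≈ m ×ₙ 1# + - (n ×ₙ 1#)
  ofℤ-⊖ m zero = sym (x-0≈x _)
  ofℤ-⊖ zero (suc n) = sym (+-identityˡ _)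
  ofℤ-⊖ (suc m) (suc n) = begin
    ofℤ (suc m ℤ.⊖ suc n)                 ≡⟨ ≡.cong ofℤ (ℤ.[1+m]⊖[1+n]≡m⊖n m n) ⟩
    ofℤ (m ℤ.⊖ n)                         ≈⟨ ofℤ-⊖ m n ⟩
    m ×ₙ 1# + - (n ×ₙ 1#)                   ≈⟨ sym (cancelˡ 1# _ _) ⟩
    1# + m ×ₙ 1# + - (1# + n ×ₙ 1#)         ≈⟨ sym (+-cong (1+× m 1#) (-‿cong (1+× n 1#))) ⟩
    suc m ×ₙ 1# + - (suc n ×ₙ 1#)           ∎

  ofℤ-+ : ∀ x y → ofℤ (x ℤ.+ y) ≈ ofℤ x + ofℤ y
  ofℤ-+ (+ m) (+ n) = ×-homo-+ 1# m n
  ofℤ-+ (+ m) -[1+ n ] = ofℤ-⊖ m (suc n)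
  ofℤ-+ -[1+ m ] (+ n) = trans (ofℤ-⊖ n (suc m)) (+-comm _ _)
  ofℤ-+ -[1+ m ] -[1+ n ] = begin
    - (suc (suc (m ℕ.+ n)) ×ₙ 1#)          ≡⟨ ≡.cong (λ k → - (k ×ₙ 1#)) (≡.sym (≡.cong suc (ℕ.+-suc m n))) ⟩
    - ((suc m ℕ.+ suc n) ×ₙ 1#)            ≈⟨ -‿cong (×-homo-+ 1# (suc m) (suc n)) ⟩
    - (suc m ×ₙ 1# + suc n ×ₙ 1#)           ≈⟨ sym (⁻¹-∙-comm _ _) ⟩
    - (suc m ×ₙ 1#) + - (suc n ×ₙ 1#)       ∎

  ofℤ-neg : ∀ x → ofℤ (ℤ.- x) ≈ - ofℤ x
  ofℤ-neg (+ zero) = sym -0#≈0#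
  ofℤ-neg (+ suc n) = refl
  ofℤ-neg -[1+ n ] = sym (-‿involutive _)

  ofℤ-◃ : ∀ n → ofℤ (Sign.- ℤ.◃ n) ≈ - (n ×ₙ 1#)
  ofℤ-◃ zero = sym -0#≈0#
  ofℤ-◃ (suc n) = refl

  ofℤ-* : ∀ x y → ofℤ (x ℤ.* y) ≈ ofℤ x * ofℤ y
  ofℤ-* (+ m) (+ n) = trans (reflexive (≡.cong ofℤ (ℤ.+◃n≡+n (m ℕ.* n)))) (×1-homo-* m n)
  ofℤ-* (+ m) -[1+ n ] = trans (ofℤ-◃ (m ℕ.* suc n)) (trans (-‿cong (×1-homo-* m (suc n))) (-‿distribʳ-* _ _))
  ofℤ-* -[1+ m ] (+ n) = trans (ofℤ-◃ (suc m ℕ.* n)) (trans (-‿cong (×1-homo-* (suc m) n)) (-‿distribˡ-* _ _))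
  ofℤ-* -[1+ m ] -[1+ n ] = begin
    (suc m ℕ.* suc n) ×ₙ 1#                ≈⟨ ×1-homo-* (suc m) (suc n) ⟩
    (suc m ×ₙ 1#) * (suc n ×ₙ 1#)           ≈⟨ sym (-‿involutive _) ⟩
    - - ((suc m ×ₙ 1#) * (suc n ×ₙ 1#))     ≈⟨ -‿cong (-‿distribʳ-* _ _) ⟩
    - ((suc m ×ₙ 1#) * - (suc n ×ₙ 1#))     ≈⟨ -‿distribˡ-* _ _ ⟩
    - (suc m ×ₙ 1#) * - (suc n ×ₙ 1#)       ∎

  private
    ofℤ-morphism : CommutativeRing.rawRing ℤ.+-*-commutativeRing
                   -Raw-AlmostCommutative⟶ fromCommutativeRing R
    ofℤ-morphism = record
      { ⟦_⟧ = ofℤ ; +-homo = ofℤ-+ ; *-homo = ofℤ-* ; -‿homo = ofℤ-neg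
      ; 0-homo = refl ; 1-homo = refl }

    ofℤ-≟ : ∀ x y → Maybe (ofℤ x ≈ ofℤ y)
    ofℤ-≟ x y with x ℤ.≟ y
    ... | yes p = just (reflexive (≡.cong ofℤ p))
    ... | no _ = nothing

  open import Algebra.Solver.Ring
    (CommutativeRing.rawRing ℤ.+-*-commutativeRing) (fromCommutativeRing R) ofℤ-morphism ofℤ-≟
    public using (solve; _:=_; _:+_; _:*_; :-_; _:-_; con)

-- Determinants of matrices indexed by natural numbers

module Determinants {c ℓ : Level} (R : CommutativeRing c ℓ) where
  open CommutativeRing R hiding (zero)
  open import Algebra.Properties.Ring ring using (-‿distribˡ-*)
  open import Relation.Binary.Reasoning.Setoid setoid
  open IntegerCoefficientSolver R

  ∑ : ℕ → (ℕ → Carrier) → Carrier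
  ∑ zero f = 0#
  ∑ (suc n) f = f 0 + ∑ n (f ∘ suc)

  ∑-cong : ∀ n {f g : ℕ → Carrier} → (∀ i → i < n → f i ≈ g i) → ∑ n f ≈ ∑ n g
  ∑-cong zero h = refl
  ∑-cong (suc n) h = +-cong (h 0 (s≤s z≤n)) (∑-cong n (λ i i<n → h (suc i) (s≤s i<n)))

  ∑-zero : ∀ n {f : ℕ → Carrier} → (∀ i → i < n → f i ≈ 0#) → ∑ n f ≈ 0#
  ∑-zero zero h = refl
  ∑-zero (suc n) h =
    trans (+-cong (h 0 (s≤s z≤n)) (∑-zero n (λ i i<n → h (suc i) (s≤s i<n)))) (+-identityˡ 0#)

  ∑-+ : ∀ n (f g : ℕ → Carrier) → ∑ n (λ i → f i + g i) ≈ ∑ n f + ∑ n g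
  ∑-+ zero f g = sym (+-identityˡ 0#)
  ∑-+ (suc n) f g = trans (+-congˡ (∑-+ n (f ∘ suc) (g ∘ suc)))
    (solve 4 (λ a b x y → a :+ b :+ (x :+ y) := a :+ x :+ (b :+ y)) refl _ _ _ _)

  ∑-*ˡ : ∀ n a (f : ℕ → Carrier) → ∑ n (λ i → a * f i) ≈ a * ∑ n f
  ∑-*ˡ zero a f = sym (zeroʳ a)
  ∑-*ˡ (suc n) a f = trans (+-congˡ (∑-*ˡ n a (f ∘ suc))) (sym (distribˡ _ _ _))

  ∑-swap : ∀ m n (f : ℕ → ℕ → Carrier) →
    ∑ m (λ i → ∑ n (f i)) ≈ ∑ n (λ j → ∑ m (λ i → f i j))
  ∑-swap zero n f = sym (∑-zero n (λ _ _ → refl))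
  ∑-swap (suc m) n f =
    trans (+-congˡ (∑-swap m n (f ∘ suc))) (sym (∑-+ n (f 0) (λ j → ∑ m (λ i → f (suc i) j))))

  ∑-last : ∀ n (f : ℕ → Carrier) → ∑ (suc n) f ≈ ∑ n f + f n
  ∑-last zero f = +-comm _ _
  ∑-last (suc n) f = trans (+-congˡ (∑-last n (f ∘ suc))) (sym (+-assoc _ _ _))

  ∑-only : ∀ n {j} {f : ℕ → Carrier} → j < n → (∀ i → i < n → i ≢ j → f i ≈ 0#) → ∑ n f ≈ f j
  ∑-only (suc n) {zero} j<n h =
    trans (+-congˡ (∑-zero n (λ i i<n → h (suc i) (s≤s i<n) (λ ())))) (+-identityʳ _)
  ∑-only (suc n) {suc j} (s≤s j<n) h =
    trans (+-cong (h 0 (s≤s z≤n) (λ ()))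
                  (∑-only n j<n (λ i i<n i≢j → h (suc i) (s≤s i<n) (i≢j ∘ ℕ.suc-injective))))
          (+-identityˡ _)

  sg : ℕ → Carrier
  sg zero = 1#
  sg (suc j) = - sg j

  sg-+ : ∀ i j → sg (i ℕ.+ j) ≈ sg i * sg j
  sg-+ zero j = sym (*-identityˡ _)
  sg-+ (suc i) j = trans (-‿cong (sg-+ i j)) (-‿distribˡ-* _ _)

  sg-square : ∀ i → sg i * sg i ≈ 1#
  sg-square zero = *-identityˡ 1#
  sg-square (suc i) = trans (solve 1 (λ x → :- x :* :- x := x :* x) refl (sg i)) (sg-square i)

  skip : ℕ → ℕ → ℕ
  skip zero k = suc k
  skip (suc j) zero = zero
  skip (suc j) (suc k) = suc (skip j k)

  skip-< : ∀ j k → k < j → skip j k ≡ k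
  skip-< (suc j) zero k<j = ≡.refl
  skip-< (suc j) (suc k) (s≤s k<j) = ≡.cong suc (skip-< j k k<j)

  skip-≥ : ∀ j k → j ≤ k → skip j k ≡ suc k
  skip-≥ zero k j≤k = ≡.refl
  skip-≥ (suc j) (suc k) (s≤s j≤k) = ≡.cong suc (skip-≥ j k j≤k)

  skip-bound : ∀ j {k n} → k < n → skip j k < suc n
  skip-bound zero k<n = s≤s k<n
  skip-bound (suc j) {zero} k<n = s≤s z≤n
  skip-bound (suc j) {suc k} {suc n} (s≤s k<n) = s≤s (skip-bound j k<n)

  -- An infinite array, of which `det n` reads the leading n rows and columns; passing to a later
  -- block is then a mere shift of indices.
  Matrix : Set c
  Matrix = ℕ → ℕ → Carrier

  infix 9 _ᵀ
  _ᵀ : Matrix → Matrix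
  (M ᵀ) i j = M j i

  minor : Matrix → ℕ → Matrix
  minor M j i k = M (suc i) (skip j k)

  mutual
    det : ℕ → Matrix → Carrier
    det zero M = 1#
    det (suc n) M = ∑ (suc n) (laplace n M)

    laplace : ℕ → Matrix → ℕ → Carrier
    laplace n M j = sg j * M 0 j * det n (minor M j)

  det-cong : ∀ n {M M′ : Matrix} → (∀ i j → i < n → j < n → M i j ≈ M′ i j) → det n M ≈ det n M′
  det-cong zero h = refl
  det-cong (suc n) {M} {M′} h = ∑-cong (suc n) {laplace n M} {laplace n M′} λ j j<n →
    *-cong (*-congˡ (h 0 j (s≤s z≤n) j<n))
           (det-cong n (λ i k i<n k<n → h (suc i) (skip j k) (s≤s i<n) (skip-bound j k<n)))

  -- Expanding the first row and then the first columns of the minors gives a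
  -- double sum that is symmetric under transposition.
  det-ᵀ : ∀ n (M : Matrix) → det n M ≈ det n (M ᵀ)
  det-ᵀ zero M = refl
  det-ᵀ (suc zero) M = refl
  det-ᵀ (suc (suc n)) M = begin
    det (suc (suc n)) M
      ≈⟨ expand (det-ᵀ (suc n)) M ⟩
    corner M + ∑ (suc n) (λ j → ∑ (suc n) (term M j))
      ≈⟨ +-cong (*-congˡ (det-ᵀ (suc n) (minor M 0)))
                (trans (∑-swap (suc n) (suc n) (term M))
                  (∑-cong (suc n) {λ i → ∑ (suc n) (λ j → term M j i)} {λ i → ∑ (suc n) (term (M ᵀ) i)}
                    (λ i _ → ∑-cong (suc n) {λ j → term M j i} {term (M ᵀ) i} (λ j _ → term-ᵀ j i)))) ⟩
    corner (M ᵀ) + ∑ (suc n) (λ j → ∑ (suc n) (term (M ᵀ) j))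
      ≈⟨ sym (expand (det-ᵀ (suc n)) (M ᵀ)) ⟩
    det (suc (suc n)) (M ᵀ) ∎
    where
    corner : Matrix → Carrier
    corner N = sg 0 * N 0 0 * det (suc n) (minor N 0)
    inner : Matrix → ℕ → ℕ → Matrix
    inner N j i k i′ = N (suc (skip i i′)) (suc (skip j k))
    term : Matrix → ℕ → ℕ → Carrier
    term N j i = sg (suc j) * N 0 (suc j) * (sg i * N (suc i) 0 * det n (inner N j i))
    expand : (∀ N → det (suc n) N ≈ det (suc n) (N ᵀ)) → ∀ N → det (suc (suc n)) N ≈ corner N + ∑ (suc n) (λ j → ∑ (suc n) (term N j))
    expand ih N = +-congˡ (∑-cong (suc n) {laplace (suc n) N ∘ suc} {λ j → ∑ (suc n) (term N j)} λ j _ →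
      trans (*-congˡ {sg (suc j) * N 0 (suc j)} (ih (minor N (suc j))))
            (sym (∑-*ˡ (suc n) _ (λ i → sg i * N (suc i) 0 * det n (inner N j i)))))
    term-ᵀ : ∀ j i → term M j i ≈ term (M ᵀ) i j
    term-ᵀ j i = trans (*-congˡ (*-congˡ (det-ᵀ n (inner M j i))))
      (solve 5 (λ a b x y d → :- a :* x :* (b :* y :* d) := :- b :* y :* (a :* x :* d)) refl
        (sg j) (sg i) (M 0 (suc j)) (M (suc i) 0) (det n (inner (M ᵀ) i j)))

  det-linear-row : ∀ n {r} {L M N : Matrix} {α} → r < n →
    (∀ i j → i ≢ r → L i j ≈ M i j) → (∀ i j → i ≢ r → L i j ≈ N i j) →
    (∀ j → L r j ≈ α * M r j + N r j) → det n L ≈ α * det n M + det n N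
  det-linear-row (suc n) {zero} {L} {M} {N} {α} r<n LM LN Lr = begin
    det (suc n) L
      ≈⟨ ∑-cong (suc n) {laplace n L} {combined} (λ j _ →
           trans (*-congʳ (*-congˡ (Lr j)))
           (trans (solve 5 (λ s a b c d → s :* (a :* b :+ c) :* d := a :* (s :* b :* d) :+ s :* c :* d) refl _ _ _ _ _)
             (+-cong (*-congˡ (*-congˡ (det-cong n (λ i k _ _ → LM (suc i) (skip j k) (λ ())))))
                     (*-congˡ (det-cong n (λ i k _ _ → LN (suc i) (skip j k) (λ ()))))))) ⟩
    ∑ (suc n) combined
      ≈⟨ ∑-+ (suc n) (λ j → α * laplace n M j) (laplace n N) ⟩
    ∑ (suc n) (λ j → α * laplace n M j) + det (suc n) N
      ≈⟨ +-congʳ (∑-*ˡ (suc n) α (laplace n M)) ⟩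
    α * det (suc n) M + det (suc n) N ∎
    where
    combined : ℕ → Carrier
    combined j = α * laplace n M j + laplace n N j
  det-linear-row (suc n) {suc r} {L} {M} {N} {α} (s≤s r<n) LM LN Lr = begin
    det (suc n) L
      ≈⟨ ∑-cong (suc n) {laplace n L} {combined} (λ j _ →
           trans (*-congˡ (det-linear-row n {r} {minor L j} {minor M j} {minor N j} {α} r<n
                    (λ i k i≢r → LM (suc i) (skip j k) (i≢r ∘ ℕ.suc-injective))
                    (λ i k i≢r → LN (suc i) (skip j k) (i≢r ∘ ℕ.suc-injective))
                    (λ k → Lr (skip j k))))
           (trans (solve 5 (λ s x a b c → s :* x :* (a :* b :+ c) := a :* (s :* x :* b) :+ s :* x :* c) refl _ _ _ _ _)
             (+-cong (*-congˡ (*-congʳ (*-congˡ (LM 0 j (λ ()))))) (*-congʳ (*-congˡ (LN 0 j (λ ()))))))) ⟩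
    ∑ (suc n) combined
      ≈⟨ ∑-+ (suc n) (λ j → α * laplace n M j) (laplace n N) ⟩
    ∑ (suc n) (λ j → α * laplace n M j) + det (suc n) N
      ≈⟨ +-congʳ (∑-*ˡ (suc n) α (laplace n M)) ⟩
    α * det (suc n) M + det (suc n) N ∎
    where
    combined : ℕ → Carrier
    combined j = α * laplace n M j + laplace n N j

  -- In the expansion along row 0 the first two terms cancel, and every other minor still has the
  -- two equal columns in positions 0 and 1.
  det-columns-01 : ∀ n (M : Matrix) → (∀ i → M i 0 ≈ M i 1) → det (suc (suc n)) M ≈ 0#
  det-columns-01 n M h = begin
    sg 0 * M 0 0 * det (suc n) (minor M 0) + (sg 1 * M 0 1 * det (suc n) (minor M 1) + rest)
      ≈⟨ +-cong (*-cong (*-congˡ (h 0)) (det-cong (suc n) {minor M 0} {minor M 1} minors)) (+-congˡ (rest≈0 n)) ⟩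
    sg 0 * M 0 1 * det (suc n) (minor M 1) + (sg 1 * M 0 1 * det (suc n) (minor M 1) + 0#)
      ≈⟨ solve 3 (λ s x d → s :* x :* d :+ (:- s :* x :* d :+ con (+ 0)) := con (+ 0)) refl _ _ _ ⟩
    0# ∎
    where
    rest : Carrier
    rest = ∑ n (λ j → sg (suc (suc j)) * M 0 (suc (suc j)) * det (suc n) (minor M (suc (suc j))))
    minors : ∀ i k → i < suc n → k < suc n → minor M 0 i k ≈ minor M 1 i k
    minors i zero _ _ = sym (h (suc i))
    minors i (suc k) _ _ = refl
    rest≈0 : ∀ n → ∑ n (λ j → sg (suc (suc j)) * M 0 (suc (suc j)) * det (suc n) (minor M (suc (suc j)))) ≈ 0#
    rest≈0 zero = refl
    rest≈0 (suc n) = ∑-zero (suc n) {laplace (suc (suc n)) M ∘ suc ∘ suc} λ j _ →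
      trans (*-congˡ (det-columns-01 n (minor M (suc (suc j))) (λ i → h (suc i)))) (zeroʳ _)

  det-adjacent-rows : ∀ n r (M : Matrix) → suc r < n → (∀ j → M r j ≈ M (suc r) j) → det n M ≈ 0#
  det-adjacent-rows (suc zero) r M (s≤s ()) h
  det-adjacent-rows (suc (suc n)) zero M _ h = trans (det-ᵀ (suc (suc n)) M) (det-columns-01 n (M ᵀ) h)
  det-adjacent-rows (suc n) (suc r) M (s≤s r<n) h = ∑-zero (suc n) {laplace n M} λ j _ →
    trans (*-congˡ (det-adjacent-rows n r (minor M j) r<n (λ k → h (skip j k)))) (zeroʳ _)

  _[_↦_] : Matrix → ℕ → (ℕ → Carrier) → Matrix
  (M [ r ↦ v ]) i with i ℕ.≟ r
  ... | yes _ = v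
  ... | no _ = M i

  ↦-same : ∀ M r v j → (M [ r ↦ v ]) r j ≈ v j
  ↦-same M r v j with r ℕ.≟ r
  ... | yes _ = refl
  ... | no r≢r = ⊥-elim (r≢r ≡.refl)

  ↦-other : ∀ M {r} v i j → i ≢ r → (M [ r ↦ v ]) i j ≈ M i j
  ↦-other M {r} v i j i≢r with i ℕ.≟ r
  ... | yes i≡r = ⊥-elim (i≢r i≡r)
  ... | no _ = refl

  det-↦-+ : ∀ n {r} (M : Matrix) α u v → r < n →
    det n (M [ r ↦ (λ j → α * u j + v j) ]) ≈ α * det n (M [ r ↦ u ]) + det n (M [ r ↦ v ])
  det-↦-+ n {r} M α u v r<n = det-linear-row n r<n
    (λ i j i≢r → trans (↦-other M _ i j i≢r) (sym (↦-other M _ i j i≢r)))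
    (λ i j i≢r → trans (↦-other M _ i j i≢r) (sym (↦-other M _ i j i≢r)))
    (λ j → trans (↦-same M r _ j) (sym (+-cong (*-congˡ (↦-same M r u j)) (↦-same M r v j))))

  swapRows : ℕ → Matrix → Matrix
  swapRows r M = M [ suc r ↦ M r ] [ r ↦ M (suc r) ]

  ↦-cong : ∀ {M N : Matrix} r {u v : ℕ → Carrier} → (∀ i j → i ≢ r → M i j ≈ N i j) → (∀ j → u j ≈ v j) →
    ∀ i j → (M [ r ↦ u ]) i j ≈ (N [ r ↦ v ]) i j
  ↦-cong r MN uv i j with i ℕ.≟ r
  ... | yes _ = uv j
  ... | no i≢r = MN i j i≢r

  -- Polarisation of `det-adjacent-rows`: with w, the sum of the two rows, in both places the
  -- determinant vanishes; it expands into four terms, two of which have equal rows. The factors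
  -- `1#` only fit the form of `det-↦-+`.
  det-swap : ∀ n r (M : Matrix) → suc r < n → det n M + det n (swapRows r M) ≈ 0#
  det-swap n r M r<n = begin
    det n M + D (M (suc r)) (M r)
      ≈⟨ +-congʳ (det-cong n (λ i j _ _ → unchanged i j)) ⟩
    D (M r) (M (suc r)) + D (M (suc r)) (M r)
      ≈⟨ solve 2 (λ x y → x :+ y := con (+ 1) :* (con (+ 1) :* con (+ 0) :+ y) :+ (con (+ 1) :* x :+ con (+ 0))) refl _ _ ⟩
    1# * (1# * 0# + D (M (suc r)) (M r)) + (1# * D (M r) (M (suc r)) + 0#)
      ≈⟨ sym (+-cong (*-congˡ (+-congʳ (*-congˡ (D-same (M (suc r)))))) (+-congˡ (D-same (M r)))) ⟩
    1# * (1# * D (M (suc r)) (M (suc r)) + D (M (suc r)) (M r)) + (1# * D (M r) (M (suc r)) + D (M r) (M r))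
      ≈⟨ sym (+-cong (*-congˡ (D-+ʳ _ _ _)) (D-+ʳ _ _ _)) ⟩
    1# * D (M (suc r)) w + D (M r) w
      ≈⟨ sym (det-↦-+ n _ _ _ _ (ℕ.<-trans (ℕ.n<1+n r) r<n)) ⟩
    D w w
      ≈⟨ D-same w ⟩
    0# ∎
    where
    D : (ℕ → Carrier) → (ℕ → Carrier) → Carrier
    D u v = det n (M [ suc r ↦ v ] [ r ↦ u ])
    w : ℕ → Carrier
    w j = 1# * M (suc r) j + M r j
    r≢1+r : suc r ≢ r
    r≢1+r = ℕ.1+n≢n
    unchanged : ∀ i j → M i j ≈ (M [ suc r ↦ M (suc r) ] [ r ↦ M r ]) i j
    unchanged i j with i ℕ.≟ r
    ... | yes ≡.refl = refl
    ... | no _ with i ℕ.≟ suc r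
    ...   | yes ≡.refl = refl
    ...   | no _ = refl
    D-same : ∀ u → D u u ≈ 0#
    D-same u = det-adjacent-rows n r _ r<n λ j →
      trans (↦-same _ r u j) (sym (trans (↦-other _ u (suc r) j r≢1+r) (↦-same M (suc r) u j)))
    commute : ∀ u v i j → (M [ suc r ↦ v ] [ r ↦ u ]) i j ≈ (M [ r ↦ u ] [ suc r ↦ v ]) i j
    commute u v i j with i ℕ.≟ r | i ℕ.≟ suc r
    ... | yes p | yes q = ⊥-elim (r≢1+r (≡.trans (≡.sym q) p))
    ... | yes p | no q with i ℕ.≟ r
    ...   | yes _ = refl
    ...   | no p′ = ⊥-elim (p′ p)
    commute u v i j | no p | yes q with i ℕ.≟ suc r
    ...   | yes _ = refl
    ...   | no q′ = ⊥-elim (q′ q)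
    commute u v i j | no p | no q with i ℕ.≟ r | i ℕ.≟ suc r
    ...   | yes p′ | _ = ⊥-elim (p p′)
    ...   | no _ | yes q′ = ⊥-elim (q q′)
    ...   | no _ | no _ = refl
    -- `det-↦-+` acts on the outermost replacement, so the two replacements are exchanged before it
    -- is applied.
    D-+ʳ : ∀ u x y → D u (λ j → 1# * x j + y j) ≈ 1# * D u x + D u y
    D-+ʳ u x y = trans (det-cong n (λ i j _ _ → commute u _ i j))
      (trans (det-↦-+ n (M [ r ↦ u ]) 1# x y r<n)
        (sym (+-cong (*-congˡ (det-cong n (λ i j _ _ → commute u x i j))) (det-cong n (λ i j _ _ → commute u y i j)))))

  -- Induction on the distance of the rows: one swap moves the lower row one place up and changes
  -- only the sign.
  det-equal-rows : ∀ d n r (M : Matrix) → suc (d ℕ.+ r) < n →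
    (∀ j → M r j ≈ M (suc (d ℕ.+ r)) j) → det n M ≈ 0#
  det-equal-rows zero n r M r<n h = det-adjacent-rows n r M r<n h
  det-equal-rows (suc d) n r M r<n h = begin
    det n M                         ≈⟨ sym (+-identityʳ _) ⟩
    det n M + 0#                    ≈⟨ +-congˡ (sym swapped≈0) ⟩
    det n M + det n (swapRows q M)  ≈⟨ det-swap n q M r<n ⟩
    0#                              ∎
    where
    q : ℕ
    q = suc (d ℕ.+ r)
    r<q : r < q
    r<q = s≤s (ℕ.m≤n+m r d)
    swapped≈0 : det n (swapRows q M) ≈ 0#
    swapped≈0 = det-equal-rows d n r (swapRows q M) (ℕ.<-trans (ℕ.n<1+n q) r<n) λ j →
      trans (↦-other _ _ r j (ℕ.<⇒≢ r<q))
      (trans (↦-other M _ r j (ℕ.<⇒≢ (ℕ.m<n⇒m<1+n r<q)))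
      (trans (h j) (sym (↦-same _ q _ j))))

  det-add-earlier-rows : ∀ n r k (M : Matrix) (a : ℕ → Carrier) → r < n → k ≤ r →
    det n (M [ r ↦ (λ j → M r j + ∑ k (λ p → a p * M p j)) ]) ≈ det n M
  det-add-earlier-rows n r zero M a r<n k≤r = det-cong n λ i j _ _ → same i j
    where
    same : ∀ i j → (M [ r ↦ (λ j → M r j + 0#) ]) i j ≈ M i j
    same i j with i ℕ.≟ r
    ... | yes ≡.refl = +-identityʳ _
    ... | no _ = refl
  det-add-earlier-rows n r (suc k) M a r<n k<r = begin
    det n (M [ r ↦ (λ j → M r j + ∑ (suc k) (λ p → a p * M p j)) ])
      ≈⟨ det-cong n (λ i j _ _ → ↦-cong {M} {M} r (λ _ _ _ → refl) (λ j → trans (+-congˡ (∑-last k _))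
           (solve 3 (λ x y z → x :+ (y :+ z) := z :+ (x :+ y)) refl _ _ _)) i j) ⟩
    det n (M [ r ↦ (λ j → a k * M k j + (M r j + ∑ k (λ p → a p * M p j))) ])
      ≈⟨ det-↦-+ n M (a k) _ _ r<n ⟩
    a k * det n (M [ r ↦ M k ]) + det n (M [ r ↦ (λ j → M r j + ∑ k (λ p → a p * M p j)) ])
      ≈⟨ +-cong (trans (*-congˡ repeated) (zeroʳ _)) (det-add-earlier-rows n r k M a r<n (ℕ.<⇒≤ k<r)) ⟩
    0# + det n M
      ≈⟨ +-identityˡ _ ⟩
    det n M ∎
    where
    r≡ : suc ((r ℕ.∸ suc k) ℕ.+ k) ≡ r
    r≡ = ≡.trans (≡.sym (ℕ.+-suc (r ℕ.∸ suc k) k)) (ℕ.m∸n+n≡m k<r)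
    repeated : det n (M [ r ↦ M k ]) ≈ 0#
    repeated = det-equal-rows (r ℕ.∸ suc k) n k (M [ r ↦ M k ]) (≡.subst (_< n) (≡.sym r≡) r<n) λ j →
      trans (↦-other M _ k j (ℕ.<⇒≢ k<r))
        (trans (sym (↦-same M r (M k) j)) (reflexive (≡.cong (λ x → (M [ r ↦ M k ]) x j) (≡.sym r≡))))

  -- The rows are restored in increasing order. When row q is treated, the rows above it are already
  -- those of `M`, which are the ones that the combination in `N q` refers to.
  det-unitriangular : ∀ n (M N : Matrix) (a : ℕ → ℕ → Carrier) →
    (∀ i j → i < n → N i j ≈ M i j + ∑ i (λ p → a i p * M p j)) → det n N ≈ det n M
  det-unitriangular n M N a h = trans (stages n ℕ.≤-refl) (det-cong n λ i j i<n _ → done i j i<n)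
    where
    stage : ℕ → Matrix
    stage q i with i ℕ.<? q
    ... | yes _ = M i
    ... | no _ = N i
    done : ∀ i j → i < n → stage n i j ≈ M i j
    done i j i<n with i ℕ.<? n
    ... | yes _ = refl
    ... | no i≮n = ⊥-elim (i≮n i<n)
    stage-< : ∀ q i j → i < q → stage q i j ≈ M i j
    stage-< q i j i<q with i ℕ.<? q
    ... | yes _ = refl
    ... | no i≮q = ⊥-elim (i≮q i<q)
    stage-step : ∀ q i j → q < n →
      stage q i j ≈ (stage (suc q) [ q ↦ (λ j → stage (suc q) q j + ∑ q (λ p → a q p * stage (suc q) p j)) ]) i j
    stage-step q i j q<n with i ℕ.≟ q
    ... | yes ≡.refl = trans at-q (trans (h q j q<n)
           (+-cong (sym (stage-< (suc q) q j (ℕ.n<1+n q)))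
             (∑-cong q (λ p p<q → *-congˡ (sym (stage-< (suc q) p j (ℕ.m<n⇒m<1+n p<q)))))))
      where
      at-q : stage q q j ≈ N q j
      at-q with q ℕ.<? q
      ... | yes q<q = ⊥-elim (ℕ.<-irrefl ≡.refl q<q)
      ... | no _ = refl
    ... | no i≢q with i ℕ.<? q | i ℕ.<? suc q
    ...   | yes _ | yes _ = refl
    ...   | no _ | no _ = refl
    ...   | yes i<q | no i≮ = ⊥-elim (i≮ (ℕ.m<n⇒m<1+n i<q))
    ...   | no i≮q | yes i<1+q = ⊥-elim (i≮q (ℕ.≤∧≢⇒< (s≤s⁻¹ i<1+q) i≢q))
    stages : ∀ q → q ≤ n → det n N ≈ det n (stage q)
    stages zero _ = refl
    stages (suc q) q<n = trans (stages q (ℕ.<⇒≤ q<n))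
      (trans (det-cong n (λ i j _ _ → stage-step q i j q<n))
             (det-add-earlier-rows n q q (stage (suc q)) (a q) q<n ℕ.≤-refl))

-- Bordered determinants

extend : ∀ {a : Level} {A : Set a} → ℕ → (ℕ → A) → A → ℕ → A
extend zero f x _ = x
extend (suc n) f x zero = f 0
extend (suc n) f x (suc j) = extend n (f ∘ suc) x j

extend-< : ∀ {a : Level} {A : Set a} n (f : ℕ → A) x {j} → j < n → extend n f x j ≡ f j
extend-< (suc n) f x {zero} j<n = ≡.refl
extend-< (suc n) f x {suc j} (s≤s j<n) = extend-< n (f ∘ suc) x j<n

extend-last : ∀ {a : Level} {A : Set a} n (f : ℕ → A) x → extend n f x n ≡ x
extend-last zero f x = ≡.refl
extend-last (suc n) f x = extend-last n (f ∘ suc) x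

extend-+ : ∀ {a : Level} {A : Set a} m n (f : ℕ → A) x j →
  extend (m ℕ.+ n) f x (m ℕ.+ j) ≡ extend n (λ i → f (m ℕ.+ i)) x j
extend-+ zero n f x j = ≡.refl
extend-+ (suc m) n f x j = extend-+ m n (f ∘ suc) x j

module BorderedDeterminants {c ℓ : Level} (R : CommutativeRing c ℓ) where
  open CommutativeRing R hiding (zero)
  open import Algebra.Properties.Semiring.Exp semiring using (_^_)
  open import Relation.Binary.Reasoning.Setoid setoid
  open IntegerCoefficientSolver R
  open Determinants R

  det-zero-row : ∀ n (M : Matrix) → (∀ j → j < suc n → M 0 j ≈ 0#) → det (suc n) M ≈ 0#
  det-zero-row n M h = ∑-zero (suc n) {laplace n M} λ j j<n →
    trans (*-congʳ (trans (*-congˡ (h j j<n)) (zeroʳ _))) (zeroˡ _)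

  det-single-row : ∀ n {j} (M : Matrix) → j < suc n → (∀ k → k < suc n → k ≢ j → M 0 k ≈ 0#) →
    det (suc n) M ≈ laplace n M j
  det-single-row n M j<n h = ∑-only (suc n) {f = laplace n M} j<n λ k k<n k≢j →
    trans (*-congʳ (trans (*-congˡ (h k k<n k≢j)) (zeroʳ _))) (zeroˡ _)

  det-double-row : ∀ n {j} (M : Matrix) → j < n → (∀ k → k < n → k ≢ j → M 0 k ≈ 0#) →
    det (suc n) M ≈ laplace n M j + laplace n M n
  det-double-row n M j<n h = trans (∑-last n (laplace n M)) (+-congʳ (∑-only n {f = laplace n M} j<n λ k k<n k≢j →
    trans (*-congʳ (trans (*-congˡ (h k k<n k≢j)) (zeroʳ _))) (zeroˡ _)))

  det-zero-last-column : ∀ n (M : Matrix) → (∀ i → i < suc n → M i n ≈ 0#) → det (suc n) M ≈ 0#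
  det-zero-last-column zero M h = det-zero-row 0 M λ { zero _ → h 0 (s≤s z≤n) ; (suc j) (s≤s ()) }
  det-zero-last-column (suc n) M h = ∑-zero (suc (suc n)) {laplace (suc n) M} vanish
    where
    vanish : ∀ j → j < suc (suc n) → laplace (suc n) M j ≈ 0#
    vanish j j<n with j ℕ.≟ suc n
    ... | yes ≡.refl = trans (*-congʳ (trans (*-congˡ (h 0 (s≤s z≤n))) (zeroʳ _))) (zeroˡ _)
    ... | no j≢n = trans (*-congˡ (det-zero-last-column n (minor M j) λ i i<n →
            trans (reflexive (≡.cong (M (suc i)) (skip-≥ j n (s≤s⁻¹ (ℕ.≤∧≢⇒< (s≤s⁻¹ j<n) j≢n))))) (h (suc i) (s≤s i<n))))
          (zeroʳ _)

  det-single-last-column : ∀ n (M : Matrix) → (∀ i → i < n → M (suc i) n ≈ 0#) →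
    det (suc n) M ≈ laplace n M n
  det-single-last-column n M h = ∑-only (suc n) {f = laplace n M} (ℕ.n<1+n n) (vanish n h)
    where
    vanish : ∀ n → (∀ i → i < n → M (suc i) n ≈ 0#) → ∀ j → j < suc n → j ≢ n → laplace n M j ≈ 0#
    vanish zero h zero j<n j≢n = ⊥-elim (j≢n ≡.refl)
    vanish zero h (suc j) (s≤s ()) j≢n
    vanish (suc n) h j j<n j≢n = trans (*-congˡ (det-zero-last-column n (minor M j) λ i i<n →
        trans (reflexive (≡.cong (M (suc i)) (skip-≥ j n (s≤s⁻¹ (ℕ.≤∧≢⇒< (s≤s⁻¹ j<n) j≢n))))) (h i i<n)))
      (zeroʳ _)

  -- The determinant (-1)^(m(m-1)/2) of the antidiagonal permutation matrix of order m.
  σ : ℕ → Carrier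
  σ zero = 1#
  σ (suc m) = sg m * σ m

  -- Expanding along row 0 deletes the last antidiagonal column and leaves the same shape. The rows
  -- below the block are arbitrary in its columns, as the border row of `det-peel` will be.
  det-antidiagonal : ∀ m q (M : Matrix) s →
    (∀ i j → i < m → j < m ℕ.+ q → suc (i ℕ.+ j) ≡ m → M i j ≈ s) →
    (∀ i j → i < m → j < m ℕ.+ q → suc (i ℕ.+ j) ≢ m → M i j ≈ 0#) →
    det (m ℕ.+ q) M ≈ σ m * s ^ m * det q (λ i j → M (m ℕ.+ i) (m ℕ.+ j))
  det-antidiagonal zero q M s on off = solve 1 (λ x → x := con (+ 1) :* con (+ 1) :* x) refl _
  det-antidiagonal (suc m) q M s on off = begin
    det (suc m ℕ.+ q) M
      ≈⟨ det-single-row (m ℕ.+ q) M m<n (λ k k<n k≢m → off 0 k (s≤s z≤n) k<n (k≢m ∘ ℕ.suc-injective)) ⟩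
    sg m * M 0 m * det (m ℕ.+ q) (minor M m)
      ≈⟨ *-cong (*-congˡ (on 0 m (s≤s z≤n) m<n ≡.refl)) (det-antidiagonal m q (minor M m) s on′ off′) ⟩
    sg m * s * (σ m * s ^ m * det q (λ i j → minor M m (m ℕ.+ i) (m ℕ.+ j)))
      ≈⟨ solve 5 (λ g s t p d → g :* s :* (t :* p :* d) := g :* t :* (s :* p) :* d) refl _ _ _ _ _ ⟩
    sg m * σ m * (s * s ^ m) * det q (λ i j → minor M m (m ℕ.+ i) (m ℕ.+ j))
      ≈⟨ *-congˡ (det-cong q λ i j _ _ →
           reflexive (≡.cong (M (suc (m ℕ.+ i))) (skip-≥ m (m ℕ.+ j) (ℕ.m≤m+n m j)))) ⟩
    sg m * σ m * (s * s ^ m) * det q (λ i j → M (suc (m ℕ.+ i)) (suc (m ℕ.+ j))) ∎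
    where
    m<n : m < suc (m ℕ.+ q)
    m<n = s≤s (ℕ.m≤m+n m q)
    on′ : ∀ i j → i < m → j < m ℕ.+ q → suc (i ℕ.+ j) ≡ m → minor M m i j ≈ s
    on′ i j i<m j<n eq = trans (reflexive (≡.cong (M (suc i)) (skip-< m j j<m)))
        (on (suc i) j (s≤s i<m) (ℕ.m<n⇒m<1+n j<n) (≡.cong suc eq))
      where
      j<m : j < m
      j<m = ≡.subst (suc j ≤_) eq (s≤s (ℕ.m≤n+m j i))
    off′ : ∀ i j → i < m → j < m ℕ.+ q → suc (i ℕ.+ j) ≢ m → minor M m i j ≈ 0#
    off′ i j i<m j<n neq with j ℕ.<? m
    ... | yes j<m = trans (reflexive (≡.cong (M (suc i)) (skip-< m j j<m)))
           (off (suc i) j (s≤s i<m) (ℕ.m<n⇒m<1+n j<n) (neq ∘ ℕ.suc-injective))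
    ... | no j≮m = trans (reflexive (≡.cong (M (suc i)) (skip-≥ m j (ℕ.≮⇒≥ j≮m))))
           (off (suc i) (suc j) (s≤s i<m) (s≤s j<n)
             (λ eq → ℕ.<⇒≢ (s≤s (ℕ.≤-trans (ℕ.≮⇒≥ j≮m) (ℕ.≤-trans (ℕ.n≤1+n j) (ℕ.m≤n+m (suc j) i)))) (≡.sym (ℕ.suc-injective eq))))

  bordered : ℕ → Matrix → (ℕ → Carrier) → (ℕ → Carrier) → Carrier → Matrix
  bordered n A v w x = extend n (λ i → extend n (A i) (v i)) (extend n w x)

  module _ (n : ℕ) (A : Matrix) (v w : ℕ → Carrier) (x : Carrier) where
    bordered-inner : ∀ {i j} → i < n → j < n → bordered n A v w x i j ≡ A i j
    bordered-inner {i} {j} i<n j<n =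
      ≡.trans (≡.cong (λ row → row j) (extend-< n (λ i → extend n (A i) (v i)) (extend n w x) i<n)) (extend-< n (A i) (v i) j<n)

    bordered-column : ∀ {i} → i < n → bordered n A v w x i n ≡ v i
    bordered-column {i} i<n =
      ≡.trans (≡.cong (λ row → row n) (extend-< n (λ i → extend n (A i) (v i)) (extend n w x) i<n)) (extend-last n (A i) (v i))

    bordered-row : ∀ {j} → j < n → bordered n A v w x n j ≡ w j
    bordered-row {j} j<n =
      ≡.trans (≡.cong (λ row → row j) (extend-last n (λ i → extend n (A i) (v i)) (extend n w x))) (extend-< n w x j<n)

  bordered-+ : ∀ m n A v w x i j →
    bordered (m ℕ.+ n) A v w x (m ℕ.+ i) (m ℕ.+ j) ≡
    bordered n (λ i j → A (m ℕ.+ i) (m ℕ.+ j)) (λ i → v (m ℕ.+ i)) (λ j → w (m ℕ.+ j)) x i j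
  bordered-+ m n A v w x i j = ≡.trans
    (≡.cong (λ row → row (m ℕ.+ j)) (extend-+ m n (λ i → extend (m ℕ.+ n) (A i) (v i)) (extend (m ℕ.+ n) w x) i))
    (rows n i)
    where
    rows : ∀ k i → extend k (λ i → extend (m ℕ.+ n) (A (m ℕ.+ i)) (v (m ℕ.+ i))) (extend (m ℕ.+ n) w x) i (m ℕ.+ j) ≡
      extend k (λ i → extend n (λ j → A (m ℕ.+ i) (m ℕ.+ j)) (v (m ℕ.+ i))) (extend n (λ j → w (m ℕ.+ j)) x) i j
    rows k i = lift k i (λ i → extend-+ m n (A (m ℕ.+ i)) (v (m ℕ.+ i)) j) (extend-+ m n w x j)
      where
      lift : ∀ k i {f g : ℕ → ℕ → Carrier} {y z : ℕ → Carrier} → (∀ i → f i (m ℕ.+ j) ≡ g i j) → y (m ℕ.+ j) ≡ z j →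
        extend k f y i (m ℕ.+ j) ≡ extend k g z i j
      lift zero i fg yz = yz
      lift (suc k) zero fg yz = fg 0
      lift (suc k) (suc i) fg yz = lift k i (fg ∘ suc) yz

  private
    <-or-≡ : ∀ {j n} → j < suc n → j ≢ n → j < n
    <-or-≡ j<1+n j≢n = ℕ.≤∧≢⇒< (s≤s⁻¹ j<1+n) j≢n

  -- The Schur complement of the leading antidiagonal block, cleared of the
  -- denominator s.
  det-peel : ∀ m q A v w x s →
    (∀ i j → i < suc m → j < suc m ℕ.+ q → suc (i ℕ.+ j) ≡ suc m → A i j ≈ s) →
    (∀ i j → i < suc m → j < suc m ℕ.+ q → suc (i ℕ.+ j) ≢ suc m → A i j ≈ 0#) →
    (∀ i → i < q → A (suc m ℕ.+ i) m ≈ 0#) →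
    (∀ i → i < m → v (suc i) ≈ 0#) →
    det (suc (suc m ℕ.+ q)) (bordered (suc m ℕ.+ q) A v w x) ≈
      σ (suc m) * s ^ suc m *
        det (suc q) (bordered q (λ i j → A (suc m ℕ.+ i) (suc m ℕ.+ j)) (λ i → v (suc m ℕ.+ i)) (λ j → w (suc m ℕ.+ j)) x)
      + - (σ (suc m) * s ^ m * (v 0 * w m) * det q (λ i j → A (suc m ℕ.+ i) (suc m ℕ.+ j)))
  det-peel m q A v w x s on off below v0 = begin
    det (suc z) M
      -- Row 0 meets the antidiagonal in column m and the border in column z, with entries s and
      -- `v 0`; these give the two terms of the result.
      ≈⟨ det-double-row z M m<z (λ k k<z k≢m → M-off 0 k (s≤s z≤n) k<z (k≢m ∘ ℕ.suc-injective)) ⟩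
    laplace z M m + laplace z M z
      ≈⟨ +-cong (*-cong (*-congˡ (M-on 0 m (s≤s z≤n) m<z ≡.refl)) first)
                (*-cong (*-congˡ (reflexive (bordered-column z A v w x (s≤s z≤n)))) second) ⟩
    sg m * s * (σ m * s ^ m * D₁) + - sg (m ℕ.+ q) * v 0 * (σ m * s ^ m * (sg q * w m * D₂))
      ≈⟨ +-congˡ (*-congʳ (*-congʳ (-‿cong (sg-+ m q)))) ⟩
    sg m * s * (σ m * s ^ m * D₁) + - (sg m * sg q) * v 0 * (σ m * s ^ m * (sg q * w m * D₂))
      ≈⟨ solve 9 (λ g s t p d e v h w →
             g :* s :* (t :* p :* d) :+ :- (g :* h) :* v :* (t :* p :* (h :* w :* e))
             := g :* t :* (s :* p) :* d :+ :- (h :* h :* (g :* t :* p :* (v :* w) :* e)))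
           refl _ _ _ _ _ _ _ _ _ ⟩
    sg m * σ m * (s * s ^ m) * D₁ + - (sg q * sg q * (sg m * σ m * s ^ m * (v 0 * w m) * D₂))
      ≈⟨ +-congˡ (-‿cong (trans (*-congʳ (sg-square q)) (*-identityˡ _))) ⟩
    σ (suc m) * s ^ suc m * D₁ + - (σ (suc m) * s ^ m * (v 0 * w m) * D₂) ∎
    where
    z : ℕ
    z = suc m ℕ.+ q
    M : Matrix
    M = bordered z A v w x
    A′ : Matrix
    A′ i j = A (suc m ℕ.+ i) (suc m ℕ.+ j)
    D₁ D₂ : Carrier
    D₁ = det (suc q) (bordered q A′ (λ i → v (suc m ℕ.+ i)) (λ j → w (suc m ℕ.+ j)) x)
    D₂ = det q A′
    m<z : m < z
    m<z = s≤s (ℕ.m≤m+n m q)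
    <z : ∀ {i} → i < suc m → i < z
    <z i<m = ℕ.<-≤-trans i<m (ℕ.m≤m+n (suc m) q)
    size : z ≡ m ℕ.+ suc q
    size = ≡.sym (ℕ.+-suc m q)
    M-on : ∀ i j → i < suc m → j < z → suc (i ℕ.+ j) ≡ suc m → M i j ≈ s
    M-on i j i<m j<z eq = trans (reflexive (bordered-inner z A v w x (<z i<m) j<z)) (on i j i<m j<z eq)
    M-off : ∀ i j → i < suc m → j < z → suc (i ℕ.+ j) ≢ suc m → M i j ≈ 0#
    M-off i j i<m j<z neq = trans (reflexive (bordered-inner z A v w x (<z i<m) j<z)) (off i j i<m j<z neq)
    M-off′ : ∀ i j → i < m → j < suc z → suc (suc i ℕ.+ j) ≢ suc m → M (suc i) j ≈ 0#
    M-off′ i j i<m j<z neq with j ℕ.≟ z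
    ... | yes ≡.refl = trans (reflexive (bordered-column z A v w x (<z (s≤s i<m)))) (v0 i i<m)
    ... | no j≢z = M-off (suc i) j (s≤s i<m) (<-or-≡ j<z j≢z) neq
    m≤⇒≢ : ∀ i j → m ≤ j → suc (suc i ℕ.+ j) ≢ suc m
    m≤⇒≢ i j m≤j eq = ℕ.<⇒≢ (s≤s (ℕ.≤-trans m≤j (ℕ.m≤n+m j i))) (≡.sym (ℕ.suc-injective eq))

    first : det z (minor M m) ≈ σ m * s ^ m * D₁
    first = begin
      det z (minor M m)
        ≡⟨ ≡.cong (λ k → det k (minor M m)) size ⟩
      det (m ℕ.+ suc q) (minor M m)
        ≈⟨ det-antidiagonal m (suc q) (minor M m) s on′ off′ ⟩
      σ m * s ^ m * det (suc q) (λ i j → minor M m (m ℕ.+ i) (m ℕ.+ j))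
        ≈⟨ *-congˡ (det-cong (suc q) λ i j _ _ → reflexive (≡.trans
             (≡.cong (M (suc (m ℕ.+ i))) (skip-≥ m (m ℕ.+ j) (ℕ.m≤m+n m j)))
             (bordered-+ (suc m) q A v w x i j))) ⟩
      σ m * s ^ m * D₁ ∎
      where
      on′ : ∀ i j → i < m → j < m ℕ.+ suc q → suc (i ℕ.+ j) ≡ m → minor M m i j ≈ s
      on′ i j i<m j<n eq = trans (reflexive (≡.cong (M (suc i)) (skip-< m j j<m)))
          (M-on (suc i) j (s≤s i<m) (ℕ.<-trans j<m m<z) (≡.cong suc eq))
        where
        j<m : j < m
        j<m = ≡.subst (suc j ≤_) eq (s≤s (ℕ.m≤n+m j i))
      off′ : ∀ i j → i < m → j < m ℕ.+ suc q → suc (i ℕ.+ j) ≢ m → minor M m i j ≈ 0#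
      off′ i j i<m j<n neq with j ℕ.<? m
      ... | yes j<m = trans (reflexive (≡.cong (M (suc i)) (skip-< m j j<m)))
             (M-off (suc i) j (s≤s i<m) (ℕ.<-trans j<m m<z) (neq ∘ ℕ.suc-injective))
      ... | no j≮m = trans (reflexive (≡.cong (M (suc i)) (skip-≥ m j (ℕ.≮⇒≥ j≮m))))
             (M-off′ i (suc j) i<m (s≤s (≡.subst (j <_) (≡.sym size) j<n)) (m≤⇒≢ i (suc j) (ℕ.≤-trans (ℕ.≮⇒≥ j≮m) (ℕ.n≤1+n j))))

    K : Matrix
    K i j = minor M z (m ℕ.+ i) (m ℕ.+ j)
    K≡ : ∀ i {j} → j < suc q → K i j ≡ M (suc m ℕ.+ i) (m ℕ.+ j)
    K≡ i {j} j≤q = ≡.cong (M (suc m ℕ.+ i)) (skip-< z (m ℕ.+ j) (s≤s (ℕ.+-monoʳ-≤ m (s≤s⁻¹ j≤q))))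

    -- The first column of `K` is column m of `M`, where `below` leaves only the entry `w m` of the
    -- border row.
    corner : det (suc q) K ≈ sg q * w m * D₂
    corner = begin
      det (suc q) K
        ≈⟨ det-ᵀ (suc q) K ⟩
      det (suc q) (K ᵀ)
        ≈⟨ det-single-row q (K ᵀ) (ℕ.n<1+n q) (λ k k<n k≢q → K-column k (<-or-≡ k<n k≢q)) ⟩
      sg q * K q 0 * det q (minor (K ᵀ) q)
        ≈⟨ *-cong (*-congˡ (reflexive K-corner)) (trans (det-ᵀ q (minor (K ᵀ) q)) (det-cong q rest)) ⟩
      sg q * w m * D₂ ∎
      where
      K-column : ∀ k → k < q → K k 0 ≈ 0#
      K-column k k<q = trans (reflexive (≡.trans (K≡ k (s≤s z≤n))
          (≡.trans (≡.cong (M (suc m ℕ.+ k)) (ℕ.+-identityʳ m))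
            (bordered-inner z A v w x (s≤s (ℕ.+-monoʳ-< m k<q)) m<z))))
          (below k k<q)
      K-corner : K q 0 ≡ w m
      K-corner = ≡.trans (K≡ q (s≤s z≤n))
        (≡.trans (≡.cong (M (suc m ℕ.+ q)) (ℕ.+-identityʳ m)) (bordered-row z A v w x m<z))
      rest : ∀ i j → i < q → j < q → minor (K ᵀ) q j i ≈ A′ i j
      rest i j i<q j<q = reflexive (≡.trans (≡.cong (λ a → K a (suc j)) (skip-< q i i<q))
        (≡.trans (K≡ i (s≤s j<q)) (≡.trans (≡.cong (M (suc m ℕ.+ i)) (ℕ.+-suc m j))
          (bordered-inner z A v w x (s≤s (ℕ.+-monoʳ-< m i<q)) (s≤s (ℕ.+-monoʳ-< m j<q))))))

    second : det z (minor M z) ≈ σ m * s ^ m * (sg q * w m * D₂)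
    second = begin
      det z (minor M z)
        ≡⟨ ≡.cong (λ k → det k (minor M z)) size ⟩
      det (m ℕ.+ suc q) (minor M z)
        ≈⟨ det-antidiagonal m (suc q) (minor M z) s
             (λ i j i<m j<n eq → trans (reflexive (≡.cong (M (suc i)) (skip-< z j (j<z j<n))))
               (M-on (suc i) j (s≤s i<m) (j<z j<n) (≡.cong suc eq)))
             (λ i j i<m j<n neq → trans (reflexive (≡.cong (M (suc i)) (skip-< z j (j<z j<n))))
               (M-off (suc i) j (s≤s i<m) (j<z j<n) (neq ∘ ℕ.suc-injective))) ⟩
      σ m * s ^ m * det (suc q) K
        ≈⟨ *-congˡ corner ⟩
      σ m * s ^ m * (sg q * w m * D₂) ∎
      where
      j<z : ∀ {j} → j < m ℕ.+ suc q → j < z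
      j<z {j} = ≡.subst (j <_) (≡.sym size)

  -- Row 0 meets only the border column and column 0 only the border row. The sign is that of the
  -- transposition of the first and the last index.
  det-bordered-hook : ∀ r A v w x → (∀ j → j < suc r → A 0 j ≈ 0#) → (∀ i → i < suc r → A i 0 ≈ 0#) →
    det (suc (suc r)) (bordered (suc r) A v w x) ≈ - (v 0 * w 0 * det r (λ i j → A (suc i) (suc j)))
  det-bordered-hook r A v w x row column = begin
    det (suc z) M
      ≈⟨ det-single-row z M (ℕ.n<1+n z) (λ k k<n k≢z →
           trans (reflexive (bordered-inner z A v w x (s≤s z≤n) (<-or-≡ k<n k≢z))) (row k (<-or-≡ k<n k≢z))) ⟩
    sg z * M 0 z * det z K
      ≈⟨ *-cong (*-congˡ (reflexive (bordered-column z A v w x (s≤s z≤n)))) (det-ᵀ z K) ⟩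
    sg z * v 0 * det z (K ᵀ)
      ≈⟨ *-congˡ (det-single-row r (K ᵀ) (ℕ.n<1+n r) (λ k k<n k≢r → K-column k (<-or-≡ k<n k≢r))) ⟩
    sg z * v 0 * (sg r * K r 0 * det r (minor (K ᵀ) r))
      ≈⟨ *-congˡ (*-cong (*-congˡ (reflexive (≡.trans (K≡ r (s≤s z≤n)) (bordered-row z A v w x (s≤s z≤n)))))
           (trans (det-ᵀ r (minor (K ᵀ) r)) (det-cong r rest))) ⟩
    sg z * v 0 * (sg r * w 0 * det r (λ i j → A (suc i) (suc j)))
      ≈⟨ solve 4 (λ g v w d → :- g :* v :* (g :* w :* d) := :- (g :* g :* (v :* w :* d))) refl _ _ _ _ ⟩
    - (sg r * sg r * (v 0 * w 0 * det r (λ i j → A (suc i) (suc j))))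
      ≈⟨ -‿cong (trans (*-congʳ (sg-square r)) (*-identityˡ _)) ⟩
    - (v 0 * w 0 * det r (λ i j → A (suc i) (suc j))) ∎
    where
    z : ℕ
    z = suc r
    M : Matrix
    M = bordered z A v w x
    K : Matrix
    K = minor M z
    K≡ : ∀ i {j} → j < z → K i j ≡ M (suc i) j
    K≡ i {j} j<z = ≡.cong (M (suc i)) (skip-< z j j<z)
    K-column : ∀ k → k < r → K k 0 ≈ 0#
    K-column k k<r = trans (reflexive (≡.trans (K≡ k (s≤s z≤n)) (bordered-inner z A v w x (s≤s k<r) (s≤s z≤n)))) (column (suc k) (s≤s k<r))
    rest : ∀ i j → i < r → j < r → minor (K ᵀ) r j i ≈ A (suc i) (suc j)
    rest i j i<r j<r = reflexive (≡.trans (≡.cong (λ a → K a (suc j)) (skip-< r i i<r))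
      (≡.trans (K≡ i (s≤s j<r)) (bordered-inner z A v w x (s≤s i<r) (s≤s j<r))))

  -- As a functional on polynomials, xⁿ ↦ `unit₀ n` is the evaluation at 0.
  unit₀ : ℕ → Carrier
  unit₀ zero = 1#
  unit₀ (suc _) = 0#

  -- A border of unit vectors deletes row and column 0. Read from right to left, this turns the
  -- doubly shifted Hankel matrix into a bordered one whose inner part involves all powers of x.
  det-bordered-unit : ∀ n (H : Matrix) →
    det (suc (suc n)) (bordered (suc n) H unit₀ unit₀ 0#) ≈ - det n (λ i j → H (suc i) (suc j))
  det-bordered-unit n H = begin
    det (suc z) M
      ≈⟨ det-single-last-column z M M-column ⟩
    sg z * M 0 z * det z K
      ≈⟨ *-cong (*-congˡ (reflexive (bordered-column z H unit₀ unit₀ 0# (s≤s z≤n)))) (det-ᵀ z K) ⟩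
    sg z * 1# * det z (K ᵀ)
      ≈⟨ *-congˡ (det-single-last-column n (K ᵀ) (λ i i<n → reflexive (K-row (suc i) (s≤s i<n)))) ⟩
    sg z * 1# * (sg n * K n 0 * det n (minor (K ᵀ) n))
      ≈⟨ *-congˡ (*-cong (*-congˡ (reflexive (K-row 0 (s≤s z≤n)))) (trans (det-ᵀ n (minor (K ᵀ) n)) (det-cong n rest))) ⟩
    sg z * 1# * (sg n * 1# * det n (λ i j → H (suc i) (suc j)))
      ≈⟨ solve 2 (λ g d → :- g :* con (+ 1) :* (g :* con (+ 1) :* d) := :- (g :* g :* d)) refl _ _ ⟩
    - (sg n * sg n * det n (λ i j → H (suc i) (suc j)))
      ≈⟨ -‿cong (trans (*-congʳ (sg-square n)) (*-identityˡ _)) ⟩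
    - det n (λ i j → H (suc i) (suc j)) ∎
    where
    z : ℕ
    z = suc n
    M : Matrix
    M = bordered z H unit₀ unit₀ 0#
    K : Matrix
    K = minor M z
    -- The corner entry 0 is what makes the last column a unit vector.
    M-column : ∀ i → i < z → M (suc i) z ≈ 0#
    M-column i i<z with i ℕ.≟ n
    ... | yes ≡.refl = reflexive (≡.trans (≡.cong (λ row → row z) (extend-last z (λ i → extend z (H i) (unit₀ i)) (extend z unit₀ 0#))) (extend-last z unit₀ 0#))
    ... | no i≢n = reflexive (bordered-column z H unit₀ unit₀ 0# (s≤s (<-or-≡ i<z i≢n)))
    K≡ : ∀ i {j} → j < z → K i j ≡ M (suc i) j
    K≡ i {j} j<z = ≡.cong (M (suc i)) (skip-< z j j<z)
    K-row : ∀ j → j < z → K n j ≡ unit₀ j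
    K-row j j<z = ≡.trans (K≡ n j<z) (bordered-row z H unit₀ unit₀ 0# j<z)
    rest : ∀ i j → i < n → j < n → minor (K ᵀ) n j i ≈ H (suc i) (suc j)
    rest i j i<n j<n = reflexive (≡.trans (≡.cong (λ a → K a (suc j)) (skip-< n i i<n))
      (≡.trans (K≡ i (s≤s j<n)) (bordered-inner z H unit₀ unit₀ 0# (s≤s i<n) (s≤s j<n))))

-- Polynomials in x acting on sequences

module Operators {c ℓ : Level} (R : CommutativeRing c ℓ) (t : CommutativeRing.Carrier R) where
  open CommutativeRing R hiding (zero)
  open import Algebra.Properties.Ring ring using (-‿distribˡ-*; -0#≈0#)
  open import Algebra.Properties.Semiring.Exp semiring using (_^_)
  open import Relation.Binary.Reasoning.Setoid setoid
  open IntegerCoefficientSolver R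
  open Determinants R
  open BorderedDeterminants R

  -- A sequence f stands for the functional xⁿ ↦ `f n`, and a polynomial p for the operator `O` such
  -- that `O f n` is the value of f at p(x) xⁿ. Applying operators in succession multiplies
  -- polynomials.
  Sequence : Set c
  Sequence = ℕ → Carrier

  Operator : Set c
  Operator = Sequence → Sequence

  -- power n k is the coefficient of qⁿ in uᵏ, where u = q (1 + u) (1 + t u).
  power : ℕ → ℕ → Carrier
  power zero zero = 1#
  power zero (suc k) = 0#
  power (suc n) zero = 0#
  power (suc n) (suc k) = power n k + (1# + t) * power n (suc k) + t * power n (suc (suc k))

  power-< : ∀ {n k} → n < k → power n k ≈ 0#
  power-< {zero} {suc k} n<k = refl
  power-< {suc n} {suc k} (s≤s n<k) = trans
    (+-cong (+-cong (power-< n<k) (*-congˡ (power-< (ℕ.m<n⇒m<1+n n<k)))) (*-congˡ (power-< (ℕ.m<n⇒m<1+n (ℕ.m<n⇒m<1+n n<k)))))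
    (solve 1 (λ t → con (+ 0) :+ (con (+ 1) :+ t) :* con (+ 0) :+ t :* con (+ 0) := con (+ 0)) refl t)

  power-diagonal : ∀ n → power n n ≈ 1#
  power-diagonal zero = refl
  power-diagonal (suc n) = trans
    (+-cong (+-cong (power-diagonal n) (*-congˡ (power-< (ℕ.n<1+n n)))) (*-congˡ (power-< (ℕ.m<n⇒m<1+n (ℕ.n<1+n n)))))
    (solve 1 (λ t → con (+ 1) :+ (con (+ 1) :+ t) :* con (+ 0) :+ t :* con (+ 0) := con (+ 1)) refl t)

  -- The indices start at the coefficient of q, so polynomials in x = 1/q are invisible to the
  -- moments; in particular the moments of u⁰ = 1 all vanish.
  moment : ℕ → Sequence
  moment k n = power (suc n) k

  -- With x acting as the shift, x = 1/q = u⁻¹ + (1 + t) + t u, and V k is the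
  -- polynomial u⁻ᵏ + tᵏ uᵏ in x.
  V : ℕ → Operator
  V zero f n = f n + f n
  V (suc zero) f n = f (suc n) + - ((1# + t) * f n)
  V (suc (suc k)) f n = V (suc k) f (suc n) + - ((1# + t) * V (suc k) f n) + - (t * V k f n)

  V-cong : ∀ k {f g : Sequence} → (∀ n → f n ≈ g n) → ∀ n → V k f n ≈ V k g n
  V-cong zero fg n = +-cong (fg n) (fg n)
  V-cong (suc zero) fg n = +-cong (fg (suc n)) (-‿cong (*-congˡ (fg n)))
  V-cong (suc (suc k)) fg n =
    +-cong (+-cong (V-cong (suc k) fg (suc n)) (-‿cong (*-congˡ (V-cong (suc k) fg n)))) (-‿cong (*-congˡ (V-cong k fg n)))

  V-linear : ∀ k (f g : Sequence) α n → V k (λ n → f n + α * g n) n ≈ V k f n + α * V k g n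
  V-linear zero f g α n =
    solve 3 (λ f g a → f :+ a :* g :+ (f :+ a :* g) := f :+ f :+ a :* (g :+ g)) refl (f n) (g n) α
  V-linear (suc zero) f g α n =
    solve 6 (λ f g f′ g′ a s → f′ :+ a :* g′ :- s :* (f :+ a :* g) := f′ :- s :* f :+ a :* (g′ :- s :* g))
      refl (f n) (g n) (f (suc n)) (g (suc n)) α (1# + t)
  V-linear (suc (suc k)) f g α n = trans
    (+-cong (+-cong (V-linear (suc k) f g α (suc n)) (-‿cong (*-congˡ (V-linear (suc k) f g α n)))) (-‿cong (*-congˡ (V-linear k f g α n))))
    (solve 9 (λ f₂ g₂ f₁ g₁ f₀ g₀ a s t → f₂ :+ a :* g₂ :- s :* (f₁ :+ a :* g₁) :- t :* (f₀ :+ a :* g₀)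
        := f₂ :- s :* f₁ :- t :* f₀ :+ a :* (g₂ :- s :* g₁ :- t :* g₀))
      refl _ _ _ _ _ _ α (1# + t) t)

  moment-step : ∀ k n → moment (suc k) (suc n) + - ((1# + t) * moment (suc k) n) ≈ moment k n + t * moment (suc (suc k)) n
  moment-step k n = solve 4 (λ x y z s → x :+ s :* y :+ z :- s :* y := x :+ z) refl _ _ _ _

  -- The product of uᵏ⁺ⁱ with u⁻ᵏ + tᵏ uᵏ. At i = 0 the first summand is the constant 1, which has
  -- no moments.
  V-moment : ∀ k i n → V k (moment (k ℕ.+ i)) n ≈ moment i n + t ^ k * moment (k ℕ.+ (k ℕ.+ i)) n
  V-moment zero i n = +-congˡ (sym (*-identityˡ _))
  V-moment (suc zero) i n = trans (moment-step i n) (+-congˡ (*-congʳ (sym (*-identityʳ t))))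
  V-moment (suc (suc k)) i n = begin
    V (suc k) f (suc n) + - (s * V (suc k) f n) + - (t * V k f n)
      ≈⟨ +-cong (+-cong (one (V-moment (suc k)) (suc n)) (-‿cong (*-congˡ (one (V-moment (suc k)) n)))) (-‿cong (*-congˡ (two (V-moment k)))) ⟩
    m₁ (suc n) + t ^ suc k * high (suc n) + - (s * (m₁ n + t ^ suc k * high n)) + - (t * (m₂ n + t ^ k * low n))
      ≈⟨ solve 8 (λ a a′ h h′ p q s t →
           a :+ p :* h :- s :* (a′ :+ p :* h′) :- t :* q := (a :- s :* a′) :+ p :* (h :- s :* h′) :- t :* q)
         refl (m₁ (suc n)) (m₁ n) (high (suc n)) (high n) (t ^ suc k) (m₂ n + t ^ k * low n) s t ⟩
    (m₁ (suc n) + - (s * m₁ n)) + t ^ suc k * (high (suc n) + - (s * high n)) + - (t * (m₂ n + t ^ k * low n))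
      ≈⟨ +-congʳ (+-cong (moment-step i n) (*-congˡ (moment-step _ n))) ⟩
    (moment i n + t * m₂ n) + t ^ suc k * (low n + t * top n) + - (t * (m₂ n + t ^ k * low n))
      ≈⟨ solve 6 (λ a b p l h t → a :+ t :* b :+ t :* p :* (l :+ t :* h) :- t :* (b :+ p :* l) := a :+ t :* (t :* p) :* h)
         refl (moment i n) (m₂ n) (t ^ k) (low n) (top n) t ⟩
    moment i n + t * (t * t ^ k) * top n
      ≡⟨ ≡.cong (λ x → moment i n + t * (t * t ^ k) * moment (suc (suc x)) n) (≡.sym (≡.trans (ℕ.+-suc k (suc (k ℕ.+ i))) (≡.cong suc (ℕ.+-suc k (k ℕ.+ i))))) ⟩
    moment i n + t ^ suc (suc k) * moment (suc (suc k) ℕ.+ (suc (suc k) ℕ.+ i)) n ∎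
    where
    s : Carrier
    s = 1# + t
    f m₁ m₂ high low top : Sequence
    f = moment (suc (suc k) ℕ.+ i)
    m₁ = moment (suc i)
    m₂ = moment (suc (suc i))
    low = moment (suc (suc (k ℕ.+ (k ℕ.+ i))))
    high = moment (suc (suc (suc (k ℕ.+ (k ℕ.+ i)))))
    top = moment (suc (suc (suc (suc (k ℕ.+ (k ℕ.+ i))))))
    f≡₁ : suc k ℕ.+ suc i ≡ suc (suc k) ℕ.+ i
    f≡₁ = ≡.cong suc (ℕ.+-suc k i)
    f≡₂ : k ℕ.+ suc (suc i) ≡ suc (suc k) ℕ.+ i
    f≡₂ = ≡.trans (ℕ.+-suc k (suc i)) (≡.cong suc (ℕ.+-suc k i))
    Step : ℕ → Set ℓ
    Step k = ∀ i n → V k (moment (k ℕ.+ i)) n ≈ moment i n + t ^ k * moment (k ℕ.+ (k ℕ.+ i)) n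
    one : Step (suc k) → ∀ n → V (suc k) f n ≈ m₁ n + t ^ suc k * high n
    one ih n = trans (reflexive (≡.cong (λ x → V (suc k) (moment x) n) (≡.sym f≡₁)))
      (trans (ih (suc i) n) (reflexive (≡.cong (λ x → m₁ n + t ^ suc k * moment x n)
        (≡.trans (≡.cong (suc k ℕ.+_) f≡₁) (≡.cong suc (≡.trans (ℕ.+-suc k (suc (k ℕ.+ i))) (≡.cong suc (ℕ.+-suc k (k ℕ.+ i)))))))))
    two : Step k → V k f n ≈ m₂ n + t ^ k * low n
    two ih = trans (reflexive (≡.cong (λ x → V k (moment x) n) (≡.sym f≡₂)))
      (trans (ih (suc (suc i)) n) (reflexive (≡.cong (λ x → m₂ n + t ^ k * moment x n)
        (≡.trans (≡.cong (k ℕ.+_) f≡₂) (≡.trans (ℕ.+-suc k (suc (k ℕ.+ i))) (≡.cong suc (ℕ.+-suc k (k ℕ.+ i))))))))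

  -- `O` is multiplication by some polynomial in x of degree below d; in `Monic d` it is a monic one
  -- of degree d. The coefficients depend neither on f nor on n.
  record Lower (d : ℕ) (O : Operator) : Set (c ⊔ ℓ) where
    constructor lower
    field
      coeff : Sequence
      rep : ∀ f n → O f n ≈ ∑ d (λ p → coeff p * f (p ℕ.+ n))

  record Monic (d : ℕ) (O : Operator) : Set (c ⊔ ℓ) where
    constructor monic
    field
      coeff : Sequence
      rep : ∀ f n → O f n ≈ f (d ℕ.+ n) + ∑ d (λ p → coeff p * f (p ℕ.+ n))

  ∑-extend : ∀ d (a b : Sequence) x → ∑ (suc d) (λ p → extend d a x p * b p) ≈ ∑ d (λ p → a p * b p) + x * b d
  ∑-extend d a b x = trans (∑-last d _) (+-cong
    (∑-cong d (λ p p<d → *-congʳ (reflexive (extend-< d a x p<d))))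
    (*-congʳ (reflexive (extend-last d a x))))

  Lower-suc : ∀ {d O} → Lower d O → Lower (suc d) O
  Lower-suc {d} {O} (lower a rep) = lower (extend d a 0#) λ f n → trans (rep f n)
    (sym (trans (∑-extend d a (λ p → f (p ℕ.+ n)) 0#) (trans (+-congˡ (zeroˡ _)) (+-identityʳ _))))

  Lower-+ : ∀ e {d O} → Lower d O → Lower (e ℕ.+ d) O
  Lower-+ zero L = L
  Lower-+ (suc e) L = Lower-suc (Lower-+ e L)

  Lower-≤ : ∀ {d e O} → d ≤ e → Lower d O → Lower e O
  Lower-≤ {d} {e} {O} d≤e L = ≡.subst (λ k → Lower k O) (ℕ.m∸n+n≡m d≤e) (Lower-+ (e ℕ.∸ d) L)

  Lower-linear : ∀ {d O P} α β → Lower d O → Lower d P → Lower d (λ f n → α * O f n + β * P f n)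
  Lower-linear {d} α β (lower a repO) (lower b repP) = lower (λ p → α * a p + β * b p) λ f n → sym (begin
    ∑ d (λ p → (α * a p + β * b p) * f (p ℕ.+ n))
      ≈⟨ ∑-cong d (λ p _ → solve 5 (λ x a y b f → (x :* a :+ y :* b) :* f := x :* (a :* f) :+ y :* (b :* f)) refl _ _ _ _ _) ⟩
    ∑ d (λ p → α * (a p * f (p ℕ.+ n)) + β * (b p * f (p ℕ.+ n)))
      ≈⟨ ∑-+ d _ _ ⟩
    ∑ d (λ p → α * (a p * f (p ℕ.+ n))) + ∑ d (λ p → β * (b p * f (p ℕ.+ n)))
      ≈⟨ +-cong (trans (∑-*ˡ d α _) (*-congˡ (sym (repO f n)))) (trans (∑-*ˡ d β _) (*-congˡ (sym (repP f n)))) ⟩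
    _ ∎)

  Monic⇒Lower : ∀ {d O} → Monic d O → Lower (suc d) O
  Monic⇒Lower {d} (monic a rep) = lower (extend d a 1#) λ f n → trans (rep f n)
    (trans (+-comm _ _) (sym (trans (∑-extend d a (λ p → f (p ℕ.+ n)) 1#) (+-congˡ (*-identityˡ _)))))

  Monic-shift : ∀ {d O} → Monic d O → Monic (suc d) (λ f n → O f (suc n))
  Monic-shift {d} {O} (monic a rep) = monic b λ f n → trans (rep f (suc n))
      (+-cong (reflexive (≡.cong f (ℕ.+-suc d n)))
        (trans (∑-cong d (λ p _ → *-congˡ (reflexive (≡.cong f (ℕ.+-suc p n)))))
          (sym (trans (+-congʳ (zeroˡ _)) (+-identityˡ _)))))
    where
    b : Sequence
    b zero = 0#
    b (suc p) = a p

  Monic-shifts : ∀ r {d O} → Monic d O → Monic (r ℕ.+ d) (λ f n → O f (r ℕ.+ n))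
  Monic-shifts zero M = M
  Monic-shifts (suc r) {d} {O} M = monic (Monic.coeff M′) λ f n →
      trans (reflexive (≡.cong (O f) (≡.sym (ℕ.+-suc r n)))) (Monic.rep M′ f n)
    where
    M′ : Monic (suc r ℕ.+ d) (λ f n → O f (r ℕ.+ suc n))
    M′ = Monic-shift (Monic-shifts r M)

  Monic-+ : ∀ {d O P} α → Monic d O → Lower d P → Monic d (λ f n → O f n + α * P f n)
  Monic-+ {d} α (monic a repO) (lower b repP) = monic (λ p → a p + α * b p) λ f n → begin
    _ ≈⟨ +-cong (repO f n) (*-congˡ (repP f n)) ⟩
    f (d ℕ.+ n) + ∑ d (λ p → a p * f (p ℕ.+ n)) + α * ∑ d (λ p → b p * f (p ℕ.+ n))
      ≈⟨ trans (+-assoc _ _ _) (+-congˡ (trans (+-congˡ (sym (∑-*ˡ d α _))) (sym (∑-+ d _ _)))) ⟩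
    f (d ℕ.+ n) + ∑ d (λ p → a p * f (p ℕ.+ n) + α * (b p * f (p ℕ.+ n)))
      ≈⟨ +-congˡ (∑-cong d (λ p _ → solve 4 (λ a x b f → a :* f :+ x :* (b :* f) := (a :+ x :* b) :* f) refl _ _ _ _)) ⟩
    f (d ℕ.+ n) + ∑ d (λ p → (a p + α * b p) * f (p ℕ.+ n)) ∎

  Monic-≈ : ∀ {d O P} → (∀ f n → P f n ≈ O f n) → Monic d O → Monic d P
  Monic-≈ P≈O (monic a rep) = monic a λ f n → trans (P≈O f n) (rep f n)

  Lower-≈ : ∀ {d O P} → (∀ f n → P f n ≈ O f n) → Lower d O → Lower d P
  Lower-≈ P≈O (lower a rep) = lower a λ f n → trans (P≈O f n) (rep f n)

  -- The recursion of `V` reaches back two steps, so a degree bound on `V k` travels along. It is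
  -- only a bound because `V 0` is 2, which need not be monic.
  Monic-V : ∀ k {d O} → Monic d O → Monic (suc k ℕ.+ d) (V (suc k) ∘ O) × Lower (suc k ℕ.+ d) (V k ∘ O)
  Monic-V zero {d} {O} M =
    Monic-≈ (λ f n → +-congˡ (-‿distribˡ-* _ _)) (Monic-+ (- (1# + t)) (Monic-shift M) (Monic⇒Lower M)) ,
    Lower-≈ (λ f n → sym (+-cong (*-identityˡ _) (*-identityˡ _))) (Lower-linear 1# 1# (Monic⇒Lower M) (Monic⇒Lower M))
  Monic-V (suc k) {d} {O} M = let (M′ , L) = Monic-V k M in
    Monic-≈ (λ f n → +-cong (+-congˡ (-‿distribˡ-* _ _)) (-‿distribˡ-* _ _))
      (Monic-+ (- t) (Monic-+ (- (1# + t)) (Monic-shift M′) (Monic⇒Lower M′)) (Lower-suc L)) ,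
    Monic⇒Lower M′

  Monic-id : Monic 0 (λ f → f)
  Monic-id = monic (λ _ → 0#) λ f n → sym (+-identityʳ _)

  module _ {d : ℕ} {O : Operator} (M : Monic d O) where
    Monic-scale : ∀ (f : Sequence) α n → O (λ i → α * f i) n ≈ α * O f n
    Monic-scale f α n = let open Monic M renaming (coeff to a) in begin
      O (λ i → α * f i) n
        ≈⟨ rep _ n ⟩
      α * f (d ℕ.+ n) + ∑ d (λ p → a p * (α * f (p ℕ.+ n)))
        ≈⟨ +-congˡ (trans (∑-cong d (λ p _ → solve 3 (λ a x f → a :* (x :* f) := x :* (a :* f)) refl _ _ _)) (∑-*ˡ d α _)) ⟩
      α * f (d ℕ.+ n) + α * ∑ d (λ p → a p * f (p ℕ.+ n))
        ≈⟨ sym (distribˡ α _ _) ⟩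
      α * (f (d ℕ.+ n) + ∑ d (λ p → a p * f (p ℕ.+ n)))
        ≈⟨ *-congˡ (sym (rep f n)) ⟩
      α * O f n ∎

    Monic-cong : ∀ {f g : Sequence} → (∀ i → f i ≈ g i) → ∀ n → O f n ≈ O g n
    Monic-cong fg n = let open Monic M renaming (coeff to a) in
      trans (rep _ n) (trans (+-cong (fg _) (∑-cong d (λ p _ → *-congˡ (fg _)))) (sym (rep _ n)))

    Monic-translate : ∀ (f : Sequence) r n → O (λ i → f (i ℕ.+ r)) n ≈ O f (n ℕ.+ r)
    Monic-translate f r n = let open Monic M renaming (coeff to a) in
      trans (rep _ n) (trans (+-cong (reflexive (≡.cong f (ℕ.+-assoc d n r)))
        (∑-cong d (λ p _ → *-congˡ (reflexive (≡.cong f (ℕ.+-assoc p n r)))))) (sym (rep f (n ℕ.+ r))))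

    Monic-zero : ∀ {f : Sequence} → (∀ i → f i ≈ 0#) → ∀ n → O f n ≈ 0#
    Monic-zero f≈0 n = let open Monic M renaming (coeff to a) in
      trans (rep _ n) (trans (+-cong (f≈0 _) (∑-zero d (λ p _ → trans (*-congˡ (f≈0 _)) (zeroʳ _)))) (+-identityˡ 0#))

  -- The functional that takes the coefficient of x.
  unit₁ : Sequence
  unit₁ zero = 0#
  unit₁ (suc n) = unit₀ n

  geometric : Carrier → ℕ → Carrier
  geometric x n = ∑ n (x ^_)

  geometric-suc : ∀ x n → geometric x (suc n) ≈ 1# + x * geometric x n
  geometric-suc x n = +-congˡ (∑-*ˡ n x (x ^_))

  fromℕ : ℕ → Carrier
  fromℕ zero = 0#
  fromℕ (suc n) = 1# + fromℕ n

  V-supported : ∀ d k {f : Sequence} → (∀ n → f (suc (d ℕ.+ n)) ≈ 0#) → ∀ n → V k f (suc (d ℕ.+ n)) ≈ 0#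
  V-supported d zero h n = trans (+-cong (h n) (h n)) (+-identityˡ 0#)
  V-supported d (suc zero) {f} h n = trans
    (+-cong (trans (reflexive (≡.cong (f ∘ suc) (≡.sym (ℕ.+-suc d n)))) (h (suc n))) (-‿cong (*-congˡ (h n))))
    (solve 1 (λ s → con (+ 0) :- s :* con (+ 0) := con (+ 0)) refl (1# + t))
  V-supported d (suc (suc k)) {f} h n = trans
    (+-cong (+-cong (trans (reflexive (≡.cong (V (suc k) f ∘ suc) (≡.sym (ℕ.+-suc d n)))) (V-supported d (suc k) h (suc n)))
                    (-‿cong (*-congˡ (V-supported d (suc k) h n))))
            (-‿cong (*-congˡ (V-supported d k h n))))
    (solve 2 (λ s t → con (+ 0) :- s :* con (+ 0) :- t :* con (+ 0) := con (+ 0)) refl (1# + t) t)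

  -- The factor is the constant term of `V k`: at x = 0 one may take u = -1, where u⁻ᵏ + tᵏ uᵏ is
  -- (-1)ᵏ (1 + tᵏ). The offset d lets the same lemma serve `unit₀` and `unit₁`.
  V-constant : ∀ d k {f : Sequence} → (∀ n → f (suc (d ℕ.+ n)) ≈ 0#) → V k f d ≈ sg k * (1# + t ^ k) * f d
  V-constant d zero h = solve 1 (λ f → f :+ f := con (+ 1) :* (con (+ 1) :+ con (+ 1)) :* f) refl _
  V-constant d (suc zero) {f} h = trans
    (+-congʳ (trans (reflexive (≡.cong (f ∘ suc) (≡.sym (ℕ.+-identityʳ d)))) (h 0)))
    (solve 2 (λ t f → con (+ 0) :- (con (+ 1) :+ t) :* f := :- con (+ 1) :* (con (+ 1) :+ t :* con (+ 1)) :* f) refl t _)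
  V-constant d (suc (suc k)) {f} h = trans
    (+-cong (+-cong (trans (reflexive (≡.cong (V (suc k) f ∘ suc) (≡.sym (ℕ.+-identityʳ d)))) (V-supported d (suc k) h 0))
                    (-‿cong (*-congˡ (V-constant d (suc k) h))))
            (-‿cong (*-congˡ (V-constant d k h))))
    (solve 4 (λ g p f t → con (+ 0) :- (con (+ 1) :+ t) :* (:- g :* (con (+ 1) :+ t :* p) :* f) :- t :* (g :* (con (+ 1) :+ p) :* f)
        := :- :- g :* (con (+ 1) :+ t :* (t :* p)) :* f) refl (sg k) (t ^ k) (f d) t)

  unit₁-supported : ∀ n → unit₁ (suc (suc n)) ≈ 0#
  unit₁-supported n = refl

  -- The derivative of `V k` with respect to x at u = -1, that is the quotient of (-1)ᵏ k (1 - tᵏ),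
  -- the derivative in u, by dx/du = t - 1.
  V-unit₁ : ∀ k → V k unit₁ 0 ≈ - (sg k * fromℕ k * geometric t k)
  V-unit₁ zero = solve 0 (con (+ 0) :+ con (+ 0) := :- (con (+ 1) :* con (+ 0) :* con (+ 0))) refl
  V-unit₁ (suc zero) = solve 1 (λ t → con (+ 1) :- (con (+ 1) :+ t) :* con (+ 0)
      := :- (:- con (+ 1) :* (con (+ 1) :+ con (+ 0)) :* (con (+ 1) :+ con (+ 0)))) refl t
  V-unit₁ (suc (suc k)) = begin
    V (suc k) unit₁ 1 + - (s * V (suc k) unit₁ 0) + - (t * V k unit₁ 0)
      ≈⟨ +-cong (+-cong (V-constant 1 (suc k) unit₁-supported) (-‿cong (*-congˡ (trans (V-unit₁ (suc k)) (-‿cong (*-congˡ last))))))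
                (-‿cong (*-congˡ (V-unit₁ k))) ⟩
    - g * (1# + t * p) * 1# + - (s * - (- g * (1# + n) * (G + p))) + - (t * - (g * n * G))
      -- The solver takes tᵏ and [k] as independent; the relation 1 = [k] + tᵏ - t [k] has to be put
      -- in by hand, at the one place that needs it.
      ≈⟨ +-congʳ (+-congʳ (*-congʳ (*-congˡ (+-congʳ one)))) ⟩
    - g * (G + p + - (t * G) + t * p) * 1# + - (s * - (- g * (1# + n) * (G + p))) + - (t * - (g * n * G))
      ≈⟨ solve 5 (λ g t p n G →
           :- g :* (G :+ p :- t :* G :+ t :* p) :* con (+ 1) :- (con (+ 1) :+ t) :* (:- (:- g :* (con (+ 1) :+ n) :* (G :+ p))) :- t :* (:- (g :* n :* G))
           := :- (:- :- g :* (con (+ 1) :+ (con (+ 1) :+ n)) :* (G :+ p :+ t :* p))) refl g t p n G ⟩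
    - (- - g * (1# + (1# + n)) * (G + p + t * p))
      ≈⟨ sym (-‿cong (*-congˡ (trans (∑-last (suc k) (t ^_)) (+-congʳ last)))) ⟩
    - (- - g * (1# + (1# + n)) * geometric t (suc (suc k))) ∎
    where
    s g p n G : Carrier
    s = 1# + t
    g = sg k
    p = t ^ k
    n = fromℕ k
    G = geometric t k
    last : geometric t (suc k) ≈ G + p
    last = ∑-last k (t ^_)
    one : 1# ≈ G + p + - (t * G)
    one = trans (solve 2 (λ t G → con (+ 1) := con (+ 1) :+ t :* G :- t :* G) refl t G)
      (+-congʳ (trans (sym (geometric-suc t k)) last))

  -- The Gram matrix of L in bases adapted to V

  module Blocks (m′ : ℕ) where
    m : ℕ
    m = suc m′

    τ : Carrier
    τ = t ^ m

    block : ℕ → Sequence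
    block j = moment (j ℕ.* m)

    V-block : ∀ j n → V m (block (suc j)) n ≈ block j n + τ * block (suc (suc j)) n
    V-block j n = V-moment m (j ℕ.* m) n

    W : ℕ → Operator
    W zero f = f
    W (suc zero) f = V m f
    W (suc (suc k)) f n = V m (W (suc k) f) n + - (τ * W k f n)

    -- With a = u⁻ᵐ and b = τ uᵐ this is W_(k+1) = a W_k + bᵏ⁺¹, multiplied by u^((j+1)m).
    W-block : ∀ k j n → W (suc k) (block (suc j)) n ≈ W k (block j) n + τ ^ suc k * block (suc (suc (k ℕ.+ j))) n
    W-block zero j n = trans (V-block j n) (+-congˡ (*-congʳ (sym (*-identityʳ τ))))
    W-block (suc zero) j n = begin
      V m (V m (block (suc j))) n + - (τ * block (suc j) n)
        ≈⟨ +-congʳ (trans (V-cong m (V-block j) n) (V-linear m (block j) (block (suc (suc j))) τ n)) ⟩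
      V m (block j) n + τ * V m (block (suc (suc j))) n + - (τ * block (suc j) n)
        ≈⟨ +-congʳ (+-congˡ (*-congˡ (V-block (suc j) n))) ⟩
      V m (block j) n + τ * (block (suc j) n + τ * block (suc (suc (suc j))) n) + - (τ * block (suc j) n)
        ≈⟨ solve 4 (λ x y z τ → x :+ τ :* (y :+ τ :* z) :- τ :* y := x :+ τ :* (τ :* con (+ 1)) :* z) refl _ _ _ _ ⟩
      V m (block j) n + τ * (τ * 1#) * block (suc (suc (suc j))) n ∎
    W-block (suc (suc k)) j n = begin
      V m (W (suc (suc k)) (block (suc j))) n + - (τ * W (suc k) (block (suc j)) n)
        ≈⟨ +-cong (trans (V-cong m (W-block (suc k) j) n) (V-linear m (W (suc k) (block j)) (block (suc (suc (suc (k ℕ.+ j))))) _ n))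
                  (-‿cong (*-congˡ (W-block k j n))) ⟩
      V m (W (suc k) (block j)) n + τ * (τ * τ ^ k) * V m (block (suc (suc (suc (k ℕ.+ j))))) n
        + - (τ * (W k (block j) n + τ * τ ^ k * block (suc (suc (k ℕ.+ j))) n))
        ≈⟨ +-congʳ (+-congˡ (*-congˡ (V-block (suc (suc (k ℕ.+ j))) n))) ⟩
      V m (W (suc k) (block j)) n + τ * (τ * τ ^ k) * (block (suc (suc (k ℕ.+ j))) n + τ * block (suc (suc (suc (suc (k ℕ.+ j))))) n)
        + - (τ * (W k (block j) n + τ * τ ^ k * block (suc (suc (k ℕ.+ j))) n))
        ≈⟨ solve 6 (λ x y b d τ p → x :+ τ :* (τ :* p) :* (b :+ τ :* d) :- τ :* (y :+ τ :* p :* b)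
             := x :- τ :* y :+ τ :* (τ :* (τ :* p)) :* d) refl _ _ _ _ _ _ ⟩
      V m (W (suc k) (block j)) n + - (τ * W k (block j) n) + τ * (τ * (τ * τ ^ k)) * block (suc (suc (suc (suc (k ℕ.+ j))))) n ∎

    Monic-W : ∀ k → Monic (k ℕ.* m) (W k)
    Monic-W zero = Monic-id
    Monic-W (suc zero) = proj₁ (Monic-V m′ Monic-id)
    Monic-W (suc (suc k)) = Monic-≈ (λ f n → +-congˡ (-‿distribˡ-* _ _))
      (Monic-+ (- τ) (proj₁ (Monic-V m′ (Monic-W (suc k))))
        (Lower-≤ (s≤s (ℕ.≤-trans (ℕ.m≤n+m (k ℕ.* m) m) (ℕ.m≤n+m (m ℕ.+ k ℕ.* m) m′))) (Monic⇒Lower (Monic-W k))))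

    Monic-Vm : Monic m (V m)
    Monic-Vm = ≡.subst (λ d → Monic d (V m)) (ℕ.+-identityʳ m) (Monic-W 1)

    χ : Sequence
    χ = Monic.coeff Monic-Vm

    -- G (m ∸ s) s is the polynomial formed by the s + 1 leading terms of
    -- V m, divided by the appropriate power of x.
    G : ℕ → ℕ → Operator
    G i zero f n = f n
    G i (suc s) f n = G (suc i) s f (suc n) + χ i * f n

    G-coefficients : ∀ i s f n → G i s f n ≈ f (s ℕ.+ n) + ∑ s (λ p → χ (i ℕ.+ p) * f (p ℕ.+ n))
    G-coefficients i zero f n = sym (+-identityʳ _)
    G-coefficients i (suc s) f n = begin
      G (suc i) s f (suc n) + χ i * f n
        ≈⟨ +-congʳ (G-coefficients (suc i) s f (suc n)) ⟩
      f (s ℕ.+ suc n) + ∑ s (λ p → χ (suc i ℕ.+ p) * f (p ℕ.+ suc n)) + χ i * f n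
        ≈⟨ trans (+-assoc _ _ _) (+-cong (reflexive (≡.cong f (ℕ.+-suc s n)))
             (trans (+-comm _ _) (+-cong (*-congʳ (reflexive (≡.cong χ (≡.sym (ℕ.+-identityʳ i)))))
               (∑-cong s (λ p _ → *-cong (reflexive (≡.cong χ (≡.sym (ℕ.+-suc i p)))) (reflexive (≡.cong f (ℕ.+-suc p n)))))))) ⟩
      f (suc s ℕ.+ n) + ∑ (suc s) (λ p → χ (i ℕ.+ p) * f (p ℕ.+ n)) ∎

    G-full : ∀ f n → G 0 m f n ≈ V m f n
    G-full f n = trans (G-coefficients 0 m f n) (sym (Monic.rep Monic-Vm f n))

    Monic-G : ∀ i s {d O} → Monic d O → Monic (s ℕ.+ d) (G i s ∘ O)
    Monic-G i zero M = M
    Monic-G i (suc s) {d} {O} M =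
      Monic-+ (χ i) (Monic-shift (Monic-G (suc i) s M)) (Lower-≤ (s≤s (ℕ.m≤n+m d s)) (Monic⇒Lower M))

    G-cong : ∀ i s {f g : Sequence} n → (∀ p → p ≤ s ℕ.+ n → f p ≈ g p) → G i s f n ≈ G i s g n
    G-cong i zero n h = h n ℕ.≤-refl
    G-cong i (suc s) n h = +-cong
      (G-cong (suc i) s (suc n) (λ p p≤ → h p (≡.subst (p ≤_) (ℕ.+-suc s n) p≤)))
      (*-congˡ (h n (ℕ.m≤n+m n (suc s))))

    G-supported : ∀ i s {f : Sequence} → (∀ n → f (suc n) ≈ 0#) → ∀ n → G i s f (suc n) ≈ 0#
    G-supported i zero h n = h n
    G-supported i (suc s) h n = trans (+-cong (G-supported (suc i) s h (suc n)) (trans (*-congˡ (h n)) (zeroʳ _))) (+-identityˡ 0#)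

    G-moment-low : ∀ i s r → s ℕ.+ r < m → G i s (moment m) r ≈ moment m (s ℕ.+ r)
    G-moment-low i zero r _ = refl
    G-moment-low i (suc s) r s+r<m = begin
      G (suc i) s (moment m) (suc r) + χ i * moment m r
        ≈⟨ +-cong (G-moment-low (suc i) s (suc r) (≡.subst (_< m) (≡.sym (ℕ.+-suc s r)) s+r<m))
                  (trans (*-congˡ (power-< (ℕ.≤-<-trans (s≤s (ℕ.m≤n+m r s)) s+r<m))) (zeroʳ _)) ⟩
      moment m (s ℕ.+ suc r) + 0#
        ≈⟨ trans (+-identityʳ _) (reflexive (≡.cong (moment m) (ℕ.+-suc s r))) ⟩
      moment m (suc s ℕ.+ r) ∎

    -- Replacing (s, r + 1) by (s + 1, r) adds a coefficient of `V m` times a moment of uᵐ below its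
    -- order, which is 0. At s = m the whole of `V m` has been completed, and V uᵐ = 1 + τ u²ᵐ has
    -- no powers of q from q¹ to qᵐ.
    G-moment-high : ∀ i s r n → i ℕ.+ s ≡ m → s ℕ.+ r ≡ m ℕ.+ n → r < m → G i s (moment m) r ≈ 0#
    G-moment-high zero .m r n ≡.refl s+r r<m with ℕ.+-cancelˡ-≡ m r n s+r
    ... | ≡.refl = begin
      G 0 m (moment m) n
        ≈⟨ G-full (moment m) n ⟩
      V m (moment m) n
        ≡⟨ ≡.cong (λ k → V m (moment k) n) (≡.sym (ℕ.+-identityʳ m)) ⟩
      V m (block 1) n
        ≈⟨ V-block 0 n ⟩
      0# + τ * block 2 n
        ≈⟨ trans (+-identityˡ _) (trans (*-congˡ (power-< (s≤s (ℕ.<-≤-trans r<m (≡.subst (m ≤_) (≡.sym (ℕ.+-suc m′ (m′ ℕ.+ 0))) (s≤s (ℕ.m≤m+n m′ (m′ ℕ.+ 0)))))))) (zeroʳ τ)) ⟩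
      0# ∎
    G-moment-high (suc i) s zero n i+s s+r r<m =
      ⊥-elim (ℕ.<⇒≢ (ℕ.<-≤-trans (≡.subst (s <_) i+s (s≤s (ℕ.m≤n+m s i))) (ℕ.m≤m+n m n)) (≡.trans (≡.sym (ℕ.+-identityʳ s)) s+r))
    G-moment-high (suc i) s (suc r) n i+s s+r r<m = begin
      G (suc i) s (moment m) (suc r)
        ≈⟨ sym (trans (+-congˡ (trans (*-congˡ (power-< r<m)) (zeroʳ _))) (+-identityʳ _)) ⟩
      G i (suc s) (moment m) r
        ≈⟨ G-moment-high i (suc s) r n (≡.trans (ℕ.+-suc i s) i+s) (≡.trans (≡.sym (ℕ.+-suc s r)) s+r) (ℕ.<-trans (ℕ.n<1+n r) r<m) ⟩
      0# ∎

    G-moment-on : ∀ i s r → suc (s ℕ.+ r) ≡ m → G i s (moment m) r ≈ 1#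
    G-moment-on i s r eq = trans (G-moment-low i s r (≡.subst (s ℕ.+ r <_) eq (ℕ.n<1+n _)))
      (trans (reflexive (≡.cong (λ k → power k m) eq)) (power-diagonal m))

    G-moment-off : ∀ i s r → i ℕ.+ s ≡ m → r < m → suc (s ℕ.+ r) ≢ m → G i s (moment m) r ≈ 0#
    G-moment-off i s r i+s r<m neq with s ℕ.+ r ℕ.<? m
    ... | yes s+r<m = trans (G-moment-low i s r s+r<m) (power-< (ℕ.≤∧≢⇒< s+r<m neq))
    ... | no s+r≮m = G-moment-high i s r (s ℕ.+ r ℕ.∸ m) i+s (≡.sym (ℕ.m+[n∸m]≡n (ℕ.≮⇒≥ s+r≮m))) r<m

    block-high : ∀ k n → suc n < m ℕ.+ m → block (suc (suc k)) n ≈ 0#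
    block-high k n n<2m = power-< (ℕ.<-≤-trans n<2m (ℕ.+-monoʳ-≤ m (ℕ.m≤m+n m (k ℕ.* m))))

    block-one : ∀ n → block 1 n ≈ moment m n
    block-one n = reflexive (≡.cong (λ k → moment k n) (ℕ.+-identityʳ m))

    -- Each use of `W-block` leaves a remainder of order at least 2m in q, invisible in the range n
    -- + 1 < 2m. The products g_s xʳ inside a block reach no further (`in-range`).
    W-block-on : ∀ k n → suc n < m ℕ.+ m → W k (block (suc k)) n ≈ moment m n
    W-block-on zero n _ = block-one n
    W-block-on (suc k) n n<2m = trans (W-block k (suc k) n)
      (trans (+-cong (W-block-on k n n<2m) (trans (*-congˡ (block-high (k ℕ.+ suc k) n n<2m)) (zeroʳ _))) (+-identityʳ _))

    W-block-off : ∀ k l n → k ≢ l → suc n < m ℕ.+ m → W k (block (suc l)) n ≈ 0#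
    W-block-off zero zero n k≢l _ = ⊥-elim (k≢l ≡.refl)
    W-block-off zero (suc l) n _ n<2m = block-high l n n<2m
    W-block-off (suc k) zero n _ n<2m = trans (W-block k 0 n)
      (trans (+-cong (Monic-zero (Monic-W k) (λ _ → refl) n) (trans (*-congˡ (block-high (k ℕ.+ 0) n n<2m)) (zeroʳ _))) (+-identityˡ 0#))
    W-block-off (suc k) (suc l) n k≢l n<2m = trans (W-block k (suc l) n)
      (trans (+-cong (W-block-off k l n (k≢l ∘ ≡.cong suc) n<2m) (trans (*-congˡ (block-high (k ℕ.+ suc l) n n<2m)) (zeroʳ _))) (+-identityˡ 0#))

    -- In W_k uᵐ = W_(k-1) + τᵏ u^((k+1)m) the polynomial W_(k-1) has no moments, so W_k kills all
    -- moments of uᵐ below the order of the remainder.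
    W-moment : ∀ k n → W k (moment m) n ≈ τ ^ k * block (suc k) n
    W-moment k n = trans (Monic-cong (Monic-W k) (λ i → sym (block-one i)) n) (powers k)
      where
      powers : ∀ k → W k (block 1) n ≈ τ ^ k * block (suc k) n
      powers zero = sym (*-identityˡ _)
      powers (suc k) = trans (W-block k 0 n)
        (trans (+-cong (Monic-zero (Monic-W k) (λ _ → refl) n) (reflexive (≡.cong (λ x → τ ^ suc k * block (suc (suc x)) n) (ℕ.+-identityʳ k)))) (+-identityˡ _))

    -- The values of the functional f at the basis elements xʳ W_k and g_s W_l.
    row column : ℕ → ℕ → Sequence → Carrier
    row k r f = W k f r
    column l s f = G (m ℕ.∸ s) s (W l f) 0

    gram : ℕ → ℕ → ℕ → ℕ → Carrier
    gram k r l s = column l s (λ p → row k r (λ q → moment m (p ℕ.+ q)))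

    private
      -- Both polynomials act on the same functional. Letting W_k act first replaces uᵐ by τᵏ
      -- u^((k+1)m), on which W_l then distinguishes l = k from l ≠ k.
      gram-reduced : ∀ k r l s → gram k r l s ≈ τ ^ k * G (m ℕ.∸ s) s (W l (block (suc k))) r
      gram-reduced k r l s = begin
        gram k r l s
          ≈⟨ Monic-cong GW (λ p → trans (Monic-cong (Monic-W k) (λ q → reflexive (≡.cong (moment m) (ℕ.+-comm p q))) r)
               (trans (Monic-translate (Monic-W k) (moment m) p r)
               (trans (W-moment k (r ℕ.+ p)) (reflexive (≡.cong (λ x → τ ^ k * block (suc k) x) (ℕ.+-comm r p)))))) 0 ⟩
        G (m ℕ.∸ s) s (W l (λ p → τ ^ k * block (suc k) (p ℕ.+ r))) 0
          ≈⟨ Monic-scale GW (λ p → block (suc k) (p ℕ.+ r)) (τ ^ k) 0 ⟩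
        τ ^ k * G (m ℕ.∸ s) s (W l (λ p → block (suc k) (p ℕ.+ r))) 0
          ≈⟨ *-congˡ (Monic-translate GW (block (suc k)) r 0) ⟩
        τ ^ k * G (m ℕ.∸ s) s (W l (block (suc k))) r ∎
        where
        GW : Monic (s ℕ.+ l ℕ.* m) (G (m ℕ.∸ s) s ∘ W l)
        GW = Monic-G (m ℕ.∸ s) s (Monic-W l)

      in-range : ∀ {r s p} → r < m → s < m → p ≤ s ℕ.+ r → suc p < m ℕ.+ m
      in-range r<m (s≤s s≤m′) p≤ = s≤s (ℕ.≤-<-trans p≤ (ℕ.+-mono-≤-< s≤m′ r<m))

    gram-on : ∀ k r s → r < m → s < m → suc (s ℕ.+ r) ≡ m → gram k r k s ≈ τ ^ k
    gram-on k r s r<m s<m eq = trans (gram-reduced k r k s) (trans (*-congˡ (trans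
      (G-cong (m ℕ.∸ s) s r (λ p p≤ → W-block-on k p (in-range r<m s<m p≤)))
      (G-moment-on (m ℕ.∸ s) s r eq))) (*-identityʳ _))

    gram-off-antidiagonal : ∀ k r s → r < m → s < m → suc (s ℕ.+ r) ≢ m → gram k r k s ≈ 0#
    gram-off-antidiagonal k r s r<m s<m neq = trans (gram-reduced k r k s) (trans (*-congˡ (trans
      (G-cong (m ℕ.∸ s) s r (λ p p≤ → W-block-on k p (in-range r<m s<m p≤)))
      (G-moment-off (m ℕ.∸ s) s r (ℕ.m∸n+n≡m (ℕ.<⇒≤ s<m)) r<m neq))) (zeroʳ _))

    gram-off-block : ∀ k r l s → r < m → s < m → l ≢ k → gram k r l s ≈ 0#
    gram-off-block k r l s r<m s<m l≢k = trans (gram-reduced k r l s) (trans (*-congˡ (trans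
      (G-cong (m ℕ.∸ s) s r (λ p p≤ → W-block-off l k p l≢k (in-range r<m s<m p≤)))
      (Monic-zero (Monic-G (m ℕ.∸ s) s Monic-id) (λ _ → refl) r))) (zeroʳ _))

    W-supported : ∀ k {f : Sequence} → (∀ n → f (suc n) ≈ 0#) → ∀ n → W k f (suc n) ≈ 0#
    W-supported zero h = h
    W-supported (suc zero) h = V-supported 0 m h
    W-supported (suc (suc k)) h n = trans
      (+-cong (V-supported 0 m (W-supported (suc k) h) n) (-‿cong (trans (*-congˡ (W-supported k h n)) (zeroʳ τ))))
      (trans (+-identityˡ _) -0#≈0#)

    -- At u = -1 the sum aᵏ + aᵏ⁻¹ b + ... + bᵏ has a = (-1)ᵐ and b = (-1)ᵐ τ.
    W-constant : ∀ k → W k unit₀ 0 ≈ sg m ^ k * geometric τ (suc k)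
    W-constant zero = solve 0 (con (+ 1) := con (+ 1) :* (con (+ 1) :+ con (+ 0))) refl
    W-constant (suc zero) = trans (V-constant 0 m {unit₀} (λ _ → refl))
      (solve 2 (λ g τ → g :* (con (+ 1) :+ τ) :* con (+ 1) := g :* con (+ 1) :* (con (+ 1) :+ (τ :* con (+ 1) :+ con (+ 0)))) refl (sg m) τ)
    W-constant (suc (suc k)) = begin
      V m (W (suc k) unit₀) 0 + - (τ * W k unit₀ 0)
        ≈⟨ +-cong (trans (V-constant 0 m (W-supported (suc k) {unit₀} (λ _ → refl))) (*-congˡ (trans (W-constant (suc k)) (*-congˡ (geometric-suc τ (suc k))))))
                  (-‿cong (*-congˡ (W-constant k))) ⟩
      g * (1# + τ) * (g * p * (1# + τ * q)) + - (τ * (p * q))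
        -- A factor (sg m)² = 1 brings both terms to the same power of `sg m`.
        ≈⟨ +-congˡ (-‿cong (trans (sym (*-identityˡ _)) (*-congʳ (sym (sg-square m))))) ⟩
      g * (1# + τ) * (g * p * (1# + τ * q)) + - (g * g * (τ * (p * q)))
        ≈⟨ solve 4 (λ g τ p q → g :* (con (+ 1) :+ τ) :* (g :* p :* (con (+ 1) :+ τ :* q)) :- g :* g :* (τ :* (p :* q))
             := g :* (g :* p) :* (con (+ 1) :+ τ :* (con (+ 1) :+ τ :* q))) refl g τ p q ⟩
      g * (g * p) * (1# + τ * (1# + τ * q))
        ≈⟨ sym (*-congˡ (trans (geometric-suc τ (suc (suc k))) (+-congˡ (*-congˡ (geometric-suc τ (suc k)))))) ⟩
      g * (g * p) * geometric τ (suc (suc (suc k))) ∎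
      where
      g p q : Carrier
      g = sg m
      p = g ^ k
      q = geometric τ (suc k)

    corner : ℕ → Carrier
    corner k = W k unit₀ 0

    corner-square : ∀ k → corner k * corner k ≈ geometric τ (suc k) * geometric τ (suc k)
    corner-square k = trans (*-cong (W-constant k) (W-constant k))
      (trans (solve 2 (λ p q → p :* q :* (p :* q) := p :* p :* (q :* q)) refl (sg m ^ k) (geometric τ (suc k)))
        (trans (*-congʳ (square k)) (*-identityˡ _)))
      where
      square : ∀ k → sg m ^ k * sg m ^ k ≈ 1#
      square zero = *-identityˡ 1#
      square (suc k) = trans (solve 2 (λ g p → g :* p :* (g :* p) := g :* g :* (p :* p)) refl (sg m) (sg m ^ k))
        (trans (*-cong (sg-square m) (square k)) (*-identityˡ 1#))

    row-unit₀ : ∀ k r → row k (suc r) unit₀ ≈ 0#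
    row-unit₀ k r = W-supported k {unit₀} (λ _ → refl) r

    -- The constant term of the truncation g_(s+1) is the lowest coefficient of `V m` that it
    -- retains, the one of index m - (s + 1).
    column-unit₀ : ∀ l s → column l (suc s) unit₀ ≈ χ (m ℕ.∸ suc s) * corner l
    column-unit₀ l s = trans (+-congʳ (G-supported _ s (W-supported l {unit₀} (λ _ → refl)) 0)) (+-identityˡ _)

  -- `χ 1` is read off by letting `V m` act on `unit₁`; here m has the form m″ + 2, so that a linear
  -- coefficient below the leading one exists.
  χ-linear : ∀ m″ → let open Blocks (suc m″) in χ 1 ≈ sg (suc m″) * (fromℕ m * geometric t m)
  χ-linear m″ = begin
    χ 1
      ≈⟨ solve 2 (λ a b → b := con (+ 0) :+ (a :* con (+ 0) :+ (b :* con (+ 1) :+ con (+ 0)))) refl (χ 0) (χ 1) ⟩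
    0# + (χ 0 * 0# + (χ 1 * 1# + 0#))
      ≈⟨ +-congˡ (+-congˡ (+-congˡ (sym (∑-zero m″ (λ p _ → zeroʳ _))))) ⟩
    unit₁ (m ℕ.+ 0) + ∑ m (λ p → χ p * unit₁ (p ℕ.+ 0))
      ≈⟨ sym (Monic.rep Monic-Vm unit₁ 0) ⟩
    V m unit₁ 0
      ≈⟨ V-unit₁ m ⟩
    - (- sg (suc m″) * fromℕ m * geometric t m)
      ≈⟨ solve 3 (λ g n G → :- (:- g :* n :* G) := g :* (n :* G)) refl _ _ _ ⟩
    sg (suc m″) * (fromℕ m * geometric t m) ∎
    where open Blocks (suc m″)

-- Extended sequences and the exponents of t

extend-≥ : ∀ {a : Level} {A : Set a} n (f : ℕ → A) x {j} → n ≤ j → extend n f x j ≡ x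
extend-≥ zero f x n≤j = ≡.refl
extend-≥ (suc n) f x (s≤s n≤j) = extend-≥ n (f ∘ suc) x n≤j

extend-map : ∀ {a b : Level} {A : Set a} {B : Set b} (h : A → B) n (f : ℕ → A) x j →
  extend n (h ∘ f) (h x) j ≡ h (extend n f x j)
extend-map h zero f x j = ≡.refl
extend-map h (suc n) f x zero = ≡.refl
extend-map h (suc n) f x (suc j) = extend-map h n (f ∘ suc) x j

-- blocksExponent k n is the exponent of t contributed by the blocks k, …,
-- k + n − 1, and fullExponent k n that of the blocks k, …, k + n after the
-- removal of one row from the last.
module Exponents (m″ : ℕ) where
  open +-*-Solver

  blocksExponent : ℕ → ℕ → ℕ
  blocksExponent k zero = 0
  blocksExponent k (suc n) = suc (suc m″) ℕ.* k ℕ.* suc (suc m″) ℕ.+ blocksExponent (suc k) n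

  fullExponent : ℕ → ℕ → ℕ
  fullExponent k zero = suc (suc m″) ℕ.* k ℕ.* suc m″
  fullExponent k (suc n) = suc (suc m″) ℕ.* k ℕ.* suc (suc m″) ℕ.+ fullExponent (suc k) n

  private
    m : ℕ
    m = suc (suc m″)

  -- On the left a row is missing from block k, on the right from block k + n; the entries τᵏ and
  -- τᵏ⁺ⁿ that are lost differ by the factor tᵐⁿ.
  full-blocks : ∀ n k → m ℕ.* k ℕ.* suc m″ ℕ.+ blocksExponent (suc k) n ≡ fullExponent k n ℕ.+ m ℕ.* n
  full-blocks zero k = ≡.cong (m ℕ.* k ℕ.* suc m″ ℕ.+_) (≡.sym (ℕ.*-zeroʳ m))
  full-blocks (suc n) k = ℕ.+-cancelʳ-≡ (m ℕ.* n) _ _ (begin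
    m ℕ.* k ℕ.* suc m″ ℕ.+ (m ℕ.* suc k ℕ.* m ℕ.+ e) ℕ.+ m ℕ.* n
      ≡⟨ solve 4 (λ m e n k →
          let m₁ = con 1 :+ m ; m₂ = con 2 :+ m ; k₁ = con 1 :+ k in
          m₂ :* k :* m₁ :+ (m₂ :* k₁ :* m₂ :+ e) :+ m₂ :* n
          := m₂ :* k :* m₂ :+ (m₂ :* k₁ :* m₁ :+ e) :+ m₂ :* (con 1 :+ n)) ≡.refl m″ e n k ⟩
    m ℕ.* k ℕ.* m ℕ.+ (m ℕ.* suc k ℕ.* suc m″ ℕ.+ e) ℕ.+ m ℕ.* suc n
      ≡⟨ ≡.cong (λ x → m ℕ.* k ℕ.* m ℕ.+ x ℕ.+ m ℕ.* suc n) (full-blocks n (suc k)) ⟩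
    m ℕ.* k ℕ.* m ℕ.+ (fullExponent (suc k) n ℕ.+ m ℕ.* n) ℕ.+ m ℕ.* suc n
      ≡⟨ solve 4 (λ x f u v → x :+ (f :+ u) :+ v := x :+ f :+ v :+ u) ≡.refl (m ℕ.* k ℕ.* m) (fullExponent (suc k) n) (m ℕ.* n) (m ℕ.* suc n) ⟩
    m ℕ.* k ℕ.* m ℕ.+ fullExponent (suc k) n ℕ.+ m ℕ.* suc n ℕ.+ m ℕ.* n ∎)
    where
    open ≡.≡-Reasoning
    e : ℕ
    e = blocksExponent (suc (suc k)) n

  -- Twice the sum of m² i for i from k to k + n - 1, with the negative term moved to the left to
  -- avoid truncated subtraction.
  blocks-closed : ∀ n k → blocksExponent k n ℕ.* 2 ℕ.+ m ℕ.* m ℕ.* n ≡ m ℕ.* m ℕ.* n ℕ.* (n ℕ.+ 2 ℕ.* k)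
  blocks-closed zero k = ≡.trans (ℕ.*-zeroʳ (m ℕ.* m)) (≡.sym (≡.cong (ℕ._* (2 ℕ.* k)) (ℕ.*-zeroʳ (m ℕ.* m))))
  blocks-closed (suc n) k = begin
    (m ℕ.* k ℕ.* m ℕ.+ e) ℕ.* 2 ℕ.+ m ℕ.* m ℕ.* suc n
      ≡⟨ solve 4 (λ m e n k → (m :* k :* m :+ e) :* con 2 :+ m :* m :* (con 1 :+ n)
           := m :* k :* m :* con 2 :+ m :* m :+ (e :* con 2 :+ m :* m :* n)) ≡.refl m e n k ⟩
    m ℕ.* k ℕ.* m ℕ.* 2 ℕ.+ m ℕ.* m ℕ.+ (e ℕ.* 2 ℕ.+ m ℕ.* m ℕ.* n)
      ≡⟨ ≡.cong (m ℕ.* k ℕ.* m ℕ.* 2 ℕ.+ m ℕ.* m ℕ.+_) (blocks-closed n (suc k)) ⟩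
    m ℕ.* k ℕ.* m ℕ.* 2 ℕ.+ m ℕ.* m ℕ.+ m ℕ.* m ℕ.* n ℕ.* (n ℕ.+ 2 ℕ.* suc k)
      ≡⟨ solve 3 (λ m n k → m :* k :* m :* con 2 :+ m :* m :+ m :* m :* n :* (n :+ con 2 :* (con 1 :+ k))
           := m :* m :* (con 1 :+ n) :* (con 1 :+ n :+ con 2 :* k)) ≡.refl m n k ⟩
    m ℕ.* m ℕ.* suc n ℕ.* (suc n ℕ.+ 2 ℕ.* k) ∎
    where
    open ≡.≡-Reasoning
    e : ℕ
    e = blocksExponent (suc k) n

  private
    halve : ∀ {a b} → a ℕ.* 2 ≡ b → a ≡ b ℕ./ 2
    halve {a} ≡.refl = ≡.sym (ℕ.m*n/n≡m a 2)

  blocks-exponent : ∀ n → blocksExponent 0 n ≡ (m ℕ.* m ℕ.* n ℕ.* (n ℕ.∸ 1)) ℕ./ 2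
  blocks-exponent zero = halve (≡.sym (ℕ.*-zeroʳ (m ℕ.* m ℕ.* 0)))
  blocks-exponent (suc n) = halve {b = m ℕ.* m ℕ.* suc n ℕ.* n} (ℕ.+-cancelʳ-≡ (m ℕ.* m ℕ.* suc n) _ _ (≡.trans (blocks-closed (suc n) 0)
    (solve 2 (λ m n → m :* m :* (con 1 :+ n) :* (con 1 :+ n :+ con 2 :* con 0)
      := m :* m :* (con 1 :+ n) :* n :+ m :* m :* (con 1 :+ n)) ≡.refl m n)))

  private
    ∸-witness : ∀ {d} n → d ℕ.≤ m ℕ.* suc n → m ℕ.* suc n ≡ (m ℕ.* suc n ℕ.∸ d) ℕ.+ d
    ∸-witness n d≤ = ≡.sym (ℕ.m∸n+n≡m d≤)

  full-exponent : ∀ n → fullExponent 0 n ≡ (m ℕ.* n ℕ.* (m ℕ.* suc n ℕ.∸ 2)) ℕ./ 2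
  full-exponent n = halve {b = m ℕ.* n ℕ.* (m ℕ.* suc n ℕ.∸ 2)} (ℕ.+-cancelʳ-≡ (m ℕ.* n ℕ.* 2 ℕ.+ m ℕ.* m ℕ.* n) _ _ (begin
    f ℕ.* 2 ℕ.+ (m ℕ.* n ℕ.* 2 ℕ.+ m ℕ.* m ℕ.* n)
      ≡⟨ solve 3 (λ m f n → f :* con 2 :+ (m :* n :* con 2 :+ m :* m :* n) := (f :+ m :* n) :* con 2 :+ m :* m :* n) ≡.refl m f n ⟩
    (f ℕ.+ m ℕ.* n) ℕ.* 2 ℕ.+ m ℕ.* m ℕ.* n
      ≡⟨ ≡.cong (λ z → z ℕ.* 2 ℕ.+ m ℕ.* m ℕ.* n) (≡.trans (≡.sym (full-blocks n 0)) (≡.cong (λ z → z ℕ.* suc m″ ℕ.+ blocksExponent 1 n) (ℕ.*-zeroʳ m))) ⟩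
    blocksExponent 1 n ℕ.* 2 ℕ.+ m ℕ.* m ℕ.* n
      ≡⟨ blocks-closed n 1 ⟩
    m ℕ.* m ℕ.* n ℕ.* (n ℕ.+ 2 ℕ.* 1)
      ≡⟨ solve 2 (λ m n → m :* m :* n :* (n :+ con 2 :* con 1) := m :* n :* (m :* (con 1 :+ n)) :+ m :* m :* n) ≡.refl m n ⟩
    m ℕ.* n ℕ.* (m ℕ.* suc n) ℕ.+ m ℕ.* m ℕ.* n
      ≡⟨ ≡.cong (λ z → m ℕ.* n ℕ.* z ℕ.+ m ℕ.* m ℕ.* n) (∸-witness n (ℕ.≤-trans (s≤s (s≤s z≤n)) (ℕ.m≤m*n m (suc n)))) ⟩
    m ℕ.* n ℕ.* (x ℕ.+ 2) ℕ.+ m ℕ.* m ℕ.* n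
      ≡⟨ solve 3 (λ m n x → m :* n :* (x :+ con 2) :+ m :* m :* n := m :* n :* x :+ (m :* n :* con 2 :+ m :* m :* n)) ≡.refl m n x ⟩
    m ℕ.* n ℕ.* x ℕ.+ (m ℕ.* n ℕ.* 2 ℕ.+ m ℕ.* m ℕ.* n) ∎))
    where
    open ≡.≡-Reasoning
    f x : ℕ
    f = fullExponent 0 n
    x = m ℕ.* suc n ℕ.∸ 2

  partial-exponent : ∀ n → blocksExponent 0 n ℕ.+ m ℕ.* n ℕ.* m″ ≡ (m ℕ.* n ℕ.* (m ℕ.* suc n ℕ.∸ 4)) ℕ./ 2
  -- Here m ∸ 4 may be truncated, but it is multiplied by n = 0.
  partial-exponent zero = halve (≡.trans (≡.cong (λ z → z ℕ.* m″ ℕ.* 2) (ℕ.*-zeroʳ m)) (≡.sym (≡.cong (ℕ._* (m ℕ.* 1 ℕ.∸ 4)) (ℕ.*-zeroʳ m))))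
  partial-exponent (suc n) = halve {b = m ℕ.* suc n ℕ.* (m ℕ.* suc (suc n) ℕ.∸ 4)} (ℕ.+-cancelʳ-≡ (m ℕ.* m ℕ.* suc n) _ _ (begin
    (e ℕ.+ m ℕ.* suc n ℕ.* m″) ℕ.* 2 ℕ.+ m ℕ.* m ℕ.* suc n
      ≡⟨ solve 4 (λ m e n m″ → (e :+ m :* (con 1 :+ n) :* m″) :* con 2 :+ m :* m :* (con 1 :+ n)
           := e :* con 2 :+ m :* m :* (con 1 :+ n) :+ m :* (con 1 :+ n) :* m″ :* con 2) ≡.refl m e n m″ ⟩
    e ℕ.* 2 ℕ.+ m ℕ.* m ℕ.* suc n ℕ.+ m ℕ.* suc n ℕ.* m″ ℕ.* 2
      ≡⟨ ≡.cong (ℕ._+ m ℕ.* suc n ℕ.* m″ ℕ.* 2) (blocks-closed (suc n) 0) ⟩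
    m ℕ.* m ℕ.* suc n ℕ.* (suc n ℕ.+ 2 ℕ.* 0) ℕ.+ m ℕ.* suc n ℕ.* m″ ℕ.* 2
      ≡⟨ solve 3 (λ m n m″ → m :* m :* (con 1 :+ n) :* (con 1 :+ n :+ con 2 :* con 0) :+ m :* (con 1 :+ n) :* m″ :* con 2
           := m :* (con 1 :+ n) :* (m :* (con 1 :+ n) :+ m″ :* con 2)) ≡.refl m n m″ ⟩
    m ℕ.* suc n ℕ.* (m ℕ.* suc n ℕ.+ m″ ℕ.* 2)
      ≡⟨ ≡.cong (m ℕ.* suc n ℕ.*_) (ℕ.+-cancelʳ-≡ 4 _ _ split) ⟩
    m ℕ.* suc n ℕ.* (y ℕ.+ m)
      ≡⟨ solve 3 (λ m n y → m :* (con 1 :+ n) :* (y :+ m) := m :* (con 1 :+ n) :* y :+ m :* m :* (con 1 :+ n)) ≡.refl m n y ⟩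
    m ℕ.* suc n ℕ.* y ℕ.+ m ℕ.* m ℕ.* suc n ∎))
    where
    open ≡.≡-Reasoning
    e y : ℕ
    e = blocksExponent 0 (suc n)
    y = m ℕ.* suc (suc n) ℕ.∸ 4
    4≤ : 4 ℕ.≤ m ℕ.* suc (suc n)
    4≤ = ℕ.*-mono-≤ {2} {m} {2} {suc (suc n)} (s≤s (s≤s z≤n)) (s≤s (s≤s z≤n))
    split : m ℕ.* suc n ℕ.+ m″ ℕ.* 2 ℕ.+ 4 ≡ y ℕ.+ m ℕ.+ 4
    split = begin
      m ℕ.* suc n ℕ.+ m″ ℕ.* 2 ℕ.+ 4
        ≡⟨ solve 2 (λ n m″ → let m = con 2 :+ m″ in m :* (con 1 :+ n) :+ m″ :* con 2 :+ con 4 := m :* (con 2 :+ n) :+ m) ≡.refl n m″ ⟩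
      m ℕ.* suc (suc n) ℕ.+ m
        ≡⟨ ≡.cong (ℕ._+ m) (∸-witness (suc n) 4≤) ⟩
      y ℕ.+ 4 ℕ.+ m
        ≡⟨ solve 2 (λ y m → y :+ con 4 :+ m := y :+ m :+ con 4) ≡.refl y m ⟩
      y ℕ.+ m ℕ.+ 4 ∎

-- Change of basis in bordered determinants

module HankelReduction {c ℓ : Level} (R : CommutativeRing c ℓ) (t : CommutativeRing.Carrier R) where
  open CommutativeRing R hiding (zero)
  open import Algebra.Properties.Semiring.Exp semiring using (_^_; ^-homo-*; ^-assocʳ; ^-congʳ)
  open import Relation.Binary.Reasoning.Setoid setoid
  open IntegerCoefficientSolver R
  open Determinants R
  open BorderedDeterminants R
  open Operators R t

  record MonicFunctional (d : ℕ) (T : Sequence → Carrier) : Set (c ⊔ ℓ) where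
    constructor monic
    field
      coeff : Sequence
      rep : ∀ f → T f ≈ f d + ∑ d (λ p → coeff p * f p)

  Monic⇒MonicFunctional : ∀ {d O} → Monic d O → MonicFunctional d (λ f → O f 0)
  Monic⇒MonicFunctional {d} (monic a rep) = monic a λ f → trans (rep f 0)
    (+-cong (reflexive (≡.cong f (ℕ.+-identityʳ d)))
            (∑-cong d (λ p _ → *-congˡ (reflexive (≡.cong f (ℕ.+-identityʳ p))))))

  MonicFunctional-≈ : ∀ {d T U} → (∀ f → U f ≈ T f) → MonicFunctional d T → MonicFunctional d U
  MonicFunctional-≈ U≈T (monic a rep) = monic a λ f → trans (U≈T f) (rep f)

  bordered-rows : ∀ n A v w x {i} j → i < n → bordered n A v w x i j ≡ extend n (A i) (v i) j
  bordered-rows n A v w x j i<n = ≡.cong (λ row → row j) (extend-< n (λ i → extend n (A i) (v i)) (extend n w x) i<n)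

  bordered-last-row : ∀ n A v w x j → bordered n A v w x n j ≡ extend n w x j
  bordered-last-row n A v w x j = ≡.cong (λ row → row j) (extend-last n (λ i → extend n (A i) (v i)) (extend n w x))

  -- The monic functionals `T i` are traded for the coefficients at xⁱ. The border column e is one
  -- more argument of the `T i`, next to the `F j`, so it is transformed by the same row operations.
  det-bordered-eliminate : ∀ n {T : ℕ → Sequence → Carrier} → (∀ i → MonicFunctional i (T i)) →
    ∀ (F : ℕ → Sequence) (e : Sequence) w x →
    det (suc n) (bordered n (λ i j → T i (F j)) (λ i → T i e) w x) ≈ det (suc n) (bordered n (λ i j → F j i) e w x)
  det-bordered-eliminate n {T} T-monic F e w x = det-unitriangular (suc n) M N a eliminate
    where
    M N : Matrix
    M = bordered n (λ i j → F j i) e w x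
    N = bordered n (λ i j → T i (F j)) (λ i → T i e) w x
    -- The zero coefficients at index n leave the border row untouched.
    a : ℕ → ℕ → Carrier
    a = extend n (λ i → MonicFunctional.coeff (T-monic i)) (λ _ → 0#)
    E : ℕ → Sequence
    E = extend n F e
    M-row : ∀ p j → p < n → M p j ≡ E j p
    M-row p j p<n = ≡.trans (bordered-rows n _ e w x j p<n) (extend-map (λ f → f p) n F e j)
    N-row : ∀ i j → i < n → N i j ≡ T i (E j)
    N-row i j i<n = ≡.trans (bordered-rows n _ (λ i → T i e) w x j i<n) (extend-map (T i) n F e j)
    eliminate : ∀ i j → i < suc n → N i j ≈ M i j + ∑ i (λ p → a i p * M p j)
    eliminate i j i<1+n with i ℕ.≟ n
    ... | yes ≡.refl = trans (reflexive (≡.trans (bordered-last-row n _ _ w x j) (≡.sym (bordered-last-row n _ e w x j))))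
      (sym (trans (+-congˡ (∑-zero n (λ p _ → trans (*-congʳ (reflexive (≡.cong (λ b → b p) (extend-last n (λ i → MonicFunctional.coeff (T-monic i)) (λ _ → 0#))))) (zeroˡ _)))) (+-identityʳ _)))
    ... | no i≢n = begin
      N i j
        ≡⟨ N-row i j i<n ⟩
      T i (E j)
        ≈⟨ MonicFunctional.rep (T-monic i) (E j) ⟩
      E j i + ∑ i (λ p → MonicFunctional.coeff (T-monic i) p * E j p)
        ≈⟨ sym (+-cong (reflexive (M-row i j i<n)) (∑-cong i (λ p p<i → *-cong
             (reflexive (≡.cong (λ b → b p) (extend-< n (λ i → MonicFunctional.coeff (T-monic i)) _ i<n)))
             (reflexive (M-row p j (ℕ.<-trans p<i i<n)))))) ⟩
      M i j + ∑ i (λ p → a i p * M p j) ∎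
      where
      i<n : i < n
      i<n = ℕ.≤∧≢⇒< (s≤s⁻¹ i<1+n) i≢n

  bordered-ᵀ : ∀ n A v w x i j → i < suc n → j < suc n → bordered n A v w x i j ≡ bordered n (A ᵀ) w v x j i
  bordered-ᵀ n A v w x i j i≤n j≤n with i ℕ.≟ n | j ℕ.≟ n
  ... | yes ≡.refl | yes ≡.refl = ≡.trans (≡.trans (bordered-last-row n A v w x n) (extend-last n w x))
          (≡.sym (≡.trans (bordered-last-row n (A ᵀ) w v x n) (extend-last n v x)))
  ... | yes ≡.refl | no j≢n = ≡.trans (bordered-row n A v w x j<n) (≡.sym (bordered-column n (A ᵀ) w v x j<n))
    where
    j<n : j < n
    j<n = ℕ.≤∧≢⇒< (s≤s⁻¹ j≤n) j≢n
  ... | no i≢n | yes ≡.refl = ≡.trans (bordered-column n A v w x i<n) (≡.sym (bordered-row n (A ᵀ) w v x i<n))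
    where
    i<n : i < n
    i<n = ℕ.≤∧≢⇒< (s≤s⁻¹ i≤n) i≢n
  ... | no i≢n | no j≢n = ≡.trans (bordered-inner n A v w x i<n j<n) (≡.sym (bordered-inner n (A ᵀ) w v x j<n i<n))
    where
    i<n : i < n
    i<n = ℕ.≤∧≢⇒< (s≤s⁻¹ i≤n) i≢n
    j<n : j < n
    j<n = ℕ.≤∧≢⇒< (s≤s⁻¹ j≤n) j≢n

  det-bordered-ᵀ : ∀ n A v w x → det (suc n) (bordered n A v w x) ≈ det (suc n) (bordered n (A ᵀ) w v x)
  det-bordered-ᵀ n A v w x = trans
    (det-cong (suc n) (λ i j i≤n j≤n → reflexive (bordered-ᵀ n A v w x i j i≤n j≤n)))
    (sym (det-ᵀ (suc n) (bordered n (A ᵀ) w v x)))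

  det-bordered-cong : ∀ n {A A′ v v′ w w′} x → (∀ i j → A i j ≈ A′ i j) → (∀ i → v i ≈ v′ i) → (∀ j → w j ≈ w′ j) →
    det (suc n) (bordered n A v w x) ≈ det (suc n) (bordered n A′ v′ w′ x)
  det-bordered-cong n {A} {A′} {v} {v′} {w} {w′} x AA′ vv′ ww′ = det-cong (suc n) λ i j _ _ → rows n i j
    where
    entries : ∀ k {f g : ℕ → Carrier} {y z} → (∀ j → f j ≈ g j) → y ≈ z → ∀ j → extend k f y j ≈ extend k g z j
    entries zero fg yz j = yz
    entries (suc k) fg yz zero = fg 0
    entries (suc k) fg yz (suc j) = entries k (fg ∘ suc) yz j
    lift : ∀ k {f g : ℕ → ℕ → Carrier} {y z : ℕ → Carrier} → (∀ i j → f i j ≈ g i j) → (∀ j → y j ≈ z j) →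
      ∀ i j → extend k f y i j ≈ extend k g z i j
    lift zero fg yz i j = yz j
    lift (suc k) fg yz zero j = fg 0 j
    lift (suc k) fg yz (suc i) j = lift k (fg ∘ suc) yz i j
    rows : ∀ k i j → extend k (λ i → extend n (A i) (v i)) (extend n w x) i j ≈ extend k (λ i → extend n (A′ i) (v′ i)) (extend n w′ x) i j
    rows k = lift k (λ i → entries n (AA′ i) (vv′ i)) (entries n ww′ refl)

  private
    fromℕ-+ : ∀ a b → fromℕ (a ℕ.+ b) ≈ fromℕ a + fromℕ b
    fromℕ-+ zero b = sym (+-identityˡ _)
    fromℕ-+ (suc a) b = trans (+-congˡ (fromℕ-+ a b)) (sym (+-assoc _ _ _))

  -- Weighted sums of squares of q-integers

  module SquareSums (x : Carrier) where
    c₂ : ℕ → Carrier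
    c₂ n = fromℕ ((n ℕ.+ 2) C 2)

    -- At x = tᵐ the first two are the sums in R, and `squareSum n` is the sum of the xⁿ⁻ᵏ [k+1]².
    -- In `highSum` the coefficient depends on 2n - i only: raising n by 1 and i by 2 preserves it,
    -- and one new term appears at i = n + 2.
    lowSum highSum squareSum : ℕ → Carrier
    lowSum zero = c₂ 0 * x ^ 0
    lowSum (suc n) = lowSum n + c₂ (suc n) * x ^ suc n
    highSum zero = 0#
    highSum (suc n) = c₂ n * x ^ suc (suc n) + x * (x * highSum n)
    squareSum zero = geometric x 1 * geometric x 1
    squareSum (suc n) = x * squareSum n + geometric x (suc (suc n)) * geometric x (suc (suc n))

    private
      c₂-suc : ∀ n → c₂ (suc n) ≈ c₂ n + fromℕ (suc (suc n))
      c₂-suc n = begin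
        fromℕ (suc (n ℕ.+ 2) C 2)
          ≡⟨ ≡.cong fromℕ (≡.sym (nCk+nC[k+1]≡[n+1]C[k+1] (n ℕ.+ 2) 1)) ⟩
        fromℕ ((n ℕ.+ 2) C 1 ℕ.+ (n ℕ.+ 2) C 2)
          ≈⟨ trans (fromℕ-+ ((n ℕ.+ 2) C 1) _) (+-comm _ _) ⟩
        c₂ n + fromℕ ((n ℕ.+ 2) C 1)
          ≡⟨ ≡.cong (λ k → c₂ n + fromℕ k) (≡.trans (nC1≡n (n ℕ.+ 2)) (ℕ.+-comm n 2)) ⟩
        c₂ n + fromℕ (suc (suc n)) ∎

      -- lowSum n ≡ (1 − x)⁻³ and linearSum n ≡ (1 − x)⁻² modulo xⁿ⁺¹.
      linearSum : ℕ → Carrier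
      linearSum zero = fromℕ 1 * x ^ 0
      linearSum (suc n) = linearSum n + fromℕ (suc (suc n)) * x ^ suc n

      low-linear : ∀ n → lowSum n + - (x * lowSum n) + - linearSum n + c₂ n * x ^ suc n ≈ 0#
      low-linear zero = solve 2 (λ x c → c :* con (+ 1) :- x :* (c :* con (+ 1)) :- c :* con (+ 1) :+ c :* (x :* con (+ 1)) := con (+ 0)) refl x (c₂ 0)
      low-linear (suc n) = begin
        lowSum n + c₂ (suc n) * P + - (x * (lowSum n + c₂ (suc n) * P)) + - (linearSum n + ν * P) + c₂ (suc n) * (x * P)
          ≈⟨ solve 7 (λ l d P x a ν c → l :+ d :* P :- x :* (l :+ d :* P) :- (a :+ ν :* P) :+ d :* (x :* P)
               := l :- x :* l :- a :+ c :* P :+ (d :- (c :+ ν)) :* P) refl (lowSum n) (c₂ (suc n)) P x (linearSum n) ν (c₂ n) ⟩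
        lowSum n + - (x * lowSum n) + - linearSum n + c₂ n * P + (c₂ (suc n) + - (c₂ n + ν)) * P
          ≈⟨ +-cong (low-linear n) (*-congʳ (+-congʳ (c₂-suc n))) ⟩
        0# + (c₂ n + ν + - (c₂ n + ν)) * P
          ≈⟨ solve 2 (λ e P → con (+ 0) :+ (e :- e) :* P := con (+ 0)) refl (c₂ n + ν) P ⟩
        0# ∎
        where
        P ν : Carrier
        P = x ^ suc n
        ν = fromℕ (suc (suc n))

      linear-geometric : ∀ n → linearSum n + - (x * linearSum n) + - geometric x (suc n) + fromℕ (suc n) * x ^ suc n ≈ 0#
      linear-geometric zero = solve 1 (λ x → let u = con (+ 1) :+ con (+ 0) in
        u :* con (+ 1) :- x :* (u :* con (+ 1)) :- u :+ u :* (x :* con (+ 1)) := con (+ 0)) refl x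
      linear-geometric (suc n) = begin
        a + (1# + μ) * P + - (x * (a + (1# + μ) * P)) + - geometric x (suc (suc n)) + (1# + μ) * (x * P)
          ≈⟨ +-congʳ (+-congˡ (-‿cong (∑-last (suc n) (x ^_)))) ⟩
        a + (1# + μ) * P + - (x * (a + (1# + μ) * P)) + - (g + P) + (1# + μ) * (x * P)
          ≈⟨ solve 5 (λ a μ P x g → a :+ (con (+ 1) :+ μ) :* P :- x :* (a :+ (con (+ 1) :+ μ) :* P) :- (g :+ P) :+ (con (+ 1) :+ μ) :* (x :* P)
               := a :- x :* a :- g :+ μ :* P) refl a μ P x g ⟩
        a + - (x * a) + - g + μ * P
          ≈⟨ linear-geometric n ⟩
        0# ∎
        where
        a μ P g : Carrier
        a = linearSum n
        μ = fromℕ (suc n)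
        P = x ^ suc n
        g = geometric x (suc n)

      telescope : ∀ n → geometric x (suc n) + x ^ suc n + - 1# + - (x * geometric x (suc n)) ≈ 0#
      telescope n = trans (+-congʳ (+-congʳ (trans (sym (∑-last (suc n) (x ^_))) (geometric-suc x (suc n)))))
        (solve 2 (λ x g → con (+ 1) :+ x :* g :- con (+ 1) :- x :* g := con (+ 0)) refl x _)

      -- The amount by which the closed form misses the recursion of `squareSum`, with [n+2] written
      -- as [n+1] + xⁿ⁺¹.
      defect : ℕ → Carrier
      defect n = lowSum (suc n) + highSum (suc n) +
        - (x * (lowSum n + highSum n) + (geometric x (suc n) + x ^ suc n) * (geometric x (suc n) + x ^ suc n))

      defect-zero : ∀ n → defect n ≈ 0#
      defect-zero zero = solve 1 (λ x → let o = con (+ 1) :+ con (+ 0) ; z = con (+ 0) ; w = o :+ x :* con (+ 1) in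
          o :* con (+ 1) :+ (con (+ 1) :+ (con (+ 1) :+ o)) :* (x :* con (+ 1)) :+ (o :* (x :* (x :* con (+ 1))) :+ x :* (x :* z))
            :- (x :* (o :* con (+ 1) :+ z) :+ w :* w) := z) refl x
      defect-zero (suc n) = begin
        defect (suc n)
          ≈⟨ +-cong (+-cong (+-cong (+-congˡ (*-congʳ (c₂-suc n))) (*-congʳ d″)) (+-congʳ (*-congʳ (c₂-suc n)))) (-‿cong (+-cong (*-congˡ (+-congʳ (+-congˡ (*-congʳ (c₂-suc n))))) (*-cong g′ g′))) ⟩
        l + (d + ν) * P + (d + ν + (1# + ν)) * (x * P) + ((d + ν) * (x * (x * P)) + x * (x * h′))
          + - (x * (l + (d + ν) * P + h′) + (g + P + x * P) * (g + P + x * P))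
          -- Subtracting x² times the previous defect eliminates the high sums. What remains is a
          -- combination of the relations `A₁`, `A₂`, `ρ` proved in `low-linear`, `linear-geometric`
          -- and `telescope`.
          ≈⟨ solve 8 (λ x l h d μ P g a →
               let one = con (+ 1)
                   ν = one :+ μ
                   h′ = d :* (x :* P) :+ x :* (x :* h)
                   E = l :+ (d :+ ν) :* P :+ (d :* (x :* P) :+ x :* (x :* h)) :- (x :* (l :+ h) :+ (g :+ P) :* (g :+ P))
                   A₁ = l :- x :* l :- a :+ d :* P
                   A₂ = a :- x :* a :- g :+ μ :* P
                   ρ = g :+ P :- one :- x :* g
               in l :+ (d :+ ν) :* P :+ (d :+ ν :+ (one :+ ν)) :* (x :* P) :+ ((d :+ ν) :* (x :* (x :* P)) :+ x :* (x :* h′))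
                  :- (x :* (l :+ (d :+ ν) :* P :+ h′) :+ (g :+ P :+ x :* P) :* (g :+ P :+ x :* P))
                  := x :* x :* E :+ (one :- x :* x) :* A₁ :+ (one :+ x) :* A₂
                     :- ρ :* (one :+ con (+ 2) :* x :* (g :+ P) :+ ρ)) refl x l h d μ P g a ⟩
        x * x * E + (1# + - (x * x)) * (l + - (x * l) + - a + d * P) + (1# + x) * (a + - (x * a) + - g + μ * P)
          + - (ρ * (1# + (1# + 1#) * x * (g + P) + ρ))
          ≈⟨ +-cong (+-cong (+-cong (*-congˡ E≈0) (*-congˡ (low-linear n))) (*-congˡ (linear-geometric n))) (-‿cong (*-congʳ (telescope n))) ⟩
        x * x * 0# + (1# + - (x * x)) * 0# + (1# + x) * 0# + - (0# * (1# + (1# + 1#) * x * (g + P) + ρ))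
          ≈⟨ solve 3 (λ x w ρ → x :* x :* con (+ 0) :+ (con (+ 1) :- x :* x) :* con (+ 0) :+ (con (+ 1) :+ x) :* con (+ 0)
               :- con (+ 0) :* (con (+ 1) :+ con (+ 2) :* x :* w :+ ρ) := con (+ 0)) refl x (g + P) ρ ⟩
        0# ∎
        where
        l h d μ ν P g a h′ ρ E : Carrier
        l = lowSum n
        h = highSum n
        d = c₂ n
        μ = fromℕ (suc n)
        ν = fromℕ (suc (suc n))
        P = x ^ suc n
        g = geometric x (suc n)
        a = linearSum n
        h′ = highSum (suc n)
        ρ = g + P + - 1# + - (x * g)
        E = l + (d + ν) * P + h′ + - (x * (l + h) + (g + P) * (g + P))
        E≈0 : E ≈ 0#
        E≈0 = trans (+-congʳ (+-congʳ (+-congˡ (*-congʳ (sym (c₂-suc n)))))) (defect-zero n)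
        d″ : c₂ (suc (suc n)) ≈ d + ν + (1# + ν)
        d″ = trans (c₂-suc (suc n)) (+-congʳ (c₂-suc n))
        g′ : geometric x (suc (suc n)) + x ^ suc (suc n) ≈ g + P + x * P
        g′ = +-congʳ (∑-last (suc n) (x ^_))

    squareSum-closed : ∀ n → squareSum n ≈ lowSum n + highSum n
    squareSum-closed zero = solve 0 (let o = con (+ 1) :+ con (+ 0) in o :* o := o :* con (+ 1) :+ con (+ 0)) refl
    squareSum-closed (suc n) = begin
      x * squareSum n + geometric x (suc (suc n)) * geometric x (suc (suc n))
        ≈⟨ +-cong (*-congˡ (squareSum-closed n)) (*-cong (∑-last (suc n) (x ^_)) (∑-last (suc n) (x ^_))) ⟩
      rhs
        ≈⟨ sym (+-identityˡ _) ⟩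
      0# + rhs
        ≈⟨ +-congʳ (sym (defect-zero n)) ⟩
      defect n + rhs
        ≈⟨ solve 2 (λ u v → u :- v :+ v := u) refl (lowSum (suc n) + highSum (suc n)) rhs ⟩
      lowSum (suc n) + highSum (suc n) ∎
      where
      rhs : Carrier
      rhs = x * (lowSum n + highSum n) + (geometric x (suc n) + x ^ suc n) * (geometric x (suc n) + x ^ suc n)

  -- Evaluation of the bordered Gram determinant

  module _ (m″ : ℕ) where
    m′ : ℕ
    m′ = suc m″
    open Blocks m′
    open Exponents m″

    rowF columnF : ℕ → Sequence → Carrier
    rowF i = row (i ℕ./ m) (i ℕ.% m)
    columnF j = column (j ℕ./ m) (j ℕ.% m)

    rowF-monic : ∀ i → MonicFunctional i (rowF i)
    rowF-monic i = ≡.subst (λ d → MonicFunctional d (rowF i)) (≡.sym (ℕ.m≡m%n+[m/n]*n i m))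
      (MonicFunctional-≈ (λ f → reflexive (≡.cong (W (i ℕ./ m) f) (≡.sym (ℕ.+-identityʳ (i ℕ.% m)))))
        (Monic⇒MonicFunctional (Monic-shifts (i ℕ.% m) (Monic-W (i ℕ./ m)))))

    columnF-monic : ∀ j → MonicFunctional j (columnF j)
    columnF-monic j = ≡.subst (λ d → MonicFunctional d (columnF j)) (≡.sym (ℕ.m≡m%n+[m/n]*n j m))
      (Monic⇒MonicFunctional (Monic-G (m ℕ.∸ (j ℕ.% m)) (j ℕ.% m) (Monic-W (j ℕ./ m))))

    -- The Gram matrix from block k on. Removing its leading block gives the member k + 1 of the
    -- same family, which is what the recursions for `A` and `B` run on.
    gramMatrix : ℕ → Matrix
    gramMatrix k i j = gram (i ℕ./ m ℕ.+ k) (i ℕ.% m) (j ℕ./ m ℕ.+ k) (j ℕ.% m)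

    rowBorder columnBorder : ℕ → Sequence
    rowBorder k i = row (i ℕ./ m ℕ.+ k) (i ℕ.% m) unit₀
    columnBorder k j = column (j ℕ./ m ℕ.+ k) (j ℕ.% m) unit₀

    B : ℕ → ℕ → Carrier
    B k n = det (suc n) (bordered n (gramMatrix k) (rowBorder k) (columnBorder k) 0#)

    hankel : ℕ → Carrier
    hankel n = det n (λ i j → moment m (suc i ℕ.+ suc j))

    hankel-bordered : ∀ n → hankel n ≈ - B 0 (suc n)
    hankel-bordered n = begin
      hankel n
        ≈⟨ sym (trans (-‿cong (det-bordered-unit n H)) (solve 1 (λ x → :- :- x := x) refl _)) ⟩
      - det (suc s) (bordered s H unit₀ unit₀ 0#)
        ≈⟨ -‿cong (sym eliminate) ⟩
      - B 0 s ∎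
      where
      s : ℕ
      s = suc n
      H : Matrix
      H i j = moment m (i ℕ.+ j)
      F : ℕ → Sequence
      F i p = rowF i (λ q → moment m (p ℕ.+ q))
      v w : Sequence
      v i = rowF i unit₀
      w j = columnF j unit₀
      eliminate : B 0 s ≈ det (suc s) (bordered s H unit₀ unit₀ 0#)
      eliminate = begin
        B 0 s
          ≈⟨ det-bordered-cong s 0#
               (λ i j → reflexive (≡.cong₂ (λ x y → gram x (i ℕ.% m) y (j ℕ.% m)) (ℕ.+-identityʳ (i ℕ./ m)) (ℕ.+-identityʳ (j ℕ./ m))))
               (λ i → reflexive (≡.cong (λ x → row x (i ℕ.% m) unit₀) (ℕ.+-identityʳ (i ℕ./ m))))
               (λ j → reflexive (≡.cong (λ x → column x (j ℕ.% m) unit₀) (ℕ.+-identityʳ (j ℕ./ m)))) ⟩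
        det (suc s) (bordered s (λ i j → columnF j (F i)) v w 0#)
          ≈⟨ det-bordered-ᵀ s (λ i j → columnF j (F i)) v w 0# ⟩
        -- Elimination works on rows, so the column basis is changed under transposition and the row
        -- basis afterwards.
        det (suc s) (bordered s (λ j i → columnF j (F i)) w v 0#)
          ≈⟨ det-bordered-eliminate s columnF-monic F unit₀ v 0# ⟩
        det (suc s) (bordered s (λ j i → F i j) unit₀ v 0#)
          ≈⟨ det-bordered-ᵀ s (λ j i → F i j) unit₀ v 0# ⟩
        det (suc s) (bordered s (λ i j → rowF i (λ q → moment m (j ℕ.+ q))) v unit₀ 0#)
          ≈⟨ det-bordered-eliminate s rowF-monic (λ j q → moment m (j ℕ.+ q)) unit₀ unit₀ 0# ⟩
        det (suc s) (bordered s (λ i j → moment m (j ℕ.+ i)) unit₀ unit₀ 0#)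
          ≈⟨ det-bordered-cong s {v = unit₀} {unit₀} {unit₀} {unit₀} 0# (λ i j → reflexive (≡.cong (moment m) (ℕ.+-comm j i))) (λ _ → refl) (λ _ → refl) ⟩
        det (suc s) (bordered s H unit₀ unit₀ 0#) ∎

    quotient-+ : ∀ i → (m ℕ.+ i) ℕ./ m ≡ suc (i ℕ./ m)
    quotient-+ i = ≡.trans (ℕ.m/n≡1+[m∸n]/n {m ℕ.+ i} {m} (ℕ.m≤m+n m i)) (≡.cong (λ x → suc (x ℕ./ m)) (ℕ.m+n∸m≡n m i))

    remainder-+ : ∀ i → (m ℕ.+ i) ℕ.% m ≡ i ℕ.% m
    remainder-+ i = ≡.trans (≡.cong (ℕ._% m) (ℕ.+-comm m i)) (ℕ.[m+n]%n≡m%n i m)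

    quotient-+-k : ∀ i k → (m ℕ.+ i) ℕ./ m ℕ.+ k ≡ i ℕ./ m ℕ.+ suc k
    quotient-+-k i k = ≡.trans (≡.cong (ℕ._+ k) (quotient-+ i)) (≡.sym (ℕ.+-suc (i ℕ./ m) k))

    gramMatrix-+ : ∀ k i j → gramMatrix k (m ℕ.+ i) (m ℕ.+ j) ≡ gramMatrix (suc k) i j
    gramMatrix-+ k i j rewrite quotient-+-k i k | quotient-+-k j k | remainder-+ i | remainder-+ j = ≡.refl

    rowBorder-+ : ∀ k i → rowBorder k (m ℕ.+ i) ≡ rowBorder (suc k) i
    rowBorder-+ k i rewrite quotient-+-k i k | remainder-+ i = ≡.refl

    columnBorder-+ : ∀ k j → columnBorder k (m ℕ.+ j) ≡ columnBorder (suc k) j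
    columnBorder-+ k j rewrite quotient-+-k j k | remainder-+ j = ≡.refl

    gramMatrix-off-block : ∀ k i j → j ℕ./ m ≢ i ℕ./ m → gramMatrix k i j ≈ 0#
    gramMatrix-off-block k i j neq = gram-off-block _ _ _ _ (ℕ.m%n<n i m) (ℕ.m%n<n j m)
      (λ eq → neq (ℕ.+-cancelʳ-≡ k (j ℕ./ m) (i ℕ./ m) eq))

    gramMatrix-leading : ∀ k i j → i < m → j < m → gramMatrix k i j ≡ gram k i k j
    gramMatrix-leading k i j i<m j<m
      rewrite ℕ.m<n⇒m/n≡0 i<m | ℕ.m<n⇒m%n≡m i<m | ℕ.m<n⇒m/n≡0 j<m | ℕ.m<n⇒m%n≡m j<m = ≡.refl

    gramMatrix-on : ∀ k i j → i < m → suc (i ℕ.+ j) ≡ m → gramMatrix k i j ≈ τ ^ k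
    gramMatrix-on k i j i<m eq = trans (reflexive (gramMatrix-leading k i j i<m j<m))
        (gram-on k i j i<m j<m (≡.trans (≡.cong suc (ℕ.+-comm j i)) eq))
      where
      j<m : j < m
      j<m = ≡.subst (suc j ≤_) eq (s≤s (ℕ.m≤n+m j i))

    gramMatrix-off : ∀ k i j → i < m → suc (i ℕ.+ j) ≢ m → gramMatrix k i j ≈ 0#
    gramMatrix-off k i j i<m neq with j ℕ.<? m
    ... | yes j<m = trans (reflexive (gramMatrix-leading k i j i<m j<m))
            (gram-off-antidiagonal k i j i<m j<m (λ eq → neq (≡.trans (≡.cong suc (ℕ.+-comm i j)) eq)))
    ... | no j≮m = gramMatrix-off-block k i j (λ eq → ℕ.<⇒≢ (ℕ.m≥n⇒m/n>0 (ℕ.≮⇒≥ j≮m)) (≡.sym (≡.trans eq (ℕ.m<n⇒m/n≡0 i<m))))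

    -- The order of a matrix made of n complete blocks and ρ further rows.
    size : ℕ → ℕ → ℕ
    size zero ρ = ρ
    size (suc n) ρ = m ℕ.+ size n ρ

    A : ℕ → ℕ → Carrier
    A k n = det n (gramMatrix k)

    -- The column paired with row 0 on the antidiagonal is the last one of the block, s = m - 1;
    -- this is how the linear coefficient of V enters.
    columnBorder-last : ∀ k → columnBorder k m′ ≈ χ 1 * corner k
    columnBorder-last k = trans
      (reflexive (≡.cong₂ (λ x y → column (x ℕ.+ k) y unit₀) (ℕ.m<n⇒m/n≡0 (ℕ.n<1+n m′)) (ℕ.m<n⇒m%n≡m (ℕ.n<1+n m′))))
      (trans (column-unit₀ k m″) (*-congʳ (reflexive (≡.cong χ (ℕ.m+n∸n≡m 1 m′)))))

    A-suc : ∀ k q → A k (m ℕ.+ q) ≈ σ m * (τ ^ k) ^ m * A (suc k) q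
    A-suc k q = trans
      (det-antidiagonal m q (gramMatrix k) (τ ^ k)
        (λ i j i<m _ eq → gramMatrix-on k i j i<m eq) (λ i j i<m _ neq → gramMatrix-off k i j i<m neq))
      (*-congˡ (det-cong q (λ i j _ _ → reflexive (gramMatrix-+ k i j))))

    -- Of the rows of a block only W_k is nonzero at 0, so the border either passes on to the later
    -- blocks or is absorbed here through row 0 and column m - 1.
    B-suc : ∀ k q → B k (m ℕ.+ q) ≈
      σ m * (τ ^ k) ^ m * B (suc k) q + - (σ m * (τ ^ k) ^ m′ * (χ 1 * (corner k * corner k)) * A (suc k) q)
    B-suc k q = trans
      (det-peel m′ q (gramMatrix k) (rowBorder k) (columnBorder k) 0# (τ ^ k)
        (λ i j i<m _ eq → gramMatrix-on k i j i<m eq)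
        (λ i j i<m _ neq → gramMatrix-off k i j i<m neq)
        (λ i _ → gramMatrix-off-block k (m ℕ.+ i) m′ λ eq →
          ℕ.0≢1+n (≡.trans (≡.sym (ℕ.m<n⇒m/n≡0 (ℕ.n<1+n m′))) (≡.trans eq (quotient-+ i))))
        (λ i i<m′ → trans (reflexive (≡.cong₂ (λ x y → row (x ℕ.+ k) y unit₀) (ℕ.m<n⇒m/n≡0 (s≤s i<m′)) (ℕ.m<n⇒m%n≡m (s≤s i<m′))))
          (row-unit₀ k i)))
      (+-cong
        (*-congˡ (det-bordered-cong q 0# (λ i j → reflexive (gramMatrix-+ k i j))
          (λ i → reflexive (rowBorder-+ k i)) (λ j → reflexive (columnBorder-+ k j))))
        (-‿cong (*-cong (*-congˡ (trans (*-congˡ (columnBorder-last k))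
            (solve 2 (λ a x → a :* (x :* a) := x :* (a :* a)) refl (corner k) (χ 1))))
          (det-cong q (λ i j _ _ → reflexive (gramMatrix-+ k i j))))))

    τ^-^ : ∀ k n → (τ ^ k) ^ n ≈ t ^ (m ℕ.* k ℕ.* n)
    τ^-^ k n = trans (^-assocʳ τ k n) (trans (^-assocʳ t m (k ℕ.* n)) (^-congʳ t (≡.sym (ℕ.*-assoc m k n))))

    A-blocks : ∀ n k ρ → A k (size n ρ) ≈ σ m ^ n * t ^ blocksExponent k n * A (n ℕ.+ k) ρ
    A-blocks zero k ρ = solve 1 (λ x → x := con (+ 1) :* con (+ 1) :* x) refl _
    A-blocks (suc n) k ρ = begin
      A k (m ℕ.+ size n ρ)
        ≈⟨ A-suc k (size n ρ) ⟩
      σ m * (τ ^ k) ^ m * A (suc k) (size n ρ)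
        ≈⟨ *-cong (*-congˡ (τ^-^ k m)) (A-blocks n (suc k) ρ) ⟩
      σ m * t ^ (m ℕ.* k ℕ.* m) * (σ m ^ n * t ^ blocksExponent (suc k) n * A (n ℕ.+ suc k) ρ)
        ≈⟨ solve 5 (λ s p x q a → s :* p :* (x :* q :* a) := s :* x :* (p :* q) :* a) refl _ _ _ _ _ ⟩
      σ m * σ m ^ n * (t ^ (m ℕ.* k ℕ.* m) * t ^ blocksExponent (suc k) n) * A (n ℕ.+ suc k) ρ
        ≈⟨ *-cong (*-congˡ (sym (^-homo-* t (m ℕ.* k ℕ.* m) _))) (reflexive (≡.cong (λ x → A x ρ) (ℕ.+-suc n k))) ⟩
      σ m ^ suc n * t ^ blocksExponent k (suc n) * A (suc n ℕ.+ k) ρ ∎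

    -- The antidiagonal partner of row 0 is column m - 1, which an incomplete block lacks.
    A-zero : ∀ k r → suc r < m → A k (suc r) ≈ 0#
    A-zero k r r<m = det-zero-row r (gramMatrix k) λ j j≤r →
      gramMatrix-off k 0 j (s≤s z≤n) (ℕ.<⇒≢ (ℕ.≤-<-trans j≤r r<m))

    -- An incomplete last block is singular without the border (`A-zero`), so no earlier block can
    -- absorb the border.
    B-blocks : ∀ n k r → suc r < m → B k (size n (suc r)) ≈ σ m ^ n * t ^ blocksExponent k n * B (n ℕ.+ k) (suc r)
    B-blocks zero k r r<m = solve 1 (λ x → x := con (+ 1) :* con (+ 1) :* x) refl _
    B-blocks (suc n) k r r<m = begin
      B k (m ℕ.+ size n (suc r))
        ≈⟨ B-suc k (size n (suc r)) ⟩
      σ m * (τ ^ k) ^ m * B (suc k) (size n (suc r)) + - (_ * A (suc k) (size n (suc r)))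
        ≈⟨ +-cong (*-cong (*-congˡ (τ^-^ k m)) (B-blocks n (suc k) r r<m))
                  (-‿cong (*-congˡ (trans (A-blocks n (suc k) (suc r)) (*-congˡ (A-zero (n ℕ.+ suc k) r r<m))))) ⟩
      σ m * t ^ (m ℕ.* k ℕ.* m) * (σ m ^ n * t ^ blocksExponent (suc k) n * B (n ℕ.+ suc k) (suc r)) + - (_ * (_ * 0#))
        ≈⟨ solve 7 (λ s p x q a y z → s :* p :* (x :* q :* a) :- y :* (z :* con (+ 0)) := s :* x :* (p :* q) :* a) refl _ _ _ _ _ _ _ ⟩
      σ m * σ m ^ n * (t ^ (m ℕ.* k ℕ.* m) * t ^ blocksExponent (suc k) n) * B (n ℕ.+ suc k) (suc r)
        ≈⟨ *-cong (*-congˡ (sym (^-homo-* t (m ℕ.* k ℕ.* m) _))) (reflexive (≡.cong (λ x → B x (suc r)) (ℕ.+-suc n k))) ⟩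
      σ m ^ suc n * t ^ blocksExponent k (suc n) * B (suc n ℕ.+ k) (suc r) ∎

    innerMatrix : ℕ → Matrix
    innerMatrix k i j = gramMatrix k (suc i) (suc j)

    inner : ℕ → ℕ → Carrier
    inner k r = det r (innerMatrix k)

    -- Row 0 and column 0 have lost their antidiagonal partners and can only be matched with the
    -- border. As g_0 = 1, both border entries are the value of W_k at 0.
    B-partial : ∀ k r → suc r < m → B k (suc r) ≈ - (corner k * corner k * inner k r)
    B-partial k r r<m = det-bordered-hook r (gramMatrix k) (rowBorder k) (columnBorder k) 0#
      (λ j j≤r → gramMatrix-off k 0 j (s≤s z≤n) (ℕ.<⇒≢ (ℕ.≤-<-trans j≤r r<m)))
      (λ i i≤r → gramMatrix-off k i 0 (ℕ.<-trans i≤r r<m)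
        (λ eq → ℕ.<⇒≢ (ℕ.≤-<-trans i≤r r<m) (≡.trans (≡.cong suc (≡.sym (ℕ.+-identityʳ i))) eq)))

    -- With m - 1 rows present, the indices 1, ..., m - 2 that remain still form a complete
    -- antidiagonal, since i + j = m - 1 pairs them among themselves.
    inner-full : ∀ k → inner k m″ ≈ σ m″ * (τ ^ k) ^ m″
    inner-full k = begin
      inner k m″
        ≡⟨ ≡.cong (inner k) (≡.sym (ℕ.+-identityʳ m″)) ⟩
      inner k (m″ ℕ.+ 0)
        ≈⟨ det-antidiagonal m″ 0 (innerMatrix k) (τ ^ k)
             (λ i j i<m″ _ eq → gramMatrix-on k (suc i) (suc j) (s≤s (ℕ.m<n⇒m<1+n i<m″)) (index i j eq))
             (λ i j i<m″ _ neq → gramMatrix-off k (suc i) (suc j) (s≤s (ℕ.m<n⇒m<1+n i<m″)) (neq ∘ index⁻¹ i j)) ⟩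
      σ m″ * (τ ^ k) ^ m″ * 1#
        ≈⟨ *-identityʳ _ ⟩
      σ m″ * (τ ^ k) ^ m″ ∎
      where
      index : ∀ i j → suc (i ℕ.+ j) ≡ m″ → suc (suc i ℕ.+ suc j) ≡ m
      index i j eq = ≡.cong suc (≡.cong suc (≡.trans (ℕ.+-suc i j) eq))
      index⁻¹ : ∀ i j → suc (suc i ℕ.+ suc j) ≡ m → suc (i ℕ.+ j) ≡ m″
      index⁻¹ i j eq = ≡.trans (≡.sym (ℕ.+-suc i j)) (ℕ.suc-injective (ℕ.suc-injective eq))

    -- Row 1 is paired with column m - 2, which is missing; between the empty and the complete inner
    -- block everything vanishes.
    inner-zero : ∀ k r → suc r < m″ → inner k (suc r) ≈ 0#
    inner-zero k r r<m″ = det-zero-row r (innerMatrix k) λ j j≤r →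
      gramMatrix-off k 1 (suc j) (s≤s (s≤s z≤n)) (ℕ.<⇒≢ (s≤s (s≤s (ℕ.≤-<-trans j≤r r<m″))))

    -- One term for each block that can absorb the border. Block i gives an extra factor
    -- t^(m(k+n-i)) compared with the last block k + n, as computed in `full-blocks`.
    cornerSum : ℕ → ℕ → Carrier
    cornerSum k zero = corner k * corner k
    cornerSum k (suc n) = t ^ (m ℕ.* suc n) * (corner k * corner k) + cornerSum (suc k) n

    -- `cornerSum` is built from the first block onwards, `squareSum` by adding the last one; this
    -- is the change of direction.
    cornerSum-last : ∀ n k → cornerSum k (suc n) ≈ τ * cornerSum k n + corner (suc n ℕ.+ k) * corner (suc n ℕ.+ k)
    cornerSum-last zero k = +-congʳ (*-congʳ (^-congʳ t (ℕ.*-identityʳ m)))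
    cornerSum-last (suc n) k = begin
      t ^ (m ℕ.* suc (suc n)) * x + cornerSum (suc k) (suc n)
        ≈⟨ +-cong (*-congʳ (trans (^-congʳ t (ℕ.*-suc m (suc n))) (^-homo-* t m (m ℕ.* suc n)))) (cornerSum-last n (suc k)) ⟩
      τ * t ^ (m ℕ.* suc n) * x + (τ * cornerSum (suc k) n + y (suc n ℕ.+ suc k))
        ≈⟨ solve 5 (λ τ p x s y → τ :* p :* x :+ (τ :* s :+ y) := τ :* (p :* x :+ s) :+ y) refl _ _ _ _ _ ⟩
      τ * (t ^ (m ℕ.* suc n) * x + cornerSum (suc k) n) + y (suc n ℕ.+ suc k)
        ≡⟨ ≡.cong (λ i → τ * cornerSum k (suc n) + y i) (ℕ.+-suc (suc n) k) ⟩
      τ * cornerSum k (suc n) + y (suc (suc n) ℕ.+ k) ∎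
      where
      x : Carrier
      x = corner k * corner k
      y : ℕ → Carrier
      y i = corner i * corner i

    -- Only the corner entry 0 is left: some block has to absorb the border.
    B-zero : ∀ k → B k 0 ≈ 0#
    B-zero k = solve 0 (con (+ 1) :* con (+ 0) :* con (+ 1) :+ con (+ 0) := con (+ 0)) refl

    B-full : ∀ n k → B k (size (suc n) 0) ≈ - (σ m ^ suc n * χ 1 * t ^ fullExponent k n * cornerSum k n)
    B-full zero k = begin
      B k (m ℕ.+ 0)
        ≈⟨ B-suc k 0 ⟩
      _ * B (suc k) 0 + - (σ m * (τ ^ k) ^ m′ * (χ 1 * (corner k * corner k)) * 1#)
        ≈⟨ +-cong (trans (*-congˡ (B-zero (suc k))) (zeroʳ _)) (-‿cong (*-congʳ (*-congʳ (*-congˡ (τ^-^ k m′))))) ⟩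
      0# + - (σ m * t ^ (m ℕ.* k ℕ.* m′) * (χ 1 * (corner k * corner k)) * 1#)
        ≈⟨ solve 4 (λ s p x a → con (+ 0) :- s :* p :* (x :* a) :* con (+ 1) := :- (s :* con (+ 1) :* x :* p :* a)) refl _ _ _ _ ⟩
      - (σ m * 1# * χ 1 * t ^ (m ℕ.* k ℕ.* m′) * (corner k * corner k)) ∎
    B-full (suc n) k = begin
      B k (m ℕ.+ size (suc n) 0)
        ≈⟨ B-suc k (size (suc n) 0) ⟩
      σ m * (τ ^ k) ^ m * B (suc k) (size (suc n) 0) + - (σ m * (τ ^ k) ^ m′ * (χ 1 * x) * A (suc k) (size (suc n) 0))
        ≈⟨ +-cong (*-cong (*-congˡ (τ^-^ k m)) (B-full n (suc k)))
                  (-‿cong (*-cong (*-congʳ (*-congˡ (τ^-^ k m′))) (A-blocks (suc n) (suc k) 0))) ⟩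
      σ m * p * - (σ m ^ suc n * χ 1 * f * cornerSum (suc k) n) + - (σ m * q * (χ 1 * x) * (σ m ^ suc n * g * 1#))
        ≈⟨ solve 9 (λ s p S X f c q x g → s :* p :* :- (S :* X :* f :* c) :- s :* q :* (X :* x) :* (S :* g :* con (+ 1))
             := :- (s :* S :* X :* (p :* f :* c :+ q :* g :* x))) refl (σ m) p (σ m ^ suc n) (χ 1) f (cornerSum (suc k) n) q x g ⟩
      - (σ m * σ m ^ suc n * χ 1 * (p * f * cornerSum (suc k) n + q * g * x))
        ≈⟨ -‿cong (*-congˡ (+-congˡ (*-congʳ merge))) ⟩
      - (σ m * σ m ^ suc n * χ 1 * (p * f * cornerSum (suc k) n + p * f * t ^ (m ℕ.* suc n) * x))
        ≈⟨ solve 6 (λ s p f c u x → :- (s :* (p :* f :* c :+ p :* f :* u :* x)) := :- (s :* (p :* f) :* (u :* x :+ c))) refl _ p f _ _ x ⟩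
      - (σ m * σ m ^ suc n * χ 1 * (p * f) * cornerSum k (suc n))
        ≈⟨ -‿cong (*-congʳ (*-congˡ (sym (^-homo-* t (m ℕ.* k ℕ.* m) (fullExponent (suc k) n))))) ⟩
      - (σ m ^ suc (suc n) * χ 1 * t ^ fullExponent k (suc n) * cornerSum k (suc n)) ∎
      where
      x p q f g : Carrier
      x = corner k * corner k
      p = t ^ (m ℕ.* k ℕ.* m)
      q = t ^ (m ℕ.* k ℕ.* m′)
      f = t ^ fullExponent (suc k) n
      g = t ^ blocksExponent (suc k) (suc n)
      merge : q * g ≈ p * f * t ^ (m ℕ.* suc n)
      merge = begin
        q * g
          ≈⟨ sym (^-homo-* t (m ℕ.* k ℕ.* m′) (blocksExponent (suc k) (suc n))) ⟩
        t ^ (m ℕ.* k ℕ.* m′ ℕ.+ blocksExponent (suc k) (suc n))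
          ≈⟨ ^-congʳ t (full-blocks (suc n) k) ⟩
        t ^ (m ℕ.* k ℕ.* m ℕ.+ fullExponent (suc k) n ℕ.+ m ℕ.* suc n)
          ≈⟨ trans (^-homo-* t (m ℕ.* k ℕ.* m ℕ.+ fullExponent (suc k) n) (m ℕ.* suc n)) (*-congʳ (^-homo-* t (m ℕ.* k ℕ.* m) (fullExponent (suc k) n))) ⟩
        p * f * t ^ (m ℕ.* suc n) ∎


    open SquareSums τ using (squareSum)

    cornerSum-squares : ∀ n → cornerSum 0 n ≈ squareSum n
    cornerSum-squares zero = corner-square 0
    cornerSum-squares (suc n) = trans (cornerSum-last n 0)
      (+-cong (*-congˡ (cornerSum-squares n))
        (trans (reflexive (≡.cong (λ k → corner k * corner k) (ℕ.+-identityʳ (suc n)))) (corner-square (suc n))))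

    hankel-partial : ∀ N n r → suc r < m → suc N ≡ size n (suc r) →
      hankel N ≈ σ m ^ n * t ^ blocksExponent 0 n * (geometric τ (suc n) * geometric τ (suc n) * inner n r)
    hankel-partial N n r r<m eq = begin
      hankel N
        ≈⟨ hankel-bordered N ⟩
      - B 0 (suc N)
        ≈⟨ -‿cong (trans (reflexive (≡.cong (B 0) eq)) (B-blocks n 0 r r<m)) ⟩
      - (σ m ^ n * t ^ blocksExponent 0 n * B (n ℕ.+ 0) (suc r))
        ≈⟨ -‿cong (*-congˡ (trans (reflexive (≡.cong (λ k → B k (suc r)) (ℕ.+-identityʳ n)))
             (trans (B-partial n r r<m) (-‿cong (*-congʳ (corner-square n)))))) ⟩
      - (σ m ^ n * t ^ blocksExponent 0 n * - (geometric τ (suc n) * geometric τ (suc n) * inner n r))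
        ≈⟨ solve 2 (λ x y → :- (x :* :- y) := x :* y) refl _ _ ⟩
      σ m ^ n * t ^ blocksExponent 0 n * (geometric τ (suc n) * geometric τ (suc n) * inner n r) ∎

    hankel-one-extra : ∀ N n → suc N ≡ size n 1 →
      hankel N ≈ σ m ^ n * (t ^ blocksExponent 0 n * (geometric τ (suc n) * geometric τ (suc n)))
    hankel-one-extra N n eq = trans (hankel-partial N n 0 (s≤s (s≤s z≤n)) eq)
      (solve 3 (λ s p q → s :* p :* (q :* con (+ 1)) := s :* (p :* q)) refl _ _ _)

    hankel-complete : ∀ N n → suc N ≡ size (suc n) 0 →
      hankel N ≈ sg m′ * σ m ^ suc n * (t ^ fullExponent 0 n * (fromℕ m * geometric t m * squareSum n))
    hankel-complete N n eq = begin
      hankel N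
        ≈⟨ hankel-bordered N ⟩
      - B 0 (suc N)
        ≈⟨ -‿cong (trans (reflexive (≡.cong (B 0) eq)) (B-full n 0)) ⟩
      - - (σ m ^ suc n * χ 1 * t ^ fullExponent 0 n * cornerSum 0 n)
        ≈⟨ -‿cong (-‿cong (*-cong (*-congʳ (*-congˡ (χ-linear m″))) (cornerSum-squares n))) ⟩
      - - (σ m ^ suc n * (sg m′ * (fromℕ m * geometric t m)) * t ^ fullExponent 0 n * squareSum n)
        ≈⟨ solve 5 (λ s g x p c → :- :- (s :* (g :* x) :* p :* c) := g :* s :* (p :* (x :* c))) refl _ _ _ _ _ ⟩
      sg m′ * σ m ^ suc n * (t ^ fullExponent 0 n * (fromℕ m * geometric t m * squareSum n)) ∎

    hankel-one-missing : ∀ N n → suc N ≡ size n m′ →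
      hankel N ≈ - (σ m ^ suc n) * (t ^ (blocksExponent 0 n ℕ.+ m ℕ.* n ℕ.* m″) * (geometric τ (suc n) * geometric τ (suc n)))
    hankel-one-missing N n eq = begin
      hankel N
        ≈⟨ hankel-partial N n m″ (ℕ.n<1+n m′) eq ⟩
      σ m ^ n * t ^ blocksExponent 0 n * (g * inner n m″)
        ≈⟨ *-congˡ (*-congˡ (trans (inner-full n) (*-congˡ (τ^-^ n m″)))) ⟩
      σ m ^ n * t ^ blocksExponent 0 n * (g * (σ m″ * t ^ (m ℕ.* n ℕ.* m″)))
        -- The inserted 1 becomes (sg m″)². By definition `σ m` is - (sg m″)² times `σ m″`, which is
        -- the origin of the minus sign.
        ≈⟨ sym (*-congˡ (*-identityˡ _)) ⟩
      σ m ^ n * t ^ blocksExponent 0 n * (1# * (g * (σ m″ * t ^ (m ℕ.* n ℕ.* m″))))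
        ≈⟨ *-congˡ (*-congʳ (sym (sg-square m″))) ⟩
      σ m ^ n * t ^ blocksExponent 0 n * (sg m″ * sg m″ * (g * (σ m″ * t ^ (m ℕ.* n ℕ.* m″))))
        ≈⟨ solve 6 (λ S p h g s q → S :* p :* (h :* h :* (g :* (s :* q))) := :- (:- h :* (h :* s) :* S) :* (p :* q :* g)) refl _ _ _ _ _ _ ⟩
      - (σ m * σ m ^ n) * (t ^ blocksExponent 0 n * t ^ (m ℕ.* n ℕ.* m″) * g)
        ≈⟨ *-congˡ (*-congʳ (sym (^-homo-* t (blocksExponent 0 n) (m ℕ.* n ℕ.* m″)))) ⟩
      - (σ m ^ suc n) * (t ^ (blocksExponent 0 n ℕ.+ m ℕ.* n ℕ.* m″) * g) ∎
      where
      g : Carrier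
      g = geometric τ (suc n) * geometric τ (suc n)

    hankel-zero : ∀ N n r → suc r < m″ → suc N ≡ size n (suc (suc r)) → hankel N ≈ 0#
    hankel-zero N n r r<m″ eq = trans (hankel-partial N n (suc r) (ℕ.<-trans (s≤s r<m″) (ℕ.n<1+n m′)) eq)
      (trans (*-congˡ (trans (*-congˡ (inner-zero n r r<m″)) (zeroʳ _))) (zeroʳ _))

open import Defs

-- The ring of formal power series in t

module PowerSeries where
  open ≡.≡-Reasoning
  open ℤ-Solver.+-*-Solver

  sumℤ-cong : ∀ n {f g : ℕ → ℤ} → (∀ i → i < n → f i ≡ g i) → sumℤ n f ≡ sumℤ n g
  sumℤ-cong zero h = ≡.refl
  sumℤ-cong (suc n) h = ≡.cong₂ ℤ._+_ (sumℤ-cong n (λ i i<n → h i (ℕ.m<n⇒m<1+n i<n))) (h n (ℕ.n<1+n n))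

  sumℤ-front : ∀ n (f : ℕ → ℤ) → sumℤ (suc n) f ≡ f 0 ℤ.+ sumℤ n (f ∘ suc)
  sumℤ-front zero f = ℤ.+-comm (+ 0) (f 0)
  sumℤ-front (suc n) f = ≡.trans (≡.cong (ℤ._+ f (suc n)) (sumℤ-front n f)) (ℤ.+-assoc (f 0) _ _)

  -- Splitting off the constant coefficient of p describes the tail of a product by a product with
  -- the tail of p; the ring laws follow by induction on the index of the coefficient.
  *ₚ-front : ∀ p q k → (p *ₚ q) (suc k) ≡ p 0 ℤ.* q (suc k) ℤ.+ ((p ∘ suc) *ₚ q) k
  *ₚ-front p q k = sumℤ-front (suc k) _

  *ₚ-back : ∀ p q k → (p *ₚ q) (suc k) ≡ (p *ₚ (q ∘ suc)) k ℤ.+ p (suc k) ℤ.* q 0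
  *ₚ-back p q k = ≡.cong₂ ℤ._+_
    (sumℤ-cong (suc k) (λ i i≤k → ≡.cong (λ j → p i ℤ.* q j) (ℕ.+-∸-assoc 1 (s≤s⁻¹ i≤k))))
    (≡.cong (λ j → p (suc k) ℤ.* q j) (ℕ.n∸n≡0 k))

  *ₚ-0 : ∀ p q → (p *ₚ q) 0 ≡ p 0 ℤ.* q 0
  *ₚ-0 p q = ℤ.+-identityˡ _

  *ₚ-cong : ∀ {p p′ q q′} → p ≈ₚ p′ → q ≈ₚ q′ → p *ₚ q ≈ₚ p′ *ₚ q′
  *ₚ-cong pp qq k = sumℤ-cong (suc k) (λ i _ → ≡.cong₂ ℤ._*_ (pp i) (qq (k ℕ.∸ i)))

  *ₚ-comm : ∀ p q → p *ₚ q ≈ₚ q *ₚ p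
  *ₚ-comm p q zero = ≡.cong (λ x → + 0 ℤ.+ x) (ℤ.*-comm (p 0) (q 0))
  *ₚ-comm p q (suc k) = begin
    (p *ₚ q) (suc k)                                  ≡⟨ *ₚ-front p q k ⟩
    p 0 ℤ.* q (suc k) ℤ.+ ((p ∘ suc) *ₚ q) k          ≡⟨ ≡.cong₂ ℤ._+_ (ℤ.*-comm (p 0) (q (suc k))) (*ₚ-comm (p ∘ suc) q k) ⟩
    q (suc k) ℤ.* p 0 ℤ.+ (q *ₚ (p ∘ suc)) k          ≡⟨ ℤ.+-comm _ ((q *ₚ (p ∘ suc)) k) ⟩
    (q *ₚ (p ∘ suc)) k ℤ.+ q (suc k) ℤ.* p 0          ≡⟨ ≡.sym (*ₚ-back q p k) ⟩
    (q *ₚ p) (suc k)                                  ∎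

  -- Stated for c p + q because `*ₚ-front` presents the tail of a product in this form, and
  -- associativity multiplies that tail once more.
  *ₚ-linearˡ : ∀ c p q r → (c ·ₚ p +ₚ q) *ₚ r ≈ₚ c ·ₚ (p *ₚ r) +ₚ q *ₚ r
  *ₚ-linearˡ c p q r zero = solve 4 (λ c p q r → con (+ 0) :+ (c :* p :+ q) :* r := c :* (con (+ 0) :+ p :* r) :+ (con (+ 0) :+ q :* r)) ≡.refl c (p 0) (q 0) (r 0)
  *ₚ-linearˡ c p q r (suc k) = begin
    ((c ·ₚ p +ₚ q) *ₚ r) (suc k)
      ≡⟨ *ₚ-front (c ·ₚ p +ₚ q) r k ⟩
    (c ℤ.* p 0 ℤ.+ q 0) ℤ.* r (suc k) ℤ.+ ((c ·ₚ (p ∘ suc) +ₚ (q ∘ suc)) *ₚ r) k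
      ≡⟨ ≡.cong (λ x → (c ℤ.* p 0 ℤ.+ q 0) ℤ.* r (suc k) ℤ.+ x) (*ₚ-linearˡ c (p ∘ suc) (q ∘ suc) r k) ⟩
    (c ℤ.* p 0 ℤ.+ q 0) ℤ.* r (suc k) ℤ.+ (c ℤ.* ((p ∘ suc) *ₚ r) k ℤ.+ ((q ∘ suc) *ₚ r) k)
      ≡⟨ solve 6 (λ c p q r a b → (c :* p :+ q) :* r :+ (c :* a :+ b) := c :* (p :* r :+ a) :+ (q :* r :+ b)) ≡.refl c (p 0) (q 0) (r (suc k)) _ _ ⟩
    c ℤ.* (p 0 ℤ.* r (suc k) ℤ.+ ((p ∘ suc) *ₚ r) k) ℤ.+ (q 0 ℤ.* r (suc k) ℤ.+ ((q ∘ suc) *ₚ r) k)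
      ≡⟨ ≡.cong₂ (λ x y → c ℤ.* x ℤ.+ y) (≡.sym (*ₚ-front p r k)) (≡.sym (*ₚ-front q r k)) ⟩
    (c ·ₚ (p *ₚ r) +ₚ q *ₚ r) (suc k) ∎

  *ₚ-assoc : ∀ p q r → (p *ₚ q) *ₚ r ≈ₚ p *ₚ (q *ₚ r)
  *ₚ-assoc p q r zero = solve 3 (λ p q r → con (+ 0) :+ (con (+ 0) :+ p :* q) :* r := con (+ 0) :+ p :* (con (+ 0) :+ q :* r)) ≡.refl (p 0) (q 0) (r 0)
  *ₚ-assoc p q r (suc k) = begin
    ((p *ₚ q) *ₚ r) (suc k)
      ≡⟨ *ₚ-front (p *ₚ q) r k ⟩
    (p *ₚ q) 0 ℤ.* r (suc k) ℤ.+ (((p *ₚ q) ∘ suc) *ₚ r) k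
      ≡⟨ ≡.cong₂ ℤ._+_ (≡.cong (ℤ._* r (suc k)) (*ₚ-0 p q)) (*ₚ-cong {q = r} (*ₚ-front p q) (λ _ → ≡.refl) k) ⟩
    p 0 ℤ.* q 0 ℤ.* r (suc k) ℤ.+ ((p 0 ·ₚ (q ∘ suc) +ₚ (p ∘ suc) *ₚ q) *ₚ r) k
      ≡⟨ ≡.cong (λ x → p 0 ℤ.* q 0 ℤ.* r (suc k) ℤ.+ x) (≡.trans (*ₚ-linearˡ (p 0) (q ∘ suc) ((p ∘ suc) *ₚ q) r k)
           (≡.cong (λ x → p 0 ℤ.* ((q ∘ suc) *ₚ r) k ℤ.+ x) (*ₚ-assoc (p ∘ suc) q r k))) ⟩
    p 0 ℤ.* q 0 ℤ.* r (suc k) ℤ.+ (p 0 ℤ.* ((q ∘ suc) *ₚ r) k ℤ.+ ((p ∘ suc) *ₚ (q *ₚ r)) k)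
      ≡⟨ solve 5 (λ p q r a b → p :* q :* r :+ (p :* a :+ b) := p :* (q :* r :+ a) :+ b) ≡.refl (p 0) (q 0) (r (suc k)) _ _ ⟩
    p 0 ℤ.* (q 0 ℤ.* r (suc k) ℤ.+ ((q ∘ suc) *ₚ r) k) ℤ.+ ((p ∘ suc) *ₚ (q *ₚ r)) k
      ≡⟨ ≡.cong (λ x → p 0 ℤ.* x ℤ.+ ((p ∘ suc) *ₚ (q *ₚ r)) k) (≡.sym (*ₚ-front q r k)) ⟩
    p 0 ℤ.* (q *ₚ r) (suc k) ℤ.+ ((p ∘ suc) *ₚ (q *ₚ r)) k
      ≡⟨ ≡.sym (*ₚ-front p (q *ₚ r) k) ⟩
    (p *ₚ (q *ₚ r)) (suc k) ∎

  tpow-suc : ∀ e k → tpow (suc e) (suc k) ≡ tpow e k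
  tpow-suc e k with k ℕ.≟ e | suc k ℕ.≟ suc e
  ... | yes _ | yes _ = ≡.refl
  ... | no _ | no _ = ≡.refl
  ... | yes k≡e | no k≢e = ⊥-elim (k≢e (≡.cong suc k≡e))
  ... | no k≢e | yes k≡e = ⊥-elim (k≢e (ℕ.suc-injective k≡e))

  0ₚ-*ₚ : ∀ q → 0ₚ *ₚ q ≈ₚ 0ₚ
  0ₚ-*ₚ q zero = ≡.refl
  0ₚ-*ₚ q (suc k) = ≡.trans (*ₚ-front 0ₚ q k) (≡.trans (ℤ.+-identityˡ _) (0ₚ-*ₚ q k))

  1ₚ-*ₚ : ∀ q → 1ₚ *ₚ q ≈ₚ q
  1ₚ-*ₚ q zero = solve 1 (λ q → con (+ 0) :+ con (+ 1) :* q := q) ≡.refl (q 0)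
  1ₚ-*ₚ q (suc k) = ≡.trans (*ₚ-front 1ₚ q k) (≡.trans (≡.cong (λ x → + 1 ℤ.* q (suc k) ℤ.+ x) (0ₚ-*ₚ q k))
    (≡.trans (ℤ.+-identityʳ _) (ℤ.*-identityˡ _)))

  *ₚ-distribʳ : ∀ r p q → (p +ₚ q) *ₚ r ≈ₚ p *ₚ r +ₚ q *ₚ r
  *ₚ-distribʳ r p q k = ≡.trans (*ₚ-cong {q = r} (λ i → ≡.cong (ℤ._+ q i) (≡.sym (ℤ.*-identityˡ (p i)))) (λ _ → ≡.refl) k)
    (≡.trans (*ₚ-linearˡ (+ 1) p q r k) (≡.cong (ℤ._+ (q *ₚ r) k) (ℤ.*-identityˡ ((p *ₚ r) k))))

  powerSeriesRing : CommutativeRing 0ℓ 0ℓ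
  powerSeriesRing = record
    { Carrier = Poly ; _≈_ = _≈ₚ_ ; _+_ = _+ₚ_ ; _*_ = _*ₚ_ ; -_ = -ₚ_ ; 0# = 0ₚ ; 1# = 1ₚ
    ; isCommutativeRing = record
      { isRing = record
        { +-isAbelianGroup = record
          { isGroup = record
            { isMonoid = record
              { isSemigroup = record
                { isMagma = record
                  { isEquivalence = record
                    { refl = λ _ → ≡.refl ; sym = λ e k → ≡.sym (e k) ; trans = λ e f k → ≡.trans (e k) (f k) }
                  ; ∙-cong = λ e f k → ≡.cong₂ ℤ._+_ (e k) (f k) }
                ; assoc = λ p q r k → ℤ.+-assoc (p k) (q k) (r k) }
              ; identity = (λ p k → ℤ.+-identityˡ (p k)) , (λ p k → ℤ.+-identityʳ (p k)) }
            ; inverse = (λ p k → ℤ.+-inverseˡ (p k)) , (λ p k → ℤ.+-inverseʳ (p k))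
            ; ⁻¹-cong = λ e k → ≡.cong ℤ.-_ (e k) }
          ; comm = λ p q k → ℤ.+-comm (p k) (q k) }
        ; *-cong = *ₚ-cong
        ; *-assoc = *ₚ-assoc
        ; *-identity = 1ₚ-*ₚ , (λ p k → ≡.trans (*ₚ-comm p 1ₚ k) (1ₚ-*ₚ p k))
        ; distrib = (λ r p q k → ≡.trans (*ₚ-comm r (p +ₚ q) k)
                      (≡.trans (*ₚ-distribʳ r p q k) (≡.cong₂ ℤ._+_ (*ₚ-comm p r k) (*ₚ-comm q r k))))
                  , *ₚ-distribʳ }
      ; *-comm = *ₚ-comm } }

  tpow-1-*ₚ-0 : ∀ p → (tpow 1 *ₚ p) 0 ≡ + 0
  tpow-1-*ₚ-0 p = *ₚ-0 (tpow 1) p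

  tpow-1-*ₚ-suc : ∀ p k → (tpow 1 *ₚ p) (suc k) ≡ p k
  tpow-1-*ₚ-suc p k = ≡.trans (*ₚ-front (tpow 1) p k)
    (≡.trans (ℤ.+-identityˡ _) (≡.trans (*ₚ-cong {q = p} (tpow-suc 0) (λ _ → ≡.refl) k) (1ₚ-*ₚ p k)))

  scale-*ₚ : ∀ c p q → (c ·ₚ p) *ₚ q ≈ₚ c ·ₚ (p *ₚ q)
  scale-*ₚ c p q k = ≡.trans (*ₚ-cong {q = q} (λ i → ≡.sym (ℤ.+-identityʳ (c ℤ.* p i))) (λ _ → ≡.refl) k)
    (≡.trans (*ₚ-linearˡ c p 0ₚ q k) (≡.trans (≡.cong (λ x → c ℤ.* (p *ₚ q) k ℤ.+ x) (0ₚ-*ₚ q k)) (ℤ.+-identityʳ _)))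

open PowerSeries

-- Powers of u as convolutions

module PowerConvolution {c ℓ : Level} (R : CommutativeRing c ℓ) (t : CommutativeRing.Carrier R) where
  open CommutativeRing R hiding (zero)
  open import Relation.Binary.Reasoning.Setoid setoid
  open IntegerCoefficientSolver R
  open Determinants R
  open Operators R t

  convolution : ℕ → ℕ → ℕ → Carrier
  convolution n k l = ∑ (suc n) (λ i → power i k * power (n ℕ.∸ i) l)

  -- The defining recursion of power turns into the same recursion for the
  -- convolution in its first index.
  power-convolution : ∀ n k l → convolution n k l ≈ power n (k ℕ.+ l)
  power-convolution n zero l = trans
    (+-cong (*-identityˡ (power n l)) (∑-zero n (λ _ _ → zeroˡ _))) (+-identityʳ _)
  power-convolution zero (suc k) l = trans (+-identityʳ _) (zeroˡ _)
  power-convolution (suc n) (suc k) l = begin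
    0# * power (suc n) l + ∑ (suc n) (λ i → power (suc i) (suc k) * p i)
      ≈⟨ trans (+-congʳ (zeroˡ _)) (+-identityˡ _) ⟩
    ∑ (suc n) (λ i → power (suc i) (suc k) * p i)
      ≈⟨ ∑-cong (suc n) {λ i → power (suc i) (suc k) * p i} {λ i → power i k * p i + s * (power i (suc k) * p i) + t * (power i (suc (suc k)) * p i)}
           (λ i _ → solve 6 (λ a b d s t p → (a :+ s :* b :+ t :* d) :* p := a :* p :+ s :* (b :* p) :+ t :* (d :* p)) refl _ _ _ _ _ _) ⟩
    ∑ (suc n) (λ i → power i k * p i + s * (power i (suc k) * p i) + t * (power i (suc (suc k)) * p i))
      ≈⟨ trans (∑-+ (suc n) (λ i → power i k * p i + s * (power i (suc k) * p i)) (λ i → t * (power i (suc (suc k)) * p i)))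
           (+-cong (trans (∑-+ (suc n) (λ i → power i k * p i) (λ i → s * (power i (suc k) * p i)))
                     (+-congˡ (∑-*ˡ (suc n) s (λ i → power i (suc k) * p i))))
                   (∑-*ˡ (suc n) t (λ i → power i (suc (suc k)) * p i))) ⟩
    convolution n k l + s * convolution n (suc k) l + t * convolution n (suc (suc k)) l
      ≈⟨ +-cong (+-cong (power-convolution n k l) (*-congˡ (power-convolution n (suc k) l))) (*-congˡ (power-convolution n (suc (suc k)) l)) ⟩
    power (suc n) (suc k ℕ.+ l) ∎
    where
    s : Carrier
    s = 1# + t
    p : ℕ → Carrier
    p i = power (n ℕ.∸ i) l

  ∑-truncate : ∀ a b (f : ℕ → Carrier) → (∀ i → i < b → f (a ℕ.+ i) ≈ 0#) → ∑ (a ℕ.+ b) f ≈ ∑ a f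
  ∑-truncate zero b f h = ∑-zero b h
  ∑-truncate (suc a) b f h = +-congˡ (∑-truncate a b (f ∘ suc) h)

  -- The coefficient in u · uᵐ. As uᵐ has order m, the convolution may stop at i = n, which is the
  -- summation range for powers of the series u/q.
  power-suc : ∀ n m → power (suc n ℕ.+ m) (suc m) ≈ ∑ (suc n) (λ i → power (suc i) 1 * power ((n ℕ.∸ i) ℕ.+ m) m)
  power-suc n m = begin
    power (suc n ℕ.+ m) (suc m)
      ≈⟨ sym (power-convolution (suc n ℕ.+ m) 1 m) ⟩
    0# * power (suc n ℕ.+ m) m + ∑ (suc n ℕ.+ m) f
      ≈⟨ trans (+-congʳ (zeroˡ _)) (+-identityˡ _) ⟩
    ∑ (suc n ℕ.+ m) f
      ≈⟨ ∑-truncate (suc n) m f (λ i i<m → trans (*-congˡ (power-< (beyond i i<m))) (zeroʳ _)) ⟩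
    ∑ (suc n) f
      ≈⟨ ∑-cong (suc n) {f} {λ i → power (suc i) 1 * power ((n ℕ.∸ i) ℕ.+ m) m} (λ i i≤n → *-congˡ (reflexive (≡.cong (λ k → power k m) (ℕ.+-∸-comm m (s≤s⁻¹ i≤n))))) ⟩
    ∑ (suc n) (λ i → power (suc i) 1 * power ((n ℕ.∸ i) ℕ.+ m) m) ∎
    where
    f : ℕ → Carrier
    f i = power (suc i) 1 * power ((n ℕ.+ m) ℕ.∸ i) m
    beyond : ∀ i → i < m → (n ℕ.+ m) ℕ.∸ (suc n ℕ.+ i) < m
    beyond i i<m = ≡.subst (_< m)
      (≡.sym (≡.trans (≡.cong ((n ℕ.+ m) ℕ.∸_) (≡.sym (ℕ.+-suc n i))) (ℕ.[m+n]∸[m+o]≡n∸o n m (suc i))))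
      (ℕ.∸-monoʳ-< (s≤s z≤n) i<m)

-- Narayana polynomials by Lagrange inversion

C-absorption : ∀ n k → suc k ℕ.* (suc n C suc k) ≡ suc n ℕ.* (n C k)
C-absorption zero zero = ≡.refl
C-absorption zero (suc k) = ≡.trans
  (≡.cong (suc (suc k) ℕ.*_) (k>n⇒nCk≡0 {1} {suc (suc k)} (s≤s (s≤s z≤n))))
  (≡.trans (ℕ.*-zeroʳ k) (≡.sym (≡.cong (1 ℕ.*_) (k>n⇒nCk≡0 {0} {suc k} (s≤s z≤n)))))
C-absorption (suc n) zero = ≡.trans (ℕ.+-identityʳ _) (≡.trans (nC1≡n (suc (suc n))) (≡.sym (ℕ.*-identityʳ (suc (suc n)))))
C-absorption (suc n) (suc k) = begin
  suc (suc k) ℕ.* (suc (suc n) C suc (suc k))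
    ≡⟨ ≡.cong (suc (suc k) ℕ.*_) (≡.sym (nCk+nC[k+1]≡[n+1]C[k+1] (suc n) (suc k))) ⟩
  suc (suc k) ℕ.* (a ℕ.+ b)
    ≡⟨ solve 3 (λ k a b → (con 2 :+ k) :* (a :+ b) := a :+ ((con 1 :+ k) :* a :+ (con 2 :+ k) :* b)) ≡.refl k a b ⟩
  a ℕ.+ (suc k ℕ.* a ℕ.+ suc (suc k) ℕ.* b)
    ≡⟨ ≡.cong (a ℕ.+_) (≡.cong₂ ℕ._+_ (C-absorption n k) (C-absorption n (suc k))) ⟩
  a ℕ.+ (suc n ℕ.* (n C k) ℕ.+ suc n ℕ.* (n C suc k))
    ≡⟨ ≡.cong (a ℕ.+_) (≡.trans (≡.sym (ℕ.*-distribˡ-+ (suc n) (n C k) (n C suc k))) (≡.cong (suc n ℕ.*_) (nCk+nC[k+1]≡[n+1]C[k+1] n k))) ⟩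
  suc (suc n) ℕ.* a ∎
  where
  open ≡.≡-Reasoning
  open +-*-Solver
  a b : ℕ
  a = suc n C suc k
  b = suc n C suc (suc k)

module NarayanaPolynomials where
  open CommutativeRing powerSeriesRing using (+-cong; refl; sym; trans; reflexive)
  open Determinants powerSeriesRing using (∑; ∑-cong; ∑-last)
  open Operators powerSeriesRing (tpow 1) using (power; power-<)
  open PowerConvolution powerSeriesRing (tpow 1) using (power-suc)

  private
    B : ℕ → ℕ → ℤ
    B n k = + (n C k)

    B-pascal : ∀ n k → B (suc n) (suc k) ≡ B n k ℤ.+ B n (suc k)
    B-pascal n k = ≡.cong +_ (≡.sym (nCk+nC[k+1]≡[n+1]C[k+1] n k))

    B-absorption : ∀ n k → + suc k ℤ.* (B n k ℤ.+ B n (suc k)) ≡ + suc n ℤ.* B n k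
    B-absorption n k = ≡.trans (≡.cong (+ suc k ℤ.*_) (≡.sym (B-pascal n k)))
      (≡.trans (≡.sym (ℤ.pos-* (suc k) _)) (≡.trans (≡.cong +_ (C-absorption n k)) (ℤ.pos-* (suc n) _)))

    B-vanish : ∀ {n k} → n < k → B n k ≡ + 0
    B-vanish n<k = ≡.cong +_ (k>n⇒nCk≡0 n<k)

    1+t-*-0 : ∀ p → ((1ₚ +ₚ tpow 1) *ₚ p) 0 ≡ p 0
    1+t-*-0 p = ≡.trans (*ₚ-distribʳ p 1ₚ (tpow 1) 0) (≡.trans (≡.cong₂ ℤ._+_ (1ₚ-*ₚ p 0) (tpow-1-*ₚ-0 p)) (ℤ.+-identityʳ (p 0)))

    1+t-*-suc : ∀ p i → ((1ₚ +ₚ tpow 1) *ₚ p) (suc i) ≡ p (suc i) ℤ.+ p i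
    1+t-*-suc p i = ≡.trans (*ₚ-distribʳ p 1ₚ (tpow 1) (suc i)) (≡.cong₂ ℤ._+_ (1ₚ-*ₚ p (suc i)) (tpow-1-*ₚ-suc p i))

  power-coefficient-0 : ∀ n k → power (suc n) (suc k) 0 ≡ power n k 0 ℤ.+ power n (suc k) 0
  power-coefficient-0 n k = ≡.trans
    (≡.cong₂ ℤ._+_ (≡.cong (λ x → power n k 0 ℤ.+ x) (1+t-*-0 (power n (suc k)))) (tpow-1-*ₚ-0 (power n (suc (suc k)))))
    (ℤ.+-identityʳ _)

  power-coefficient-suc : ∀ n k i → power (suc n) (suc k) (suc i) ≡
    power n k (suc i) ℤ.+ (power n (suc k) (suc i) ℤ.+ power n (suc k) i) ℤ.+ power n (suc (suc k)) i
  power-coefficient-suc n k i = ≡.cong₂ ℤ._+_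
    (≡.cong (λ x → power n k (suc i) ℤ.+ x) (1+t-*-suc (power n (suc k)) i)) (tpow-1-*ₚ-suc (power n (suc (suc k))) i)

  -- Lagrange inversion: n [qⁿ] uᵏ = k [zⁿ⁻ᵏ] ((1 + z) (1 + t z))ⁿ.
  power-closed : ∀ n k i → + n ℤ.* power n k i ≡ + k ℤ.* (B n i ℤ.* B n (k ℕ.+ i))
  power-closed zero zero i = ≡.refl
  power-closed zero (suc k) i = ≡.sym (≡.trans (≡.cong (λ x → + suc k ℤ.* (B 0 i ℤ.* x)) (B-vanish {0} {suc k ℕ.+ i} (s≤s z≤n)))
    (≡.trans (≡.cong (+ suc k ℤ.*_) (ℤ.*-zeroʳ (B 0 i))) (ℤ.*-zeroʳ (+ suc k))))
  power-closed (suc n) zero i = ℤ.*-zeroʳ (+ suc n)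
  power-closed (suc zero) (suc k) zero = ≡.trans (ℤ.*-identityˡ _) (≡.trans (power-coefficient-0 0 k) (base k))
    where
    base : ∀ k → power 0 k 0 ℤ.+ + 0 ≡ + suc k ℤ.* (B 1 0 ℤ.* B 1 (suc k ℕ.+ 0))
    base zero = ≡.refl
    base (suc k) = ≡.sym (≡.trans (≡.cong (λ x → + suc (suc k) ℤ.* (+ 1 ℤ.* x)) (B-vanish {1} {suc (suc k) ℕ.+ 0} (s≤s (s≤s z≤n)))) (ℤ.*-zeroʳ (+ suc (suc k))))
  power-closed (suc zero) (suc k) (suc i) = ≡.trans (ℤ.*-identityˡ _) (≡.trans (power-coefficient-suc 0 k i) (≡.trans (base k)
    (≡.sym (≡.trans (≡.cong (λ x → + suc k ℤ.* (B 1 (suc i) ℤ.* x)) (B-vanish {1} {suc k ℕ.+ suc i} (s≤s (≡.subst (1 ≤_) (≡.sym (ℕ.+-suc k i)) (s≤s z≤n)))))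
      (≡.trans (≡.cong (+ suc k ℤ.*_) (ℤ.*-zeroʳ (B 1 (suc i)))) (ℤ.*-zeroʳ (+ suc k)))))))
    where
    base : ∀ k → power 0 k (suc i) ℤ.+ + 0 ℤ.+ + 0 ≡ + 0
    base zero = ≡.refl
    base (suc k) = ≡.refl
  -- The recursion contains the coefficients themselves while the induction hypotheses know n times
  -- them, so both sides are multiplied by n and n is cancelled at the end; hence the separate
  -- treatment of n = 0.
  power-closed (suc n@(suc _)) (suc k) zero = ℤ.*-cancelˡ-≡ (+ n) _ _ (begin
    + n ℤ.* (+ suc n ℤ.* power (suc n) (suc k) 0)
      ≡⟨ ≡.cong (λ x → + n ℤ.* (+ suc n ℤ.* x)) (power-coefficient-0 n k) ⟩
    + n ℤ.* (+ suc n ℤ.* (power n k 0 ℤ.+ power n (suc k) 0))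
      ≡⟨ solve 4 (λ n n₁ p q → n :* (n₁ :* (p :+ q)) := n₁ :* (n :* p :+ n :* q)) ≡.refl (+ n) (+ suc n) (power n k 0) (power n (suc k) 0) ⟩
    + suc n ℤ.* (+ n ℤ.* power n k 0 ℤ.+ + n ℤ.* power n (suc k) 0)
      ≡⟨ ≡.cong (+ suc n ℤ.*_) (≡.cong₂ ℤ._+_ (power-closed n k 0) (power-closed n (suc k) 0)) ⟩
    + suc n ℤ.* (+ k ℤ.* (+ 1 ℤ.* B n (k ℕ.+ 0)) ℤ.+ + suc k ℤ.* (+ 1 ℤ.* B n (suc k ℕ.+ 0)))
      ≡⟨ ≡.cong (λ j → + suc n ℤ.* (+ k ℤ.* (+ 1 ℤ.* B n j) ℤ.+ + suc k ℤ.* (+ 1 ℤ.* B n (suc j)))) (ℕ.+-identityʳ k) ⟩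
    + suc n ℤ.* (+ k ℤ.* (+ 1 ℤ.* z) ℤ.+ + suc k ℤ.* (+ 1 ℤ.* w))
      ≡⟨ solve 4 (λ n k z w → (con (+ 1) :+ n) :* (k :* (con (+ 1) :* z) :+ (con (+ 1) :+ k) :* (con (+ 1) :* w))
           := (con (+ 1) :+ n) :* ((con (+ 1) :+ k) :* (z :+ w) :- z)) ≡.refl (+ n) (+ k) z w ⟩
    + suc n ℤ.* (+ suc k ℤ.* (z ℤ.+ w) ℤ.- z)
      ≡⟨ ≡.cong (λ x → + suc n ℤ.* (x ℤ.- z)) (B-absorption n k) ⟩
    + suc n ℤ.* (+ suc n ℤ.* z ℤ.- z)
      ≡⟨ solve 2 (λ n z → (con (+ 1) :+ n) :* ((con (+ 1) :+ n) :* z :- z) := n :* (con (+ 1) :* ((con (+ 1) :+ n) :* z))) ≡.refl (+ n) z ⟩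
    + n ℤ.* (+ 1 ℤ.* (+ suc n ℤ.* z))
      ≡⟨ ≡.cong (λ x → + n ℤ.* (+ 1 ℤ.* x)) (≡.sym (B-absorption n k)) ⟩
    + n ℤ.* (+ 1 ℤ.* (+ suc k ℤ.* (z ℤ.+ w)))
      ≡⟨ solve 3 (λ n k x → n :* (con (+ 1) :* (k :* x)) := n :* (k :* (con (+ 1) :* x))) ≡.refl (+ n) (+ suc k) (z ℤ.+ w) ⟩
    + n ℤ.* (+ suc k ℤ.* (+ 1 ℤ.* (z ℤ.+ w)))
      ≡⟨ ≡.cong (λ x → + n ℤ.* (+ suc k ℤ.* (+ 1 ℤ.* x))) (≡.trans (≡.sym (B-pascal n k)) (≡.cong (λ j → B (suc n) (suc j)) (≡.sym (ℕ.+-identityʳ k)))) ⟩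
    + n ℤ.* (+ suc k ℤ.* (+ 1 ℤ.* B (suc n) (suc k ℕ.+ 0))) ∎)
    where
    open ≡.≡-Reasoning
    open ℤ-Solver.+-*-Solver
    z w : ℤ
    z = B n k
    w = B n (suc k)
  power-closed (suc n@(suc _)) (suc k) (suc i) = ℤ.*-cancelˡ-≡ (+ n) _ _ (begin
    + n ℤ.* (+ suc n ℤ.* power (suc n) (suc k) (suc i))
      ≡⟨ ≡.cong (λ x → + n ℤ.* (+ suc n ℤ.* x)) (power-coefficient-suc n k i) ⟩
    + n ℤ.* (+ suc n ℤ.* (power n k (suc i) ℤ.+ (power n (suc k) (suc i) ℤ.+ power n (suc k) i) ℤ.+ power n (suc (suc k)) i))
      ≡⟨ solve 6 (λ n n₁ p q r s → n :* (n₁ :* (p :+ (q :+ r) :+ s)) := n₁ :* (n :* p :+ (n :* q :+ n :* r) :+ n :* s)) ≡.refl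
           (+ n) (+ suc n) (power n k (suc i)) (power n (suc k) (suc i)) (power n (suc k) i) (power n (suc (suc k)) i) ⟩
    + suc n ℤ.* (+ n ℤ.* power n k (suc i) ℤ.+ (+ n ℤ.* power n (suc k) (suc i) ℤ.+ + n ℤ.* power n (suc k) i) ℤ.+ + n ℤ.* power n (suc (suc k)) i)
      ≡⟨ ≡.cong (+ suc n ℤ.*_) (≡.cong₂ ℤ._+_ (≡.cong₂ ℤ._+_
           (≡.trans (power-closed n k (suc i)) (≡.cong (λ j → + k ℤ.* (y ℤ.* B n j)) (ℕ.+-suc k i)))
           (≡.cong₂ ℤ._+_ (≡.trans (power-closed n (suc k) (suc i)) (≡.cong (λ j → + suc k ℤ.* (y ℤ.* B n (suc j))) (ℕ.+-suc k i)))
             (power-closed n (suc k) i)))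
           (power-closed n (suc (suc k)) i)) ⟩
    + suc n ℤ.* (+ k ℤ.* (y ℤ.* z) ℤ.+ (+ suc k ℤ.* (y ℤ.* w) ℤ.+ + suc k ℤ.* (x ℤ.* z)) ℤ.+ + suc (suc k) ℤ.* (x ℤ.* w))
      -- The two sides differ by multiples of the absorption identities for x + y at i and for z + w
      -- at k + i + 1, displayed as the last two summands.
      ≡⟨ solve 7 (λ n k i x y z w →
           let k₁ = con (+ 1) :+ k ; a = con (+ 1) :+ i ; n₁ = con (+ 1) :+ n in
           n₁ :* (k :* (y :* z) :+ (k₁ :* (y :* w) :+ k₁ :* (x :* z)) :+ (con (+ 2) :+ k) :* (x :* w))
           := n :* (k₁ :* ((x :+ y) :* (z :+ w)))
              :+ (x :+ y) :* ((a :+ k₁) :* (z :+ w) :- n₁ :* z) :- (z :+ w) :* (a :* (x :+ y) :- n₁ :* x))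
         ≡.refl (+ n) (+ k) (+ i) x y z w ⟩
    + n ℤ.* (+ suc k ℤ.* ((x ℤ.+ y) ℤ.* (z ℤ.+ w)))
      ℤ.+ (x ℤ.+ y) ℤ.* ((+ suc i ℤ.+ + suc k) ℤ.* (z ℤ.+ w) ℤ.- + suc n ℤ.* z) ℤ.- (z ℤ.+ w) ℤ.* (+ suc i ℤ.* (x ℤ.+ y) ℤ.- + suc n ℤ.* x)
      ≡⟨ ≡.cong₂ (λ e f → + n ℤ.* (+ suc k ℤ.* ((x ℤ.+ y) ℤ.* (z ℤ.+ w))) ℤ.+ (x ℤ.+ y) ℤ.* (e ℤ.- + suc n ℤ.* z) ℤ.- (z ℤ.+ w) ℤ.* (f ℤ.- + suc n ℤ.* x))
           (≡.trans (≡.cong (λ j → + suc j ℤ.* (z ℤ.+ w)) (≡.trans (ℕ.+-suc i k) (≡.cong suc (ℕ.+-comm i k)))) (B-absorption n (suc (k ℕ.+ i)))) (B-absorption n i) ⟩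
    + n ℤ.* (+ suc k ℤ.* ((x ℤ.+ y) ℤ.* (z ℤ.+ w))) ℤ.+ (x ℤ.+ y) ℤ.* (+ suc n ℤ.* z ℤ.- + suc n ℤ.* z) ℤ.- (z ℤ.+ w) ℤ.* (+ suc n ℤ.* x ℤ.- + suc n ℤ.* x)
      ≡⟨ solve 5 (λ g u v p q → g :+ u :* (p :- p) :- v :* (q :- q) := g) ≡.refl (+ n ℤ.* (+ suc k ℤ.* ((x ℤ.+ y) ℤ.* (z ℤ.+ w)))) (x ℤ.+ y) (z ℤ.+ w) (+ suc n ℤ.* z) (+ suc n ℤ.* x) ⟩
    + n ℤ.* (+ suc k ℤ.* ((x ℤ.+ y) ℤ.* (z ℤ.+ w)))
      ≡⟨ ≡.cong₂ (λ e f → + n ℤ.* (+ suc k ℤ.* (e ℤ.* f))) (≡.sym (B-pascal n i))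
           (≡.trans (≡.sym (B-pascal n (suc (k ℕ.+ i)))) (≡.cong (λ j → B (suc n) (suc j)) (≡.sym (ℕ.+-suc k i)))) ⟩
    + n ℤ.* (+ suc k ℤ.* (B (suc n) (suc i) ℤ.* B (suc n) (suc k ℕ.+ suc i))) ∎)
    where
    open ≡.≡-Reasoning
    open ℤ-Solver.+-*-Solver
    x y z w : ℤ
    x = B n i
    y = B n (suc i)
    z = B n (suc (k ℕ.+ i))
    w = B n (suc (suc (k ℕ.+ i)))

  -- The quotient is first found as an integer p; a negative p is impossible because the product is
  -- a natural number.
  exact-quotient : ∀ (p : ℤ) X d → p ℤ.* + suc d ≡ + X → + (X ℕ./ suc d) ≡ p
  exact-quotient (+ p) X d eq = ≡.cong +_ (≡.trans (≡.cong (ℕ._/ suc d) (≡.sym (ℤ.+-injective (≡.trans (ℤ.pos-* p (suc d)) eq)))) (ℕ.m*n/n≡m p (suc d)))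
  exact-quotient -[1+ p ] X d ()

  sumP-tpow : ∀ n (c : ℕ → ℤ) i → i < n → sumP n (λ k → c k ·ₚ tpow k) i ≡ c i
  sumP-tpow-≥ : ∀ n (c : ℕ → ℤ) i → n ≤ i → sumP n (λ k → c k ·ₚ tpow k) i ≡ + 0
  sumP-tpow (suc n) c i i<1+n with i ℕ.≟ n
  ... | yes ≡.refl = ≡.trans (≡.cong₂ ℤ._+_ (sumP-tpow-≥ n c n ℕ.≤-refl) (ℤ.*-identityʳ (c n))) (ℤ.+-identityˡ _)
  ... | no i≢n = ≡.trans (≡.cong₂ ℤ._+_ (sumP-tpow n c i (ℕ.≤∧≢⇒< (s≤s⁻¹ i<1+n) i≢n)) (ℤ.*-zeroʳ (c n))) (ℤ.+-identityʳ _)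
  sumP-tpow-≥ zero c i _ = ≡.refl
  sumP-tpow-≥ (suc n) c i n<i with i ℕ.≟ n
  ... | yes ≡.refl = ⊥-elim (ℕ.<-irrefl ≡.refl n<i)
  ... | no i≢n = ≡.cong₂ ℤ._+_ (sumP-tpow-≥ n c i (ℕ.<⇒≤ n<i)) (ℤ.*-zeroʳ (c n))

  private
    narayana : ℕ → ℕ → ℤ
    narayana n k = + (((suc n C k) ℕ.* (n C k)) ℕ./ suc k)

  -- The case k = 1 of `power-closed`, followed by the absorption (i + 1) C(n+1, i+1) = (n + 1) C(n,
  -- i). This links the explicit coefficients to the recursion of u and shows that the division by i
  -- + 1 is exact.
  gamma≈power : ∀ n → gamma (suc n) ≈ₚ power (suc n) 1
  gamma≈power n i with i ℕ.<? suc n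
  ... | yes i≤n = ≡.trans (sumP-tpow (suc n) (narayana n) i i≤n) (exact-quotient p ((suc n C i) ℕ.* (n C i)) i (ℤ.*-cancelˡ-≡ (+ suc n) _ _ (begin
      + suc n ℤ.* (p ℤ.* + suc i)
        ≡⟨ solve 3 (λ n p i → n :* (p :* i) := n :* p :* i) ≡.refl (+ suc n) p (+ suc i) ⟩
      + suc n ℤ.* p ℤ.* + suc i
        ≡⟨ ≡.cong (ℤ._* + suc i) (power-closed (suc n) 1 i) ⟩
      + 1 ℤ.* (B (suc n) i ℤ.* B (suc n) (suc i)) ℤ.* + suc i
        ≡⟨ solve 3 (λ a b i → con (+ 1) :* (a :* b) :* i := a :* (i :* b)) ≡.refl (B (suc n) i) (B (suc n) (suc i)) (+ suc i) ⟩
      B (suc n) i ℤ.* (+ suc i ℤ.* B (suc n) (suc i))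
        ≡⟨ ≡.cong (B (suc n) i ℤ.*_) (≡.trans (≡.cong (+ suc i ℤ.*_) (B-pascal n i)) (B-absorption n i)) ⟩
      B (suc n) i ℤ.* (+ suc n ℤ.* B n i)
        ≡⟨ solve 3 (λ a n b → a :* (n :* b) := n :* (a :* b)) ≡.refl (B (suc n) i) (+ suc n) (B n i) ⟩
      + suc n ℤ.* (B (suc n) i ℤ.* B n i)
        ≡⟨ ≡.cong (+ suc n ℤ.*_) (≡.sym (ℤ.pos-* (suc n C i) (n C i))) ⟩
      + suc n ℤ.* + ((suc n C i) ℕ.* (n C i)) ∎)))
    where
    open ≡.≡-Reasoning
    open ℤ-Solver.+-*-Solver
    p : ℤ
    p = power (suc n) 1 i
  ... | no i≰n = ≡.trans (sumP-tpow-≥ (suc n) (narayana n) i (ℕ.≮⇒≥ i≰n)) (≡.sym (ℤ.*-cancelˡ-≡ (+ suc n) _ _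
    (≡.trans (power-closed (suc n) 1 i)
      (≡.trans (≡.cong (λ b → + 1 ℤ.* (B (suc n) i ℤ.* b)) (B-vanish (s≤s (ℕ.≮⇒≥ i≰n))))
      (≡.trans (≡.cong (+ 1 ℤ.*_) (ℤ.*-zeroʳ (B (suc n) i))) (≡.sym (ℤ.*-zeroʳ (+ suc n))))))))

  sumP≈∑ : ∀ n (f : ℕ → Poly) → sumP n f ≈ₚ ∑ n f
  sumP≈∑ zero f = refl
  sumP≈∑ (suc n) f = trans (+-cong (sumP≈∑ n f) refl) (sym (∑-last n f))

  gammaPowN≈power : ∀ m n → gammaPowN m n ≈ₚ power (n ℕ.+ m) m
  gammaPowN≈power zero zero = refl
  gammaPowN≈power zero (suc n) = refl
  gammaPowN≈power (suc m) n = trans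
    (sumP≈∑ (suc n) (λ k → gamma (suc k) *ₚ gammaPowN m (n ℕ.∸ k)))
    (trans (∑-cong (suc n) {λ k → gamma (suc k) *ₚ gammaPowN m (n ℕ.∸ k)} {λ k → power (suc k) 1 *ₚ power ((n ℕ.∸ k) ℕ.+ m) m}
        (λ k _ → *ₚ-cong (gamma≈power k) (gammaPowN≈power m (n ℕ.∸ k))))
      (trans (sym (power-suc n m)) (reflexive (≡.cong (λ a → power a (suc m)) (≡.sym (ℕ.+-suc n m))))))

  -- The coefficient of (u/q)ᵐ at a - m is that of uᵐ at a; the convention for negative indices
  -- agrees with the order m of uᵐ.
  gamma2m≈power : ∀ m a → gamma2m m (+ a ℤ.- + m) ≈ₚ power a m
  gamma2m≈power m a with a ℕ.<? m
  ... | yes a<m = trans (reflexive (≡.trans (≡.cong (gamma2m m) (≡.trans (ℤ.m-n≡m⊖n a m) (ℤ.⊖-< a<m))) (negative (m ℕ.∸ a) (ℕ.m<n⇒0<n∸m a<m))))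
      (sym (power-< a<m))
    where
    negative : ∀ d → 0 < d → gamma2m m (ℤ.- + d) ≡ 0ₚ
    negative (suc d) _ = ≡.refl
  ... | no a≮m = trans (reflexive (≡.cong (gamma2m m) (≡.trans (ℤ.m-n≡m⊖n a m) (ℤ.⊖-≥ (ℕ.≮⇒≥ a≮m)))))
      (trans (gammaPowN≈power m (a ℕ.∸ m)) (reflexive (≡.cong (λ k → power k m) (ℕ.m∸n+n≡m (ℕ.≮⇒≥ a≮m)))))

-- Determinants over finite index types

open import Data.Fin using (Fin; zero; suc; toℕ; punchIn)

-- det is defined through local functions for the sum over Fin and for the
-- signs, which have no name outside Defs.  Terms denoting them are obtained as
-- solutions of metavariables: the expansion of a matrix supported on its first
-- row exposes the local sum, and with-abstraction of the dimension, of the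
-- matrix and of the operations of ℤ makes its arguments independent variables.
module LaplaceExpansion where
  FinMatrix : ℕ → Set
  FinMatrix n = Fin n → Fin n → Poly

  finMinor : ∀ {n} → FinMatrix (suc n) → Fin (suc n) → FinMatrix n
  finMinor M j i k = M (suc i) (punchIn j k)

  private
    -- The two leading zeros make the first two Laplace terms explicit, so that the rest of the sum
    -- is the only unknown in `tail-spec`; the zero rows keep every minor free of g.
    firstRow : ∀ {n} → (Fin n → Poly) → FinMatrix (suc (suc n))
    firstRow g zero zero = 0ₚ
    firstRow g zero (suc zero) = 0ₚ
    firstRow g zero (suc (suc j)) = g j
    firstRow g (suc i) c = 0ₚ

    data Mention : Poly → Set where
      mention : ∀ p → Mention p

    mutual
      tail : ∀ n (g : Fin n → Poly) → Poly
      tail n g = _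

      tail-spec : ∀ n g → let M = firstRow g in
        (+ 1 ·ₚ 0ₚ *ₚ det (suc n) (finMinor M zero)) +ₚ
        (((ℤ.- + 1) ·ₚ 0ₚ *ₚ det (suc n) (finMinor M (suc zero))) +ₚ tail n g) ≡ det (suc (suc n)) M
      tail-spec n g = ≡.refl

    mutual
      generalised : ∀ p (M : FinMatrix (suc p)) r (g : Fin r → Poly)
        (add : ℤ → ℤ → ℤ) (attach : Sign → ℕ → ℤ) (times : Sign → Sign → Sign) (sign : ℤ → Sign) → Mention _

      abstracted : ∀ n g → Mention (tail n g)
      abstracted n g with suc n | firstRow g | ℤ._+_ | ℤ._◃_ | Sign._*_ | ℤ.sign
      ... | p | M | add | attach | times | sign = generalised p M n g add attach times sign

      generalised p M r g add attach times sign = mention _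

    mutual
      generalisedTail : ∀ p (M : FinMatrix (suc p)) r (g : Fin r → Poly)
        (add : ℤ → ℤ → ℤ) (attach : Sign → ℕ → ℤ) (times : Sign → Sign → Sign) (sign : ℤ → Sign) → Poly
      generalisedTail p M r g add attach times sign = _

      generalisedTail-spec : ∀ p M r g add attach times sign → Mention (generalisedTail p M r g add attach times sign)
      generalisedTail-spec p M r g add attach times sign = generalised p M r g add attach times sign

    mutual
      -- With addition replaced by the constant 0 the summand reduces to `λ j k → + 0`, and
      -- abstracting that function leaves the local sum applied to an arbitrary f.
      summand : ∀ p (M : FinMatrix (suc p)) r (f : Fin r → Poly) → Mention _

      abstracted₂ : ∀ p (M : FinMatrix (suc p)) r →
        Mention (generalisedTail p M r (λ _ → 0ₚ) (λ _ _ → + 0) ℤ._◃_ Sign._*_ ℤ.sign)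
      abstracted₂ p M r with (λ (j : Fin r) (k : ℕ) → + 0)
      ... | f = summand p M r f

      summand p M r f = mention _

  mutual
    localSum : ∀ p (M : FinMatrix (suc p)) r → (Fin r → Poly) → Poly
    localSum p M r f = _

    private
      localSum-spec : ∀ p M r f → Mention (localSum p M r f)
      localSum-spec p M r f = summand p M r f

  mutual
    -- An integer product is a sign attached to an absolute value. With projections for addition and
    -- for the product of signs, each product reduces to ψ applied to the sign of its left factor,
    -- so unification can read off the local sign inside the nested ψ and `sign`.
    localSign : ∀ p (M : FinMatrix (suc p)) r → Fin r → ℤ
    localSign p M r j = _

    private
      localSign-spec : ∀ p M r (ψ : Sign → ℤ) (sign : ℤ → Sign) →
        localSum p M r (λ j k → ψ (sign (ψ (sign (localSign p M r j))))) ≡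
        generalisedTail p M r (λ _ → 0ₚ) (λ x y → y) (λ s _ → ψ s) (λ s _ → s) sign
      localSign-spec p M r ψ sign = ≡.refl

  det-expand : ∀ n M → det (suc (suc n)) M ≡
    (+ 1 ·ₚ M zero zero *ₚ det (suc n) (finMinor M zero)) +ₚ
    (((ℤ.- + 1) ·ₚ M zero (suc zero) *ₚ det (suc n) (finMinor M (suc zero))) +ₚ
     localSum (suc n) M n (λ j → localSign (suc n) M n j ·ₚ M zero (suc (suc j)) *ₚ det (suc n) (finMinor M (suc (suc j)))))
  det-expand n M = ≡.refl

  private
    module S = CommutativeRing powerSeriesRing
    module D = Determinants powerSeriesRing

  toℕ-punchIn : ∀ {n} (j : Fin (suc n)) (k : Fin n) → toℕ (punchIn j k) ≡ D.skip (toℕ j) (toℕ k)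
  toℕ-punchIn zero k = ≡.refl
  toℕ-punchIn (suc j) zero = ≡.refl
  toℕ-punchIn (suc j) (suc k) = ≡.cong suc (toℕ-punchIn j k)

  localSum≈∑ : ∀ p M r {f : Fin r → Poly} {g : ℕ → Poly} → (∀ j → f j ≈ₚ g (toℕ j)) → localSum p M r f ≈ₚ D.∑ r g
  localSum≈∑ p M zero fg = S.refl
  localSum≈∑ p M (suc r) fg = S.+-cong (fg zero) (localSum≈∑ p M r (fg ∘ suc))

  sgn-scale : ∀ {s i} q → s ·ₚ q ≈ₚ D.sg i *ₚ q → (ℤ.- s) ·ₚ q ≈ₚ D.sg (suc i) *ₚ q
  sgn-scale {s} {i} q h = S.trans (λ k → ≡.sym (ℤ.neg-distribˡ-* s (q k)))
    (S.trans (S.-‿cong h) (-‿distribˡ-* (D.sg i) q))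
    where open import Algebra.Properties.Ring S.ring using (-‿distribˡ-*)

  unit-scale : ∀ q → + 1 ·ₚ q ≈ₚ D.sg 0 *ₚ q
  unit-scale q = S.trans (λ k → ℤ.*-identityˡ (q k)) (S.sym (S.*-identityˡ q))

  localSign-scale : ∀ p M r j q → localSign p M r j ·ₚ q ≈ₚ D.sg (toℕ j) *ₚ q
  localSign-scale p M (suc r) zero q = unit-scale q
  localSign-scale p M (suc r) (suc j) q = sgn-scale {localSign p M r j} {toℕ j} q (localSign-scale p M r j q)

  det≈det : ∀ n (M : FinMatrix n) (M′ : D.Matrix) → (∀ i j → M i j ≈ₚ M′ (toℕ i) (toℕ j)) → det n M ≈ₚ D.det n M′
  det≈det zero M M′ h = S.refl
  -- Size 1 is separate because `det-expand` displays two terms in front of the local sum.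
  det≈det (suc zero) M M′ h = S.+-congʳ (S.*-congʳ {1ₚ} (S.trans (unit-scale (M zero zero)) (S.*-congˡ {1ₚ} (h zero zero))))
  det≈det (suc (suc n)) M M′ h = S.trans (S.reflexive (det-expand n M))
    (S.+-cong (term zero (+ 1) (ih (det≈det (suc n)) zero) (unit-scale (M zero zero)))
      (S.+-cong (term (suc zero) (ℤ.- + 1) (ih (det≈det (suc n)) (suc zero)) (sgn-scale {+ 1} {0} (M zero (suc zero)) (unit-scale (M zero (suc zero)))))
        (localSum≈∑ (suc n) M n {g = λ i → D.laplace (suc n) M′ (suc (suc i))} λ j →
          -- `localSign` at j is the sign of column j + 2, which `sg` writes as a double negation.
          term (suc (suc j)) (localSign (suc n) M n j) (ih (det≈det (suc n)) (suc (suc j))) (S.trans (localSign-scale (suc n) M n j (M zero (suc (suc j))))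
            (S.*-congʳ {M zero (suc (suc j))} (S.sym (-‿involutive (D.sg (toℕ j)))))))))
    where
    open import Algebra.Properties.Ring S.ring using (-‿involutive)
    minors : ∀ j i k → finMinor M j i k ≈ₚ D.minor M′ (toℕ j) (toℕ i) (toℕ k)
    minors j i k = S.trans (h (suc i) (punchIn j k)) (S.reflexive (≡.cong (M′ (suc (toℕ i))) (toℕ-punchIn j k)))
    ih : (∀ N N′ → (∀ i j → N i j ≈ₚ N′ (toℕ i) (toℕ j)) → det (suc n) N ≈ₚ D.det (suc n) N′) →
      ∀ j → det (suc n) (finMinor M j) ≈ₚ D.det (suc n) (D.minor M′ (toℕ j))
    ih step j = step (finMinor M j) (D.minor M′ (toℕ j)) (minors j)
    term : ∀ j s → det (suc n) (finMinor M j) ≈ₚ D.det (suc n) (D.minor M′ (toℕ j)) → s ·ₚ M zero j ≈ₚ D.sg (toℕ j) *ₚ M zero j →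
      s ·ₚ M zero j *ₚ det (suc n) (finMinor M j) ≈ₚ D.laplace (suc n) M′ (toℕ j)
    term j s minor≈ sj = S.*-cong (S.trans sj (S.*-congˡ {D.sg (toℕ j)} (h zero j))) minor≈

-- Hankel determinants of powers of the Narayana series

module NarayanaHankel where
  private
    module S = CommutativeRing powerSeriesRing
  open Determinants powerSeriesRing using (∑; ∑-cong; sg; sg-+)
  open BorderedDeterminants powerSeriesRing using (σ)
  open Operators powerSeriesRing (tpow 1) using (power; moment; geometric; fromℕ)
  open HankelReduction powerSeriesRing (tpow 1)
  open import Algebra.Properties.Semiring.Exp S.semiring using (_^_; ^-assocʳ; ^-congˡ)
  open import Algebra.Properties.Ring S.ring using (-‿distribˡ-*)
  open NarayanaPolynomials using (gamma2m≈power; sumP≈∑)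
  open LaplaceExpansion using (det≈det)

  t : Poly
  t = tpow 1

  -- The 3 in the index is one step for each of the deleted row and column, and one because `moment`
  -- starts at the coefficient of q.
  Delta≈hankel : ∀ m″ N → Delta (suc (suc m″)) N ≈ₚ hankel m″ N
  Delta≈hankel m″ N = det≈det N _ _ λ i j → S.trans (gamma2m≈power m (toℕ i ℕ.+ toℕ j ℕ.+ 3))
      (S.reflexive (≡.cong (λ a → power a m) (index (toℕ i) (toℕ j))))
    where
    m : ℕ
    m = suc (suc m″)
    index : ∀ i j → i ℕ.+ j ℕ.+ 3 ≡ suc (suc i ℕ.+ suc j)
    index = solve 2 (λ i j → i :+ j :+ con 3 := con 1 :+ (con 1 :+ i :+ (con 1 :+ j))) ≡.refl
      where open +-*-Solver

  t^≈tpow : ∀ e → t ^ e ≈ₚ tpow e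
  t^≈tpow zero = S.refl
  t^≈tpow (suc e) = S.trans (S.*-congˡ {t} (t^≈tpow e)) shifted
    where
    shifted : tpow 1 *ₚ tpow e ≈ₚ tpow (suc e)
    shifted zero = tpow-1-*ₚ-0 (tpow e)
    shifted (suc k) = ≡.trans (tpow-1-*ₚ-suc (tpow e) k) (≡.sym (tpow-suc e k))

  t^^≈tpow : ∀ m i → (t ^ m) ^ i ≈ₚ tpow (m ℕ.* i)
  t^^≈tpow m i = S.trans (^-assocʳ t m i) (t^≈tpow (m ℕ.* i))

  sg-*ₚ : ∀ e p → sg e *ₚ p ≈ₚ sgnPow e ·ₚ p
  sg-*ₚ zero p = S.trans (S.*-identityˡ p) (λ k → ≡.sym (ℤ.*-identityˡ (p k)))
  sg-*ₚ (suc e) p = S.trans (S.sym (-‿distribˡ-* (sg e) p)) (λ k →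
    ≡.trans (≡.cong ℤ.-_ (sg-*ₚ e p k))
    (≡.trans (≡.sym (ℤ.-1*i≡-i (sgnPow e ℤ.* p k))) (≡.sym (ℤ.*-assoc ℤ.-1ℤ (sgnPow e) (p k)))))

  triangle : ℕ → ℕ
  triangle zero = 0
  triangle (suc m) = m ℕ.+ triangle m

  triangle-double : ∀ m → triangle m ℕ.* 2 ≡ m ℕ.* (m ℕ.∸ 1)
  triangle-double zero = ≡.refl
  triangle-double (suc zero) = ≡.refl
  triangle-double (suc (suc m)) = ≡.trans
    (solve 2 (λ m x → (con 1 :+ m :+ x) :* con 2 := con 2 :+ m :* con 2 :+ x :* con 2) ≡.refl m (triangle (suc m)))
    (≡.trans (≡.cong (λ x → 2 ℕ.+ m ℕ.* 2 ℕ.+ x) (triangle-double (suc m)))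
      (solve 1 (λ m → con 2 :+ m :* con 2 :+ (con 1 :+ m) :* m := (con 2 :+ m) :* (con 1 :+ m)) ≡.refl m))
    where open +-*-Solver

  σ≈sg : ∀ m → σ m ≈ₚ sg (triangle m)
  σ≈sg zero = S.refl
  σ≈sg (suc m) = S.trans (S.*-congˡ {sg m} (σ≈sg m)) (S.sym (sg-+ m (triangle m)))

  σ^≈sg : ∀ m n → σ m ^ n ≈ₚ sg (n ℕ.* triangle m)
  σ^≈sg m zero = S.refl
  σ^≈sg m (suc n) = S.trans (S.*-cong (σ≈sg m) (σ^≈sg m n)) (S.sym (sg-+ (triangle m) (n ℕ.* triangle m)))

  -- The sign of one block is (-1) to the power `triangle m`; through `triangle` the division by 2
  -- in `xi` is seen to be exact.
  xi-exponent : ∀ m n → n ℕ.* triangle m ≡ (n ℕ.* m ℕ.* (m ℕ.∸ 1)) ℕ./ 2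
  xi-exponent m n = ≡.trans (≡.sym (ℕ.m*n/n≡m (n ℕ.* triangle m) 2)) (≡.cong (ℕ._/ 2)
    (≡.trans (ℕ.*-assoc n (triangle m) 2) (≡.trans (≡.cong (n ℕ.*_) (triangle-double m)) (≡.sym (ℕ.*-assoc n m (m ℕ.∸ 1))))))

  σ^-*ₚ : ∀ m n p → (σ m ^ n) *ₚ p ≈ₚ xi m n ·ₚ p
  σ^-*ₚ m n p = S.trans (S.*-congʳ {p} (σ^≈sg m n)) (S.trans (sg-*ₚ (n ℕ.* triangle m) p)
    (S.reflexive (≡.cong (λ e → sgnPow e ·ₚ p) (xi-exponent m n))))

  fromℕ-*ₚ : ∀ n p → fromℕ n *ₚ p ≈ₚ + n ·ₚ p
  fromℕ-*ₚ zero p = 0ₚ-*ₚ p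
  fromℕ-*ₚ (suc n) p = S.trans (*ₚ-distribʳ p 1ₚ (fromℕ n)) (S.trans (S.+-cong (S.*-identityˡ p) (fromℕ-*ₚ n p))
    (λ k → solve 2 (λ n x → x :+ n :* x := (con (+ 1) :+ n) :* x) ≡.refl (+ n) (p k)))
    where open ℤ-Solver.+-*-Solver

  fromℕ-*ₚ-tpow : ∀ n {p e} → p ≈ₚ tpow e → fromℕ n *ₚ p ≈ₚ + n ·ₚ tpow e
  fromℕ-*ₚ-tpow n {p} pe = S.trans (fromℕ-*ₚ n p) (λ k → ≡.cong (+ n ℤ.*_) (pe k))

  geometric≈qint : ∀ m n → geometric (t ^ m) n ≈ₚ qint m n
  geometric≈qint m n = S.trans (∑-cong n (λ i _ → t^^≈tpow m i)) (S.sym (sumP≈∑ n (λ i → tpow (m ℕ.* i))))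

  geometric-t≈qint : ∀ n → geometric t n ≈ₚ qint 1 n
  geometric-t≈qint n = S.trans (∑-cong n (λ i _ → ^-congˡ i (S.sym (S.*-identityʳ t)))) (geometric≈qint 1 n)

  module _ (m : ℕ) where
    open SquareSums (t ^ m)

    private
      lowTerm : ℕ → Poly
      lowTerm i = + ((i ℕ.+ 2) C 2) ·ₚ tpow (m ℕ.* i)

      highTerm : ℕ → ℕ → Poly
      highTerm n j = let i = suc n ℕ.+ j in + (((2 ℕ.* n ℕ.∸ i) ℕ.+ 2) C 2) ·ₚ tpow (m ℕ.* i)

    lowSum≈ : ∀ n → lowSum n ≈ₚ sumP (suc n) lowTerm
    lowSum≈ zero = S.trans (fromℕ-*ₚ-tpow (2 C 2) (t^^≈tpow m 0)) (S.sym (S.+-identityˡ (lowTerm 0)))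
    lowSum≈ (suc n) = S.+-cong (lowSum≈ n) (fromℕ-*ₚ-tpow ((suc n ℕ.+ 2) C 2) (t^^≈tpow m (suc n)))

    private
      first-index : ∀ n → 2 ℕ.* suc n ℕ.∸ (suc (suc n) ℕ.+ 0) ≡ n
      first-index n = ≡.trans (≡.cong₂ ℕ._∸_ (solve 1 (λ n → con 2 :* (con 1 :+ n) := con 2 :+ n :+ n) ≡.refl n) (ℕ.+-identityʳ (suc (suc n))))
        (ℕ.m+n∸m≡n (suc (suc n)) n)
        where open +-*-Solver

      next-index : ∀ n j → 2 ℕ.* suc n ℕ.∸ (suc (suc n) ℕ.+ suc j) ≡ 2 ℕ.* n ℕ.∸ (suc n ℕ.+ j)
      next-index n j = ≡.cong₂ ℕ._∸_ (ℕ.+-suc n (n ℕ.+ 0)) (≡.cong suc (ℕ.+-suc n j))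

      t^m-shift : ∀ i → (t ^ m) *ₚ ((t ^ m) *ₚ tpow (m ℕ.* i)) ≈ₚ tpow (m ℕ.* suc (suc i))
      t^m-shift i = S.trans (S.*-congˡ {t ^ m} (S.*-congˡ {t ^ m} (S.sym (t^^≈tpow m i)))) (t^^≈tpow m (suc (suc i)))

    -- The step n ↦ n + 1, i ↦ i + 2 that fixes 2n - i; it matches the recursion of `highSum`.
    highTerm-shift : ∀ n j → (t ^ m) *ₚ ((t ^ m) *ₚ highTerm n j) ≈ₚ highTerm (suc n) (suc j)
    highTerm-shift n j = S.trans (S.*-congˡ {t ^ m} (scaleʳ (t ^ m) (tpow (m ℕ.* i))))
      (S.trans (scaleʳ (t ^ m) ((t ^ m) *ₚ tpow (m ℕ.* i)))
      (S.trans (λ k → ≡.cong (b ℤ.*_) (t^m-shift i k))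
        (S.reflexive (≡.cong₂ (λ x y → + ((x ℕ.+ 2) C 2) ·ₚ tpow (m ℕ.* y)) (≡.sym (next-index n j)) (≡.cong (λ i → suc (suc i)) (≡.sym (ℕ.+-suc n j)))))))
      where
      i : ℕ
      i = suc n ℕ.+ j
      b : ℤ
      b = + (((2 ℕ.* n ℕ.∸ i) ℕ.+ 2) C 2)
      scaleʳ : ∀ p q → p *ₚ (b ·ₚ q) ≈ₚ b ·ₚ (p *ₚ q)
      scaleʳ p q = S.trans (S.*-comm p (b ·ₚ q)) (S.trans (scale-*ₚ b q p) (λ k → ≡.cong (b ℤ.*_) (S.*-comm q p k)))

    highSum≈∑ : ∀ n → highSum n ≈ₚ ∑ n (highTerm n)
    highSum≈∑ zero = S.refl
    highSum≈∑ (suc n) = S.+-cong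
      (S.trans (fromℕ-*ₚ-tpow ((n ℕ.+ 2) C 2) (t^^≈tpow m (suc (suc n))))
        (S.reflexive (≡.cong₂ (λ x y → + ((x ℕ.+ 2) C 2) ·ₚ tpow (m ℕ.* y)) (≡.sym (first-index n)) (≡.sym (ℕ.+-identityʳ (suc (suc n)))))))
      (S.trans (S.*-congˡ {t ^ m} (S.trans (S.*-congˡ {t ^ m} (highSum≈∑ n)) (S.sym (∑-*ˡ n (t ^ m) (highTerm n)))))
        (S.trans (S.sym (∑-*ˡ n (t ^ m) (λ j → (t ^ m) *ₚ highTerm n j)))
          (∑-cong n {λ j → (t ^ m) *ₚ ((t ^ m) *ₚ highTerm n j)} {highTerm (suc n) ∘ suc} (λ j _ → highTerm-shift n j))))
      where open Determinants powerSeriesRing using (∑-*ˡ)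

    -- The factor m [m] comes from the linear coefficient of V, the bracket from the squares of the
    -- values W_k(0).
    R≈squareSum : ∀ n → fromℕ m *ₚ geometric t m *ₚ squareSum n ≈ₚ R m n
    R≈squareSum n = S.*-cong
      (S.trans (fromℕ-*ₚ m (geometric t m)) (λ k → ≡.cong (+ m ℤ.*_) (geometric-t≈qint m k)))
      (S.trans (squareSum-closed n) (S.+-cong (lowSum≈ n) (S.trans (highSum≈∑ n) (S.sym (sumP≈∑ n (highTerm n))))))

  size≡ : ∀ m″ n ρ → size m″ n ρ ≡ n ℕ.* suc (suc m″) ℕ.+ ρ
  size≡ m″ zero ρ = ≡.refl
  size≡ m″ (suc n) ρ = ≡.trans (≡.cong (suc (suc m″) ℕ.+_) (size≡ m″ n ρ)) (≡.sym (ℕ.+-assoc (suc (suc m″)) (n ℕ.* suc (suc m″)) ρ))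

  module _ (m″ : ℕ) where
    private
      m : ℕ
      m = suc (suc m″)
    open Exponents m″

    qint² : ℕ → Poly
    qint² n = qint m n *ₚ qint m n

    private
      geometric² : ∀ n → geometric (t ^ m) n *ₚ geometric (t ^ m) n ≈ₚ qint² n
      geometric² n = S.*-cong (geometric≈qint m n) (geometric≈qint m n)

      t^-exponent : ∀ {e e′} → e ≡ e′ → t ^ e ≈ₚ tpow e′
      t^-exponent {e} ≡.refl = t^≈tpow e

    -- Bordering restores one row, so the Gram matrix has N + 1 = mn + 1 rows: n complete blocks and
    -- a single further row.
    Delta-mn : ∀ n → Delta m (m ℕ.* n) ≈ₚ xi m n ·ₚ (tpow ((m ℕ.* m ℕ.* n ℕ.* (n ℕ.∸ 1)) ℕ./ 2) *ₚ qint² (n ℕ.+ 1))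
    Delta-mn n = S.trans (Delta≈hankel m″ (m ℕ.* n)) (S.trans
      (hankel-one-extra m″ (m ℕ.* n) n (≡.trans (≡.cong suc (ℕ.*-comm m n)) (≡.trans (ℕ.+-comm 1 (n ℕ.* m)) (≡.sym (size≡ m″ n 1)))))
      (S.trans (S.*-congˡ {σ m ^ n} (S.*-cong (t^-exponent (blocks-exponent n))
          (S.trans (geometric² (suc n)) (S.reflexive (≡.cong qint² (ℕ.+-comm 1 n))))))
        (σ^-*ₚ m n _)))

    Delta-mn-1 : ∀ n → Delta m (m ℕ.* suc n ℕ.∸ 1) ≈ₚ
      (sgnPow (m ℕ.∸ 1) ℤ.* xi m (suc n)) ·ₚ (tpow ((m ℕ.* n ℕ.* (m ℕ.* suc n ℕ.∸ 2)) ℕ./ 2) *ₚ R m n)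
    Delta-mn-1 n = S.trans (Delta≈hankel m″ (m ℕ.* suc n ℕ.∸ 1)) (S.trans
      (hankel-complete m″ (m ℕ.* suc n ℕ.∸ 1) n (≡.trans (ℕ.*-comm m (suc n)) (≡.trans (≡.sym (ℕ.+-identityʳ (suc n ℕ.* m))) (≡.sym (size≡ m″ (suc n) 0)))))
      (S.trans (S.*-congˡ {sg (suc m″) *ₚ (σ m ^ suc n)} (S.*-cong (t^-exponent (full-exponent n)) (R≈squareSum m n)))
      (S.trans (S.*-assoc (sg (suc m″)) (σ m ^ suc n) p)
      (S.trans (S.*-congˡ {sg (suc m″)} {(σ m ^ suc n) *ₚ p} {xi m (suc n) ·ₚ p} (σ^-*ₚ m (suc n) p))
      (S.trans (sg-*ₚ (suc m″) (xi m (suc n) ·ₚ p)) (λ k → ≡.sym (ℤ.*-assoc (sgnPow (suc m″)) (xi m (suc n)) (p k))))))))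
      where
      p : Poly
      p = tpow ((m ℕ.* n ℕ.* (m ℕ.* suc n ℕ.∸ 2)) ℕ./ 2) *ₚ R m n

    -- Here N + 1 is one less than m (n + 1): the last block lacks exactly one row.
    Delta-mn-2 : ∀ n → Delta m (m ℕ.* suc n ℕ.∸ 2) ≈ₚ
      (ℤ.- xi m (suc n)) ·ₚ (tpow ((m ℕ.* n ℕ.* (m ℕ.* suc n ℕ.∸ 4)) ℕ./ 2) *ₚ qint² (suc n))
    Delta-mn-2 n = S.trans (Delta≈hankel m″ (m ℕ.* suc n ℕ.∸ 2)) (S.trans
      (hankel-one-missing m″ (m ℕ.* suc n ℕ.∸ 2) n (≡.trans (≡.cong (λ x → suc (x ℕ.∸ 2)) (ℕ.*-comm m (suc n)))
        (≡.trans (ℕ.+-comm (suc m″) (n ℕ.* m)) (≡.sym (size≡ m″ n (suc m″))))))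
      (S.trans (S.*-congˡ { -ₚ (σ m ^ suc n) } (S.*-cong (t^-exponent (partial-exponent n)) (geometric² (suc n))))
      (S.trans (S.sym (-‿distribˡ-* (σ m ^ suc n) p))
      (S.trans (S.-‿cong {(σ m ^ suc n) *ₚ p} {xi m (suc n) ·ₚ p} (σ^-*ₚ m (suc n) p)) (λ k → ℤ.neg-distribˡ-* (xi m (suc n)) (p k))))))
      where
      p : Poly
      p = tpow ((m ℕ.* n ℕ.* (m ℕ.* suc n ℕ.∸ 4)) ℕ./ 2) *ₚ qint² (suc n)

    -- The excluded forms of N are the residues 1, 0 and m - 1 of N + 1 modulo m; any other residue
    -- gives a last block whose inner part is nonempty and incomplete.
    Delta-other : ∀ N → (∀ n → N ≢ m ℕ.* n) → (∀ n → 1 ≤ n → N ≢ m ℕ.* n ℕ.∸ 1) → (∀ n → 1 ≤ n → N ≢ m ℕ.* n ℕ.∸ 2) →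
      Delta m N ≈ₚ 0ₚ
    Delta-other N ≢₀ ≢₁ ≢₂ = S.trans (Delta≈hankel m″ N) (cases (suc N ℕ./ m) (suc N ℕ.% m) (ℕ.m%n<n (suc N) m)
      (≡.trans (ℕ.m≡m%n+[m/n]*n (suc N) m) (ℕ.+-comm (suc N ℕ.% m) _)))
      where
      cases : ∀ q r → r < m → suc N ≡ q ℕ.* m ℕ.+ r → hankel m″ N ≈ₚ 0ₚ
      cases (suc q) zero _ eq = ⊥-elim (≢₁ (suc q) (s≤s z≤n)
        (≡.cong (ℕ._∸ 1) (≡.trans eq (≡.trans (ℕ.+-identityʳ (suc q ℕ.* m)) (ℕ.*-comm (suc q) m)))))
      cases q (suc zero) _ eq = ⊥-elim (≢₀ q (≡.trans (ℕ.suc-injective (≡.trans eq (ℕ.+-comm (q ℕ.* m) 1))) (ℕ.*-comm q m)))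
      cases q (suc (suc r)) r<m eq with r ℕ.<? m″
      ... | no r≮m″ = ⊥-elim (ℕ.<⇒≱ r<m (s≤s (s≤s (ℕ.≮⇒≥ r≮m″))))
      ... | yes r<m″ with suc r ℕ.≟ m″
      ...   | yes ≡.refl = ⊥-elim (≢₂ (suc q) (s≤s z≤n)
                (≡.trans (≡.cong (ℕ._∸ 1) (≡.trans eq (ℕ.+-comm (q ℕ.* m) (suc m″)))) (≡.cong (ℕ._∸ 2) (ℕ.*-comm (suc q) m))))
      ...   | no r≢ = hankel-zero m″ N q r (ℕ.≤∧≢⇒< r<m″ r≢) (≡.trans eq (≡.sym (size≡ m″ q (suc (suc r)))))

open import Data.Nat using (ℕ; _+_; _*_; _∸_; _/_; _≤_)
open import Data.Integer using (-_)
open import Data.Product using (_×_)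
open import Relation.Binary.PropositionalEquality using (_≢_)

theorem1p7 : (m : ℕ) → 3 ≤ m →
    ((n : ℕ) →
    Delta m (m * n) ≈ₚ
    xi m n ·ₚ (tpow ((m * m * n * (n ∸ 1)) / 2) *ₚ (qint m (n + 1) *ₚ qint m (n + 1))))
    × ((n : ℕ) → 1 ≤ n →
    Delta m (m * n ∸ 1) ≈ₚ
    (sgnPow (m ∸ 1) Data.Integer.* xi m n) ·ₚ (tpow ((m * (n ∸ 1) * (m * n ∸ 2)) / 2) *ₚ R m (n ∸ 1)))
    × ((n : ℕ) → 1 ≤ n →
    Delta m (m * n ∸ 2) ≈ₚ
    (- xi m n) ·ₚ (tpow ((m * (n ∸ 1) * (m * n ∸ 4)) / 2) *ₚ (qint m n *ₚ qint m n)))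
    × ((N : ℕ) →
    ((n : ℕ) → N ≢ m * n) →
    ((n : ℕ) → 1 ≤ n → N ≢ m * n ∸ 1) →
    ((n : ℕ) → 1 ≤ n → N ≢ m * n ∸ 2) →
    Delta m N ≈ₚ 0ₚ)
theorem1p7 (suc zero) (s≤s ())
theorem1p7 (suc (suc m″)) _ =
  Delta-mn m″ ,
  (λ { (suc n) _ → Delta-mn-1 m″ n }) ,
  (λ { (suc n) _ → Delta-mn-2 m″ n }) ,
  Delta-other m″
  where open NarayanaHankel
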